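{- There exists an absolute constant $c>0$ such that for all integers $n,m\ge1$ and all (possibly partial) Boolean functions $f_1,f_2,\dots,f_n$ on $\{ -1,+1\}^m$, $$T_{1/3}\left(\bigotimes_{i=1}^nf_i\right)\ \ge\ c\sum_{i=1}^n\deg_{1/3}(f_i).$$
   Context: A (possibly partial) Boolean function $f$ on a finite set $X$ is a map $f:\operatorname{dom}f\to\{ -1,+1\}$ with $\varnothing\ne\operatorname{dom}f\subseteq X$. For $X=\{ -1,+1\}^m$, $\deg_\epsilon(f)$ is the least degree of a real polynomial $p$ such that $|f(x)-p(x)|\le\epsilon$ for $x\in\operatorname{dom}f$ and $|p(x)|\le1+\epsilon$ for $x\in X\setminus\operatorname{dom}f$. $\bigotimes_{i=1}^n f_i$ is the (possibly partial) Boolean function on $(\{ -1,+1\}^m)^n$ with domain $\prod\operatorname{dom}f_i$ and value $\prod_{i=1}^n f_i(x_i)$. A quantum query algorithm with $T$ queries on unknown input $x\in\{ -1,+1\}^N$ starts in a fixed state, applies $U_TO_xU_{T-1}O_x\cdots U_1O_xU_0$, where the $U_j$ are input-independent unitaries and $O_x$ is the input oracle (mapping $|i,b,w\rangle$ to $|i,b\oplus b_i,w\rangle$ with $b_i=1$ if $x_i=-1$ and $b_i=0$ if $x_i=+1$), and outputs the result of a measurement. Its cost is the number $T$ of queries. $T_\epsilon(f)$ is the least cost of a quantum query algorithm that outputs $f(x)$ with probability at least $1-\epsilon$ on every $x\in\operatorname{dom}f$. -}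

module Defs where

open import Algebra.Bundles.Raw using (RawRing)
import Algebra.Definitions.RawSemiring as RawSemiringDefinitions
open import Data.Bool.Base using (Bool; true; false; _xor_; if_then_else_)
open import Data.Bool.Properties using () renaming (_≟_ to _≟ᵇ_)
open import Data.Fin.Base using (Fin; zero; suc)
open import Data.Fin.Properties using () renaming (_≟_ to _≟ᶠ_)
open import Data.Integer.Base using (+_)
open import Data.List.Base using (List; []; _∷_)
open import Data.Maybe.Base using (Maybe; just; nothing; zipWith)
open import Data.Nat.Base as ℕ using (ℕ; zero; suc)
import Data.Nat.Properties as ℕ
open import Data.Product.Base using (∃; ∃-syntax; _×_; _,_; proj₁; proj₂)
open import Data.Product.Properties using () renaming (≡-dec to ×-≡-dec)
open import Data.Rational.Base as ℚ using (ℚ; 0ℚ; 1ℚ; ½) renaming (∣_∣ to abs)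
import Data.Rational.Properties as ℚ
open import Data.Rational.Solver using (module +-*-Solver)
open import Data.Sign.Base as Sign using (Sign)
open import Data.Sum.Base using ([_,_]′)
open import Data.Vec.Base as Vec using (Vec; []; _∷_; lookup; concat; group)
open import Data.Vec.Properties using (++-injective) renaming (≡-dec to Vec-≡-dec)
open import Level using (0ℓ)
open import Relation.Binary.PropositionalEquality
  using (_≡_; refl; sym; trans; cong; cong₂; subst; module ≡-Reasoning)
open import Relation.Nullary using (does)

-- Real numbers: Cauchy sequences of rationals, with equality _≈ᴿ_.

IsCauchy : (ℕ → ℚ) → Set
IsCauchy x = ∀ ε → 0ℚ ℚ.< ε →
  ∃[ N ] ∀ i j → N ℕ.≤ i → N ℕ.≤ j → abs (x i ℚ.- x j) ℚ.< ε

record ℝ : Set where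
  constructor mkℝ
  field
    seq    : ℕ → ℚ
    cauchy : IsCauchy seq

open ℝ public

infix 4 _≈ᴿ_ _≤ᴿ_ _<ᴿ_

record _≈ᴿ_ (x y : ℝ) : Set where
  constructor mk≈ᴿ
  field
    eventually : ∀ ε → 0ℚ ℚ.< ε →
      ∃[ N ] ∀ i → N ℕ.≤ i → abs (seq x i ℚ.- seq y i) ℚ.< ε

record _≤ᴿ_ (x y : ℝ) : Set where
  constructor mk≤ᴿ
  field
    eventually : ∀ ε → 0ℚ ℚ.< ε →
      ∃[ N ] ∀ i → N ℕ.≤ i → seq x i ℚ.< seq y i ℚ.+ ε

record _<ᴿ_ (x y : ℝ) : Set where
  constructor mk<ᴿ
  field
    gap        : ℚ
    gap>0      : 0ℚ ℚ.< gap
    eventually : ∃[ N ] ∀ i → N ℕ.≤ i → seq x i ℚ.+ gap ℚ.< seq y i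

-- Only the underlying sequences of the operations below matter for the
-- relations above, so the convergence proofs are kept opaque.

abstract

  half-pos : ∀ {ε} → 0ℚ ℚ.< ε → 0ℚ ℚ.< ½ ℚ.* ε
  half-pos {ε} ε>0 = ℚ.positive⁻¹ _ {{ℚ.pos*pos⇒pos ½ ε {{ℚ.positive ε>0}}}}

  halves : ∀ ε → ½ ℚ.* ε ℚ.+ ½ ℚ.* ε ≡ ε
  halves ε = trans (sym (ℚ.*-distribʳ-+ ε ½ ½)) (ℚ.*-identityˡ ε)

  const-cauchy : ∀ q → IsCauchy (λ _ → q)
  const-cauchy q ε ε>0 = 0 , λ _ _ _ _ →
    subst (λ t → abs t ℚ.< ε) (sym (ℚ.+-inverseʳ q)) ε>0

  +-cauchy : ∀ x y → IsCauchy x → IsCauchy y → IsCauchy (λ i → x i ℚ.+ y i)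
  +-cauchy x y cx cy ε ε>0
    with cx (½ ℚ.* ε) (half-pos ε>0) | cy (½ ℚ.* ε) (half-pos ε>0)
  ... | M , hx | N , hy = M ℕ.⊔ N , λ i j hi hj → begin-strict
      abs ((x i ℚ.+ y i) ℚ.- (x j ℚ.+ y j))
        ≡⟨ cong abs (rearrange (x i) (y i) (x j) (y j)) ⟩
      abs ((x i ℚ.- x j) ℚ.+ (y i ℚ.- y j))
        ≤⟨ ℚ.∣p+q∣≤∣p∣+∣q∣ (x i ℚ.- x j) (y i ℚ.- y j) ⟩
      abs (x i ℚ.- x j) ℚ.+ abs (y i ℚ.- y j)
        <⟨ ℚ.+-mono-< (hx i j (ℕ.m⊔n≤o⇒m≤o M N hi) (ℕ.m⊔n≤o⇒m≤o M N hj))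
                      (hy i j (ℕ.m⊔n≤o⇒n≤o M N hi) (ℕ.m⊔n≤o⇒n≤o M N hj)) ⟩
      ½ ℚ.* ε ℚ.+ ½ ℚ.* ε
        ≡⟨ halves ε ⟩
      ε ∎
    where
    open ℚ.≤-Reasoning
    rearrange : ∀ a b c d → (a ℚ.+ b) ℚ.- (c ℚ.+ d) ≡ (a ℚ.- c) ℚ.+ (b ℚ.- d)
    rearrange = solve 4 (λ a b c d → (a :+ b) :- (c :+ d) := (a :- c) :+ (b :- d)) refl
      where open +-*-Solver

  neg-cauchy : ∀ x → IsCauchy x → IsCauchy (λ i → ℚ.- x i)
  neg-cauchy x cx ε ε>0 = proj₁ (cx ε ε>0) , λ i j hi hj →
    subst (ℚ._< ε)
      (trans (sym (ℚ.∣-p∣≡∣p∣ (x i ℚ.- x j)))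
             (cong abs (ℚ.neg-distrib-+ (x i) (ℚ.- x j))))
      (proj₂ (cx ε ε>0) i j hi hj)

  ∣p∣≤∣p-q∣+∣q∣ : ∀ p q → abs p ℚ.≤ abs (p ℚ.- q) ℚ.+ abs q
  ∣p∣≤∣p-q∣+∣q∣ p q =
    subst (λ t → abs t ℚ.≤ abs (p ℚ.- q) ℚ.+ abs q) (cancel p q)
      (ℚ.∣p+q∣≤∣p∣+∣q∣ (p ℚ.- q) q)
    where
    cancel : ∀ a b → (a ℚ.- b) ℚ.+ b ≡ a
    cancel = solve 2 (λ a b → (a :- b) :+ b := a) refl
      where open +-*-Solver

  ∣p∣-∣q∣≤∣p-q∣ : ∀ p q → abs p ℚ.- abs q ℚ.≤ abs (p ℚ.- q)
  ∣p∣-∣q∣≤∣p-q∣ p q =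
    subst (abs p ℚ.- abs q ℚ.≤_) (cancel (abs (p ℚ.- q)) (abs q))
      (ℚ.+-monoˡ-≤ (ℚ.- abs q) (∣p∣≤∣p-q∣+∣q∣ p q))
    where
    cancel : ∀ a b → (a ℚ.+ b) ℚ.- b ≡ a
    cancel = solve 2 (λ a b → (a :+ b) :- b := a) refl
      where open +-*-Solver

  ∣p-q∣≡∣q-p∣ : ∀ p q → abs (p ℚ.- q) ≡ abs (q ℚ.- p)
  ∣p-q∣≡∣q-p∣ p q =
    trans (sym (ℚ.∣-p∣≡∣p∣ (p ℚ.- q))) (cong abs (flip p q))
    where
    flip : ∀ a b → ℚ.- (a ℚ.- b) ≡ b ℚ.- a
    flip = solve 2 (λ a b → :- (a :- b) := b :- a) refl
      where open +-*-Solver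

  ∣∣p∣-∣q∣∣≤∣p-q∣ : ∀ p q → abs (abs p ℚ.- abs q) ℚ.≤ abs (p ℚ.- q)
  ∣∣p∣-∣q∣∣≤∣p-q∣ p q = ∣r∣≤ (abs p ℚ.- abs q) (∣p∣-∣q∣≤∣p-q∣ p q) (begin
      ℚ.- (abs p ℚ.- abs q)  ≡⟨ flip (abs p) (abs q) ⟩
      abs q ℚ.- abs p        ≤⟨ ∣p∣-∣q∣≤∣p-q∣ q p ⟩
      abs (q ℚ.- p)          ≡⟨ ∣p-q∣≡∣q-p∣ q p ⟩
      abs (p ℚ.- q)          ∎)
    where
    open ℚ.≤-Reasoning
    flip : ∀ a b → ℚ.- (a ℚ.- b) ≡ b ℚ.- a
    flip = solve 2 (λ a b → :- (a :- b) := b :- a) refl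
      where open +-*-Solver
    ∣r∣≤ : ∀ r {s} → r ℚ.≤ s → ℚ.- r ℚ.≤ s → abs r ℚ.≤ s
    ∣r∣≤ r {s} r≤s -r≤s =
      [ (λ eq → subst (ℚ._≤ s) (sym eq) r≤s) ,
        (λ eq → subst (ℚ._≤ s) (sym eq) -r≤s) ]′ (ℚ.∣p∣≡p∨∣p∣≡-p r)

  abs-cauchy : ∀ x → IsCauchy x → IsCauchy (λ i → abs (x i))
  abs-cauchy x cx ε ε>0 = proj₁ (cx ε ε>0) , λ i j hi hj →
    ℚ.≤-<-trans (∣∣p∣-∣q∣∣≤∣p-q∣ (x i) (x j)) (proj₂ (cx ε ε>0) i j hi hj)

  eventually-bounded : ∀ x → IsCauchy x →
    ∃[ B ] 0ℚ ℚ.< B × (∃[ N ] ∀ i → N ℕ.≤ i → abs (x i) ℚ.≤ B)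
  eventually-bounded x cx with cx 1ℚ (ℚ.positive⁻¹ 1ℚ)
  ... | N , h =
    1ℚ ℚ.+ abs (x N) ,
    ℚ.+-mono-<-≤ (ℚ.positive⁻¹ 1ℚ) (ℚ.0≤∣p∣ (x N)) ,
    N , λ i hi → ℚ.≤-trans (∣p∣≤∣p-q∣+∣q∣ (x i) (x N))
      (ℚ.+-monoˡ-≤ (abs (x N)) (ℚ.<⇒≤ (h i N hi ℕ.≤-refl)))

  divide : ∀ D ε → 0ℚ ℚ.< D → 0ℚ ℚ.< ε → ∃[ δ ] 0ℚ ℚ.< δ × D ℚ.* δ ≡ ε
  divide D ε D>0 ε>0 = D⁻¹ ℚ.* ε , δ>0 , (begin
      D ℚ.* (D⁻¹ ℚ.* ε)    ≡⟨ ℚ.*-assoc D D⁻¹ ε ⟨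
      (D ℚ.* D⁻¹) ℚ.* ε    ≡⟨ cong (ℚ._* ε) (ℚ.*-inverseʳ D {{D≢0}}) ⟩
      1ℚ ℚ.* ε             ≡⟨ ℚ.*-identityˡ ε ⟩
      ε                    ∎)
    where
    open ≡-Reasoning
    D≢0 : ℚ.NonZero D
    D≢0 = ℚ.pos⇒nonZero D {{ℚ.positive D>0}}
    D⁻¹ : ℚ
    D⁻¹ = ℚ.1/_ D {{D≢0}}
    δ>0 : 0ℚ ℚ.< D⁻¹ ℚ.* ε
    δ>0 = ℚ.positive⁻¹ (D⁻¹ ℚ.* ε)
      {{ℚ.pos*pos⇒pos D⁻¹ {{ℚ.1/pos⇒pos D {{ℚ.positive D>0}}}} ε {{ℚ.positive ε>0}}}}

  ∣p*q∣<C*δ : ∀ p q C δ → 0ℚ ℚ.< C → abs p ℚ.≤ C → abs q ℚ.< δ →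
    abs (p ℚ.* q) ℚ.< C ℚ.* δ
  ∣p*q∣<C*δ p q C δ C>0 p≤C q<δ = begin-strict
    abs (p ℚ.* q)      ≡⟨ ℚ.∣p*q∣≡∣p∣*∣q∣ p q ⟩
    abs p ℚ.* abs q    ≤⟨ ℚ.*-monoʳ-≤-nonNeg (abs q) {{ℚ.∣-∣-nonNeg q}} p≤C ⟩
    C ℚ.* abs q        <⟨ ℚ.*-monoʳ-<-pos C {{ℚ.positive C>0}} q<δ ⟩
    C ℚ.* δ            ∎
    where open ℚ.≤-Reasoning

  ∣ab-cd∣≤ : ∀ a b c d →
    abs (a ℚ.* b ℚ.- c ℚ.* d) ℚ.≤ abs (a ℚ.* (b ℚ.- d)) ℚ.+ abs (d ℚ.* (a ℚ.- c))
  ∣ab-cd∣≤ a b c d = begin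
    abs (a ℚ.* b ℚ.- c ℚ.* d)
      ≡⟨ cong abs (split a b c d) ⟩
    abs (a ℚ.* (b ℚ.- d) ℚ.+ d ℚ.* (a ℚ.- c))
      ≤⟨ ℚ.∣p+q∣≤∣p∣+∣q∣ (a ℚ.* (b ℚ.- d)) (d ℚ.* (a ℚ.- c)) ⟩
    abs (a ℚ.* (b ℚ.- d)) ℚ.+ abs (d ℚ.* (a ℚ.- c))
      ∎
    where
    open ℚ.≤-Reasoning
    split : ∀ a b c d → a ℚ.* b ℚ.- c ℚ.* d ≡ a ℚ.* (b ℚ.- d) ℚ.+ d ℚ.* (a ℚ.- c)
    split = solve 4 (λ a b c d → a :* b :- c :* d := a :* (b :- d) :+ d :* (a :- c)) refl
      where open +-*-Solver

  *-cauchy : ∀ x y → IsCauchy x → IsCauchy y → IsCauchy (λ i → x i ℚ.* y i)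
  *-cauchy x y cx cy ε ε>0 =
    let
      A , A>0 , K , x≤A = eventually-bounded x cx
      B , B>0 , L , y≤B = eventually-bounded y cy
      δ , δ>0 , Dδ≡ε    = divide (A ℚ.+ B) ε (ℚ.+-mono-< A>0 B>0) ε>0
      M , hx            = cx δ δ>0
      N , hy            = cy δ δ>0
    in
    (K ℕ.⊔ L) ℕ.⊔ (M ℕ.⊔ N) , λ i j hi hj →
      let
        KLi = ℕ.m⊔n≤o⇒m≤o (K ℕ.⊔ L) (M ℕ.⊔ N) hi
        KLj = ℕ.m⊔n≤o⇒m≤o (K ℕ.⊔ L) (M ℕ.⊔ N) hj
        MNi = ℕ.m⊔n≤o⇒n≤o (K ℕ.⊔ L) (M ℕ.⊔ N) hi
        MNj = ℕ.m⊔n≤o⇒n≤o (K ℕ.⊔ L) (M ℕ.⊔ N) hj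
        first  = ∣p*q∣<C*δ (x i) (y i ℚ.- y j) A δ A>0
          (x≤A i (ℕ.m⊔n≤o⇒m≤o K L KLi))
          (hy i j (ℕ.m⊔n≤o⇒n≤o M N MNi) (ℕ.m⊔n≤o⇒n≤o M N MNj))
        second = ∣p*q∣<C*δ (y j) (x i ℚ.- x j) B δ B>0
          (y≤B j (ℕ.m⊔n≤o⇒n≤o K L KLj))
          (hx i j (ℕ.m⊔n≤o⇒m≤o M N MNi) (ℕ.m⊔n≤o⇒m≤o M N MNj))
      in
      ℚ.≤-<-trans (∣ab-cd∣≤ (x i) (y i) (x j) (y j))
        (subst (abs (x i ℚ.* (y i ℚ.- y j)) ℚ.+ abs (y j ℚ.* (x i ℚ.- x j)) ℚ.<_)
          (trans (sym (ℚ.*-distribʳ-+ δ A B)) Dδ≡ε)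
          (ℚ.+-mono-< first second))

fromℚ : ℚ → ℝ
fromℚ q = mkℝ (λ _ → q) (const-cauchy q)

fromℕ : ℕ → ℝ
fromℕ n = fromℚ (+ n ℚ./ 1)

infixl 7 _*ᴿ_
infixl 6 _+ᴿ_ _-ᴿ_
infix  8 -ᴿ_

_+ᴿ_ _*ᴿ_ : ℝ → ℝ → ℝ
x +ᴿ y = mkℝ (λ i → seq x i ℚ.+ seq y i) (+-cauchy (seq x) (seq y) (cauchy x) (cauchy y))
x *ᴿ y = mkℝ (λ i → seq x i ℚ.* seq y i) (*-cauchy (seq x) (seq y) (cauchy x) (cauchy y))

-ᴿ_ absᴿ : ℝ → ℝ
-ᴿ x   = mkℝ (λ i → ℚ.- seq x i) (neg-cauchy (seq x) (cauchy x))
absᴿ x = mkℝ (λ i → abs (seq x i)) (abs-cauchy (seq x) (cauchy x))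

_-ᴿ_ : ℝ → ℝ → ℝ
x -ᴿ y = x +ᴿ (-ᴿ y)

0ᴿ 1ᴿ ⅓ᴿ : ℝ
0ᴿ = fromℚ 0ℚ
1ᴿ = fromℚ 1ℚ
⅓ᴿ = fromℚ (+ 1 ℚ./ 3)

ℝ-rawRing : RawRing 0ℓ 0ℓ
ℝ-rawRing = record
  { Carrier = ℝ ; _≈_ = _≈ᴿ_ ; _+_ = _+ᴿ_ ; _*_ = _*ᴿ_ ; -_ = -ᴿ_ ; 0# = 0ᴿ ; 1# = 1ᴿ }

open RawSemiringDefinitions (RawRing.rawSemiring ℝ-rawRing) public
  using () renaming (sum to sumᴿ; product to productᴿ; _^_ to _^ᴿ_)

infix 4 _≈ᶜ_

record ℂ : Set where
  constructor _+i_
  field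
    re : ℝ
    im : ℝ

open ℂ public

_≈ᶜ_ : ℂ → ℂ → Set
z ≈ᶜ w = (re z ≈ᴿ re w) × (im z ≈ᴿ im w)

infixl 7 _*ᶜ_
infixl 6 _+ᶜ_
infix  8 -ᶜ_

_+ᶜ_ _*ᶜ_ : ℂ → ℂ → ℂ
z +ᶜ w = (re z +ᴿ re w) +i (im z +ᴿ im w)
z *ᶜ w = (re z *ᴿ re w -ᴿ im z *ᴿ im w) +i (re z *ᴿ im w +ᴿ im z *ᴿ re w)

-ᶜ_ conj : ℂ → ℂ
-ᶜ z   = (-ᴿ re z) +i (-ᴿ im z)
conj z = re z +i (-ᴿ im z)

modSq : ℂ → ℝ
modSq z = re z *ᴿ re z +ᴿ im z *ᴿ im z

0ᶜ 1ᶜ : ℂ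
0ᶜ = 0ᴿ +i 0ᴿ
1ᶜ = 1ᴿ +i 0ᴿ

ℂ-rawRing : RawRing 0ℓ 0ℓ
ℂ-rawRing = record
  { Carrier = ℂ ; _≈_ = _≈ᶜ_ ; _+_ = _+ᶜ_ ; _*_ = _*ᶜ_ ; -_ = -ᶜ_ ; 0# = 0ᶜ ; 1# = 1ᶜ }

open RawSemiringDefinitions (RawRing.rawSemiring ℂ-rawRing) public
  using () renaming (sum to sumᶜ)

IsLeast : (ℕ → Set) → ℕ → Set
IsLeast P k = P k × (∀ j → P j → k ℕ.≤ j)

-- Partial Boolean functions: -1 and +1 are the two elements of Sign, and
-- a point is outside the domain when it is mapped to nothing.

record PartialBoolean (X : Set) : Set where
  field
    value    : X → Maybe Sign
    nonempty : ∃[ x ] ∃[ v ] value x ≡ just v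

open PartialBoolean public

⨂-value : ∀ {n} {X : Set} → (Fin n → X → Maybe Sign) → Vec X n → Maybe Sign
⨂-value g []       = just Sign.+
⨂-value g (x ∷ xs) = zipWith Sign._*_ (g zero x) (⨂-value (λ i → g (suc i)) xs)

⨂-nonempty : ∀ {n} {X : Set} (f : Fin n → PartialBoolean X) →
  ∃[ xs ] ∃[ v ] ⨂-value (λ i → value (f i)) xs ≡ just v
⨂-nonempty {zero}  f = [] , Sign.+ , refl
⨂-nonempty {suc n} f with nonempty (f zero) | ⨂-nonempty (λ i → f (suc i))
... | x , v , eq | xs , w , eqs =
  x ∷ xs , v Sign.* w , cong₂ (zipWith Sign._*_) eq eqs

⨂ : ∀ {n} {X : Set} → (Fin n → PartialBoolean X) → PartialBoolean (Vec X n)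
⨂ f = record
  { value    = ⨂-value (λ i → value (f i))
  ; nonempty = ⨂-nonempty f
  }

concat-injective : ∀ {A : Set} {m n} (xss yss : Vec (Vec A m) n) →
  concat xss ≡ concat yss → xss ≡ yss
concat-injective []         []         _  = refl
concat-injective (xs ∷ xss) (ys ∷ yss) eq with ++-injective xs ys eq
... | eq₁ , eq₂ = cong₂ _∷_ eq₁ (concat-injective xss yss eq₂)

-- The identification of ({-1,+1}^m)^n with {-1,+1}^(nm) by concatenation.
flatten : ∀ {A : Set} {m n} → PartialBoolean (Vec (Vec A m) n) → PartialBoolean (Vec A (n ℕ.* m))
flatten {m = m} {n} F = record
  { value    = λ x → value F (proj₁ (group n m x))
  ; nonempty =
      let xss , v , eq = nonempty F
          yss , eq′    = group n m (concat xss)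
      in concat xss , v ,
         trans (cong (value F) (sym (concat-injective xss yss eq′))) eq
  }

-- A finite formal sum of terms c · x₁^e₁ ⋯ xₘ^eₘ; exponent vectors may be
-- repeated and coefficients may vanish.
Polynomial : ℕ → Set
Polynomial m = List (ℝ × Vec ℕ m)

coefficient : ∀ {m} → Polynomial m → Vec ℕ m → ℝ
coefficient []            e = 0ᴿ
coefficient ((c , d) ∷ p) e =
  (if does (Vec-≡-dec ℕ._≟_ d e) then c else 0ᴿ) +ᴿ coefficient p e

DegreeAtMost : ∀ {m} → ℕ → Polynomial m → Set
DegreeAtMost d p = ∀ e → d ℕ.< Vec.sum e → coefficient p e ≈ᴿ 0ᴿ

signᴿ : Sign → ℝ
signᴿ Sign.- = -ᴿ 1ᴿ
signᴿ Sign.+ = 1ᴿ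

evaluate : ∀ {m} → Polynomial m → Vec Sign m → ℝ
evaluate []            x = 0ᴿ
evaluate ((c , e) ∷ p) x =
  c *ᴿ productᴿ (λ i → signᴿ (lookup x i) ^ᴿ lookup e i) +ᴿ evaluate p x

Approximates : ∀ {m} → ℝ → PartialBoolean (Vec Sign m) → Polynomial m → Set
Approximates ε f p =
  (∀ x v → value f x ≡ just v → absᴿ (signᴿ v -ᴿ evaluate p x) ≤ᴿ ε) ×
  (∀ x → value f x ≡ nothing → absᴿ (evaluate p x) ≤ᴿ 1ᴿ +ᴿ ε)

-- deg_ε(f) = d
IsApproxDegree : ∀ {m} → ℝ → PartialBoolean (Vec Sign m) → ℕ → Set
IsApproxDegree ε f = IsLeast (λ d → ∃[ p ] DegreeAtMost d p × Approximates ε f p)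

-- Labels (i , b , w) of the computational basis vectors |i,b,w⟩; the
-- workspace register w has W values.
Basis : ℕ → ℕ → Set
Basis N W = Fin N × Bool × Fin W

bit : Sign → Bool
bit Sign.- = true
bit Sign.+ = false

module _ {N W : ℕ} where

  Vector : Set
  Vector = Basis N W → ℂ

  Operator : Set
  Operator = Basis N W → Basis N W → ℂ

  sum-basis : (Basis N W → ℂ) → ℂ
  sum-basis g = sumᶜ (λ i → sumᶜ (λ w → g (i , false , w) +ᶜ g (i , true , w)))

  normSq : Vector → ℝ
  normSq ψ = sumᴿ (λ i → sumᴿ (λ w → modSq (ψ (i , false , w)) +ᴿ modSq (ψ (i , true , w))))

  apply : Operator → Vector → Vector
  apply A ψ r = sum-basis (λ s → A r s *ᶜ ψ s)

  compose : Operator → Operator → Operator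
  compose A B r t = sum-basis (λ s → A r s *ᶜ B s t)

  adjoint : Operator → Operator
  adjoint A r s = conj (A s r)

  infixl 6 _⊕_
  infix  4 _≈ᴼ_

  _⊕_ : Operator → Operator → Operator
  (A ⊕ B) r s = A r s +ᶜ B r s

  identity : Operator
  identity r s =
    if does (×-≡-dec _≟ᶠ_ (×-≡-dec _≟ᵇ_ _≟ᶠ_) r s) then 1ᶜ else 0ᶜ

  _≈ᴼ_ : Operator → Operator → Set
  A ≈ᴼ B = ∀ r s → A r s ≈ᶜ B r s

  IsUnitary : Operator → Set
  IsUnitary A = (compose (adjoint A) A ≈ᴼ identity) × (compose A (adjoint A) ≈ᴼ identity)

  -- O_x maps |i,b,w⟩ to |i,b⊕b_i,w⟩; being an involution on the basis, it
  -- moves the amplitude of |i,b⊕b_i,w⟩ to |i,b,w⟩.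
  oracle : Vec Sign N → Vector → Vector
  oracle x ψ (i , b , w) = ψ (i , b xor bit (lookup x i) , w)

  -- U_T O_x U_{T-1} O_x ⋯ U_1 O_x U_0 ψ
  evolve : ∀ T → (Fin (suc T) → Operator) → Vec Sign N → Vector → Vector
  evolve zero    U x ψ = apply (U zero) ψ
  evolve (suc T) U x ψ = evolve T (λ j → U (suc j)) x (oracle x (apply (U zero) ψ))

record QueryAlgorithm (N T : ℕ) : Set where
  field
    W        : ℕ
    start    : Vector {N} {W}
    unit     : normSq start ≈ᴿ 1ᴿ
    U        : Fin (suc T) → Operator {N} {W}
    unitary  : ∀ j → IsUnitary (U j)
    -- A general measurement with outcomes ±1, given by its measurement
    -- operators; projective measurements and POVMs are covered.
    M        : Sign → Operator {N} {W}
    complete : (compose (adjoint (M Sign.-)) (M Sign.-) ⊕ compose (adjoint (M Sign.+)) (M Sign.+))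
               ≈ᴼ identity

  outputProbability : Vec Sign N → Sign → ℝ
  outputProbability x v = normSq (apply (M v) (evolve T U x start))

open QueryAlgorithm public using (outputProbability)

Computes : ∀ {N T} → ℝ → PartialBoolean (Vec Sign N) → QueryAlgorithm N T → Set
Computes ε f 𝒜 = ∀ x v → value f x ≡ just v → 1ᴿ -ᴿ ε ≤ᴿ outputProbability 𝒜 x v

-- T_ε(f) = t
IsQueryComplexity : ∀ {N} → ℝ → PartialBoolean (Vec Sign N) → ℕ → Set
IsQueryComplexity {N} ε f =
  IsLeast (λ T → ∃ λ (𝒜 : QueryAlgorithm N T) → Computes ε f 𝒜)

module Submission where

-- A T-query algorithm has a bias P(+1) - P(-1) that is a function of degree at
-- most 2T of the input and correlates with the tensor product of the f i, so
-- it suffices to build a signed measure Ψ orthogonal to degree ≤ 2T that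
-- correlates almost perfectly with the product unless Σ deg(f i) = O(T).  By LP
-- duality and error reduction, each f i has a measure ψ i = α i + β i
-- orthogonal to degree < k i, with k i ≥ deg(f i) / K, where α i has mass 1 and
-- the signs of f i while β i has mass at most 1/15.  The product of the ψ i is
-- orthogonal to degree < Σ k i, but its correlation with the product of the f i
-- decays exponentially.  Replacing ψ i by β i for i in a set S of blocks that
-- carries at most half of Σ k i costs only half of the degree.  With the blocks
-- sorted by k i, the alternating sum over all sets S satisfying a ballot
-- condition cancels all products of α's and β's except the product of all α i
-- and terms whose last blocks contain at least as many β's as α's; these are
-- exponentially small in the number of blocks involved, so their sum is a small
-- constant.

-- The order on Cauchy reals cannot be decided, while Farkas' lemma must compare numbers, so the
-- core runs over ℚ. On the dual side this costs nothing: a rational approximant is in particular a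
-- real polynomial, so its degree is at least deg(f i). On the quantum side the probabilities are
-- replaced by a late term of their sequences. Ring operations act termwise, so this term has degree
-- at most 2T exactly, whereas normalisation and correctness hold up to 1/30.
--
-- If β has mass at most e, weighting excess k by x^-k multiplies the mass per block by (1 + e)/x +
-- e x, whose minimum 2 sqrt(e (1 + e)) must be below 1. Error 1/3 would only give e = 1/2, which is
-- too large. Error 7/8 gives e = 1/15, and with x = 4 the factor is 8/15; the error terms then sum
-- to at most 1/7, and (31/30)(1/7) stays below the correlation 7/30 of the bias. Error reduction
-- from 7/8 to 1/3 pays for this with the constant factor `K` in the degree.

open import Defs
open import Algebra.Bundles using (CommutativeSemiring)
import Algebra.Properties.CommutativeSemigroup
import Algebra.Properties.Semiring.Sum
import Algebra.Structures.Biased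
open import Data.Bool.Base using (Bool; true; false; _xor_; not; if_then_else_)
open import Data.Bool.Properties using () renaming (_≟_ to _≟ᵇ_)
open import Data.Empty using (⊥; ⊥-elim)
open import Data.Fin.Base using (Fin; zero; suc; punchIn; punchOut; remQuot)
open import Data.Fin.Properties using (punchIn-punchOut; combine-remQuot) renaming (_≟_ to _≟ᶠ_)
import Data.Integer.Base as ℤ
import Data.Integer.Properties as ℤ
open import Data.List.Base
  using (List; []; _∷_; _++_; map; length; allFin; cartesianProduct; cartesianProductWith)
open import Data.List.Membership.Propositional using (_∈_)
open import Data.List.Membership.Propositional.Properties
  using (∈-cartesianProductWith⁺; ∈-cartesianProduct⁺; ∈-++⁺ʳ; ∈-allFin; ∈-map⁺)
open import Data.List.Relation.Unary.All as All using (All; []; _∷_)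
import Data.List.Relation.Unary.All.Properties as All
open import Data.List.Relation.Unary.Any using (here; there)
open import Data.Maybe.Base using (Maybe; just; nothing; zipWith)
open import Data.Maybe.Properties using (just-injective)
open import Data.Nat.Base as ℕ using (ℕ; zero; suc; _≤_; z≤n; s≤s)
open import Data.Nat.DivMod using (_/_; _%_; m/n*n≤m; m≡m%n+[m/n]*n; m%n<n)
import Data.Nat.Properties as ℕ
import Data.Nat.Solver as ℕSolver
open import Data.Product.Base using (∃-syntax; _×_; _,_; proj₁; proj₂)
open import Data.Product.Properties using () renaming (≡-dec to ×-≡-dec)
open import Data.Rational.Base as ℚ using (ℚ; 0ℚ; 1ℚ; ½; _+_; _*_; _-_; -_) renaming (∣_∣ to abs)
import Data.Rational.Properties as ℚ
open import Data.Rational.Solver using (module +-*-Solver)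
open import Data.Rational.Unnormalised.Base as ℚᵘ using (mkℚᵘ)
import Data.Rational.Unnormalised.Properties as ℚᵘ
open import Data.Sign.Base as Sign using (Sign)
import Data.Sign.Properties as Sign
open import Data.Sum.Base using (_⊎_; inj₁; inj₂; [_,_]′)
open import Data.Vec.Base as Vec
  using (Vec; []; _∷_; lookup; head; tail; replicate; updateAt; insertAt; concat; group)
open import Data.Vec.Properties using (insertAt-lookup; insertAt-punchIn; lookup-concat)
  renaming (≡-dec to Vec-≡-dec)
open import Function.Base using (_∘_)
open import Level using (0ℓ)
open import Relation.Binary.Definitions using (tri<; tri≈; tri>)
open import Relation.Binary.PropositionalEquality as ≡
  using (_≡_; refl; sym; trans; cong; cong₂; subst; subst₂; module ≡-Reasoning)
import Relation.Binary.Reasoning.Setoid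
open import Relation.Binary.Structures using (IsEquivalence)
open import Relation.Nullary using (yes; no; ¬_; does)
open import Relation.Nullary.Decidable using (True; toWitness; from-no)

open import Algebra.Definitions.RawSemiring ℚ.+-*-rawSemiring using (_^_)
open import Algebra.Properties.CommutativeMonoid.Sum ℕ.+-0-commutativeMonoid using (sum; sum-remove)
open +-*-Solver using (solve; _:+_; _:*_; _:-_; :-_; _:=_; con)

-- Finitely supported signed measures

Measure : Set → Set
Measure Y = List (ℚ × Y)

∫ : ∀ {Y} → Measure Y → (Y → ℚ) → ℚ
∫ []            g = 0ℚ
∫ ((c , y) ∷ μ) g = c * g y + ∫ μ g

-- Equal points are not merged, so this bounds the total variation from above. In return, the mass
-- of a product or a concatenation is computed exactly.
mass : ∀ {Y} → Measure Y → ℚ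
mass []            = 0ℚ
mass ((c , y) ∷ μ) = abs c + mass μ

scale : ∀ {Y} → ℚ → Measure Y → Measure Y
scale k = map (λ (c , y) → k * c , y)

prepend : ∀ {A : Set} {n} → ℚ × A → Measure (Vec A n) → Measure (Vec A (suc n))
prepend (c , x) = map (λ (k , xs) → c * k , x ∷ xs)

infixr 6 _⊗_

_⊗_ : ∀ {A : Set} {n} → Measure A → Measure (Vec A n) → Measure (Vec A (suc n))
[]      ⊗ Φ = []
(p ∷ μ) ⊗ Φ = prepend p Φ ++ μ ⊗ Φ

module _ {Y : Set} where

  ∫-++ : ∀ (μ ν : Measure Y) g → ∫ (μ ++ ν) g ≡ ∫ μ g + ∫ ν g
  ∫-++ []            ν g = sym (ℚ.+-identityˡ (∫ ν g))
  ∫-++ ((c , y) ∷ μ) ν g = trans (cong (c * g y +_) (∫-++ μ ν g)) (sym (ℚ.+-assoc (c * g y) (∫ μ g) (∫ ν g)))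

  ∫-scale : ∀ k (μ : Measure Y) g → ∫ (scale k μ) g ≡ k * ∫ μ g
  ∫-scale k []            g = sym (ℚ.*-zeroʳ k)
  ∫-scale k ((c , y) ∷ μ) g = trans (cong (k * c * g y +_) (∫-scale k μ g))
    (solve 4 (λ k c a b → k :* c :* a :+ k :* b := k :* (c :* a :+ b)) refl k c (g y) (∫ μ g))

  ∫-cong : ∀ (μ : Measure Y) {g h} → (∀ y → g y ≡ h y) → ∫ μ g ≡ ∫ μ h
  ∫-cong []            eq = refl
  ∫-cong ((c , y) ∷ μ) eq = cong₂ (λ a b → c * a + b) (eq y) (∫-cong μ eq)

  ∫-+ : ∀ (μ : Measure Y) g h → ∫ μ (λ y → g y + h y) ≡ ∫ μ g + ∫ μ h
  ∫-+ []            g h = refl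
  ∫-+ ((c , y) ∷ μ) g h = trans (cong (c * (g y + h y) +_) (∫-+ μ g h))
    (solve 5 (λ c a b p q → c :* (a :+ b) :+ (p :+ q) := (c :* a :+ p) :+ (c :* b :+ q)) refl
      c (g y) (h y) (∫ μ g) (∫ μ h))

  ∫-*ˡ : ∀ k (μ : Measure Y) g → ∫ μ (λ y → k * g y) ≡ k * ∫ μ g
  ∫-*ˡ k []            g = sym (ℚ.*-zeroʳ k)
  ∫-*ˡ k ((c , y) ∷ μ) g = trans (cong (c * (k * g y) +_) (∫-*ˡ k μ g))
    (solve 4 (λ k c a b → c :* (k :* a) :+ k :* b := k :* (c :* a :+ b)) refl k c (g y) (∫ μ g))

  ∫-*ʳ : ∀ k (μ : Measure Y) g → ∫ μ (λ y → g y * k) ≡ ∫ μ g * k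
  ∫-*ʳ k μ g = trans (∫-cong μ (λ y → ℚ.*-comm (g y) k))
    (trans (∫-*ˡ k μ g) (ℚ.*-comm k (∫ μ g)))

  mass-++ : ∀ (μ ν : Measure Y) → mass (μ ++ ν) ≡ mass μ + mass ν
  mass-++ []            ν = sym (ℚ.+-identityˡ (mass ν))
  mass-++ ((c , y) ∷ μ) ν = trans (cong (abs c +_) (mass-++ μ ν)) (sym (ℚ.+-assoc (abs c) (mass μ) (mass ν)))

  mass-scale : ∀ k (μ : Measure Y) → mass (scale k μ) ≡ abs k * mass μ
  mass-scale k []            = sym (ℚ.*-zeroʳ (abs k))
  mass-scale k ((c , y) ∷ μ) = trans (cong₂ _+_ (ℚ.∣p*q∣≡∣p∣*∣q∣ k c) (mass-scale k μ))
    (sym (ℚ.*-distribˡ-+ (abs k) (abs c) (mass μ)))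

  0≤mass : ∀ (μ : Measure Y) → 0ℚ ℚ.≤ mass μ
  0≤mass []            = ℚ.≤-refl
  0≤mass ((c , y) ∷ μ) = ℚ.+-mono-≤ (ℚ.0≤∣p∣ c) (0≤mass μ)

  ∣∫∣≤mass : ∀ (μ : Measure Y) g B → (∀ y → abs (g y) ℚ.≤ B) → abs (∫ μ g) ℚ.≤ mass μ * B
  ∣∫∣≤mass []            g B g≤B = ℚ.≤-reflexive (sym (ℚ.*-zeroˡ B))
  ∣∫∣≤mass ((c , y) ∷ μ) g B g≤B = begin
    abs (c * g y + ∫ μ g)            ≤⟨ ℚ.∣p+q∣≤∣p∣+∣q∣ (c * g y) (∫ μ g) ⟩
    abs (c * g y) + abs (∫ μ g)      ≡⟨ cong (_+ abs (∫ μ g)) (ℚ.∣p*q∣≡∣p∣*∣q∣ c (g y)) ⟩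
    abs c * abs (g y) + abs (∫ μ g)  ≤⟨ ℚ.+-mono-≤ (ℚ.*-monoˡ-≤-nonNeg (abs c) {{ℚ.∣-∣-nonNeg c}} (g≤B y))
                                                   (∣∫∣≤mass μ g B g≤B) ⟩
    abs c * B + mass μ * B           ≡⟨ ℚ.*-distribʳ-+ B (abs c) (mass μ) ⟨
    (abs c + mass μ) * B             ∎
    where open ℚ.≤-Reasoning

module _ {A : Set} {n : ℕ} where

  ∫-prepend : ∀ c x (Φ : Measure (Vec A n)) E →
    ∫ (prepend (c , x) Φ) E ≡ c * ∫ Φ (λ xs → E (x ∷ xs))
  ∫-prepend c x []             E = sym (ℚ.*-zeroʳ c)
  ∫-prepend c x ((k , xs) ∷ Φ) E = trans (cong (c * k * E (x ∷ xs) +_) (∫-prepend c x Φ E))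
    (solve 4 (λ k c a b → c :* k :* a :+ c :* b := c :* (k :* a :+ b)) refl
      k c (E (x ∷ xs)) (∫ Φ (λ xs → E (x ∷ xs))))

  ∫-⊗ : ∀ (μ : Measure A) (Φ : Measure (Vec A n)) E →
    ∫ (μ ⊗ Φ) E ≡ ∫ μ (λ x → ∫ Φ (λ xs → E (x ∷ xs)))
  ∫-⊗ []            Φ E = refl
  ∫-⊗ ((c , x) ∷ μ) Φ E = trans (∫-++ (prepend (c , x) Φ) (μ ⊗ Φ) E)
    (cong₂ _+_ (∫-prepend c x Φ E) (∫-⊗ μ Φ E))

  mass-prepend : ∀ c x (Φ : Measure (Vec A n)) → mass (prepend (c , x) Φ) ≡ abs c * mass Φ
  mass-prepend c x []             = sym (ℚ.*-zeroʳ (abs c))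
  mass-prepend c x ((k , xs) ∷ Φ) = trans (cong₂ _+_ (ℚ.∣p*q∣≡∣p∣*∣q∣ c k) (mass-prepend c x Φ))
    (sym (ℚ.*-distribˡ-+ (abs c) (abs k) (mass Φ)))

  mass-⊗ : ∀ (μ : Measure A) (Φ : Measure (Vec A n)) → mass (μ ⊗ Φ) ≡ mass μ * mass Φ
  mass-⊗ []            Φ = sym (ℚ.*-zeroˡ (mass Φ))
  mass-⊗ ((c , x) ∷ μ) Φ = trans (mass-++ (prepend (c , x) Φ) (μ ⊗ Φ))
    (trans (cong₂ _+_ (mass-prepend c x Φ) (mass-⊗ μ Φ))
      (sym (ℚ.*-distribʳ-+ (mass Φ) (abs c) (mass μ))))

-- Functions of bounded degree

signℚ : Sign → ℚ
signℚ Sign.- = - 1ℚ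
signℚ Sign.+ = 1ℚ

-- A derivation plays the role of a polynomial, and `polynomial` later turns it into one. By `ext`
-- only the values matter, so a squared coordinate may equally be read as a constant.
data Degree≤ {V Y : Set} (var : V → Y → ℚ) : ℕ → (Y → ℚ) → Set where
  const : ∀ {k} c → Degree≤ var k (λ _ → c)
  add   : ∀ {k g h} → Degree≤ var k g → Degree≤ var k h → Degree≤ var k (λ y → g y + h y)
  mult  : ∀ {k g} v → Degree≤ var k g → Degree≤ var (suc k) (λ y → var v y * g y)
  ext   : ∀ {k g h} → (∀ y → g y ≡ h y) → Degree≤ var k g → Degree≤ var k h

-- The strict `j < k` makes `Orth var 0` vacuous. This is all that is asked of a factor β.
Orth : ∀ {V Y} → (V → Y → ℚ) → ℕ → Measure Y → Set
Orth var k μ = ∀ {j g} → Degree≤ var j g → j ℕ.< k → ∫ μ g ≡ 0ℚ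

module _ {V Y : Set} {var : V → Y → ℚ} where

  degree-mono : ∀ {j k g} → j ≤ k → Degree≤ var j g → Degree≤ var k g
  degree-mono j≤k       (const c)  = const c
  degree-mono j≤k       (add p q)  = add (degree-mono j≤k p) (degree-mono j≤k q)
  degree-mono (s≤s j≤k) (mult v p) = mult v (degree-mono j≤k p)
  degree-mono j≤k       (ext eq p) = ext eq (degree-mono j≤k p)

  degree-scale : ∀ {k g} c → Degree≤ var k g → Degree≤ var k (λ y → c * g y)
  degree-scale c (const d)      = const (c * d)
  degree-scale c (add {g = g} {h} p q) =
    ext (λ y → sym (ℚ.*-distribˡ-+ c (g y) (h y))) (add (degree-scale c p) (degree-scale c q))
  degree-scale c (mult {g = g} v p) =
    ext (λ y → solve 3 (λ a b c → a :* (b :* c) := b :* (a :* c)) refl (var v y) c (g y))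
      (mult v (degree-scale c p))
  degree-scale c (ext eq p)     = ext (λ y → cong (c *_) (eq y)) (degree-scale c p)

  degree-* : ∀ {j k g h} → Degree≤ var j g → Degree≤ var k h →
    Degree≤ var (j ℕ.+ k) (λ y → g y * h y)
  degree-* {j} {k} (const c) q = degree-mono (ℕ.m≤n+m k j) (degree-scale c q)
  degree-* {h = h} (add {g = g} {g′} p p′) q =
    ext (λ y → sym (ℚ.*-distribʳ-+ (h y) (g y) (g′ y))) (add (degree-* p q) (degree-* p′ q))
  degree-* {h = h} (mult {g = g} v p) q =
    ext (λ y → sym (ℚ.*-assoc (var v y) (g y) (h y))) (mult v (degree-* p q))
  degree-* {h = h} (ext eq p) q = ext (λ y → cong (_* h y) (eq y)) (degree-* p q)

  -- Replacing variables by variables keeps the degree; this carries the bias from the flat input to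
  -- the sorted blocks.
  degree-∘ : ∀ {W Z : Set} {var′ : W → Z → ℚ} (φ : Z → Y) →
    (∀ v → ∃[ w ] ∀ z → var′ w z ≡ var v (φ z)) →
    ∀ {k g} → Degree≤ var k g → Degree≤ var′ k (g ∘ φ)
  degree-∘ φ ren (const c)  = const c
  degree-∘ φ ren (add p q)  = add (degree-∘ φ ren p) (degree-∘ φ ren q)
  degree-∘ φ ren (mult {g = g} v p) = let w , eq = ren v in
    ext (λ z → cong (_* g (φ z)) (eq z)) (mult w (degree-∘ φ ren p))
  degree-∘ φ ren (ext eq p) = ext (λ z → eq (φ z)) (degree-∘ φ ren p)

  orth-mono : ∀ {μ j k} → j ≤ k → Orth var k μ → Orth var j μ
  orth-mono j≤k ⊥μ p i<j = ⊥μ p (ℕ.<-≤-trans i<j j≤k)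

  orth-++ : ∀ {k} μ ν → Orth var k μ → Orth var k ν → Orth var k (μ ++ ν)
  orth-++ μ ν ⊥μ ⊥ν {g = g} p j<k =
    trans (∫-++ μ ν g) (cong₂ _+_ (⊥μ p j<k) (⊥ν p j<k))

  orth-scale : ∀ {k} c μ → Orth var k μ → Orth var k (scale c μ)
  orth-scale c μ ⊥μ {g = g} p j<k =
    trans (∫-scale c μ g) (trans (cong (c *_) (⊥μ p j<k)) (ℚ.*-zeroʳ c))

coordinate : ∀ {m} → Fin m → Vec Sign m → ℚ
coordinate i x = signℚ (lookup x i)

blockCoordinate : ∀ {n m} → Fin n × Fin m → Vec (Vec Sign m) n → ℚ
blockCoordinate (i , j) xs = coordinate j (lookup xs i)

module _ {m n : ℕ} (μ : Measure (Vec Sign m)) (Φ : Measure (Vec (Vec Sign m) n)) where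

  private
    ∫∫-* : ∀ (g : Vec Sign m → ℚ) (h : Vec (Vec Sign m) n → ℚ) →
      ∫ (μ ⊗ Φ) (λ xs → g (head xs) * h (tail xs)) ≡ ∫ μ g * ∫ Φ h
    ∫∫-* g h = begin
      ∫ (μ ⊗ Φ) (λ xs → g (head xs) * h (tail xs))  ≡⟨ ∫-⊗ μ Φ _ ⟩
      ∫ μ (λ x → ∫ Φ (λ xs → g x * h xs))           ≡⟨ ∫-cong μ (λ x → ∫-*ˡ (g x) Φ h) ⟩
      ∫ μ (λ x → g x * ∫ Φ h)                       ≡⟨ ∫-*ʳ (∫ Φ h) μ g ⟩
      ∫ μ g * ∫ Φ h                                 ∎
      where open ≡-Reasoning

    sum<⇒ : ∀ {a b k l} → a ℕ.+ b ℕ.< k ℕ.+ l → a ℕ.< k ⊎ b ℕ.< l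
    sum<⇒ {a} {b} {k} {l} lt with a ℕ.<? k
    ... | yes a<k = inj₁ a<k
    ... | no  a≮k with b ℕ.<? l
    ...   | yes b<l = inj₂ b<l
    ...   | no  b≮l = ⊥-elim (ℕ.<⇒≱ lt (ℕ.+-mono-≤ (ℕ.≮⇒≥ a≮k) (ℕ.≮⇒≥ b≮l)))

  -- A monomial of degree < k + l has degree < k in the first block or
  -- degree < l in the others; the factors g and h collect its variables.
  orth-⊗′ : ∀ {k l} → Orth coordinate k μ → Orth blockCoordinate l Φ →
    ∀ {a b j g h E} → Degree≤ coordinate a g → Degree≤ blockCoordinate b h →
    Degree≤ blockCoordinate j E → a ℕ.+ b ℕ.+ j ℕ.< k ℕ.+ l →
    ∫ (μ ⊗ Φ) (λ xs → g (head xs) * h (tail xs) * E xs) ≡ 0ℚ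
  orth-⊗′ ⊥μ ⊥Φ {a} {b} {j} {g} {h} dg dh (const c) lt =
    trans (∫-*ʳ c (μ ⊗ Φ) (λ xs → g (head xs) * h (tail xs)))
      (trans (cong (_* c) (trans (∫∫-* g h) zero-product)) (ℚ.*-zeroˡ c))
    where
    zero-product : ∫ μ g * ∫ Φ h ≡ 0ℚ
    zero-product with sum<⇒ (ℕ.≤-<-trans (ℕ.m≤m+n (a ℕ.+ b) j) lt)
    ... | inj₁ a<k = trans (cong (_* ∫ Φ h) (⊥μ dg a<k)) (ℚ.*-zeroˡ (∫ Φ h))
    ... | inj₂ b<l = trans (cong (∫ μ g *_) (⊥Φ dh b<l)) (ℚ.*-zeroʳ (∫ μ g))
  orth-⊗′ ⊥μ ⊥Φ {g = g} {h} dg dh (add {g = E} {E′} dE dE′) lt = begin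
      ∫ (μ ⊗ Φ) (λ xs → G xs * (E xs + E′ xs))
        ≡⟨ ∫-cong (μ ⊗ Φ) (λ xs → ℚ.*-distribˡ-+ (G xs) (E xs) (E′ xs)) ⟩
      ∫ (μ ⊗ Φ) (λ xs → G xs * E xs + G xs * E′ xs)
        ≡⟨ ∫-+ (μ ⊗ Φ) (λ xs → G xs * E xs) (λ xs → G xs * E′ xs) ⟩
      ∫ (μ ⊗ Φ) (λ xs → G xs * E xs) + ∫ (μ ⊗ Φ) (λ xs → G xs * E′ xs)
        ≡⟨ cong₂ _+_ (orth-⊗′ ⊥μ ⊥Φ dg dh dE lt) (orth-⊗′ ⊥μ ⊥Φ dg dh dE′ lt) ⟩
      0ℚ ∎
    where
    open ≡-Reasoning
    G : Vec (Vec Sign m) (suc n) → ℚ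
    G xs = g (head xs) * h (tail xs)
  orth-⊗′ {k} {l} ⊥μ ⊥Φ {a} {b} {suc j} {g} {h} dg dh (mult {g = E} (zero , i) dE) lt =
    trans (∫-cong (μ ⊗ Φ) λ { (x ∷ xs) →
        solve 4 (λ g h v e → g :* h :* (v :* e) := v :* g :* h :* e) refl
          (g x) (h xs) (coordinate i x) (E (x ∷ xs)) })
      (orth-⊗′ ⊥μ ⊥Φ (mult i dg) dh dE (subst (ℕ._< k ℕ.+ l) (ℕ.+-suc (a ℕ.+ b) j) lt))
  orth-⊗′ {k} {l} ⊥μ ⊥Φ {a} {b} {suc j} {g} {h} dg dh (mult {g = E} (suc i , i′) dE) lt =
    trans (∫-cong (μ ⊗ Φ) λ { (x ∷ xs) →
        solve 4 (λ g h v e → g :* h :* (v :* e) := g :* (v :* h) :* e) refl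
          (g x) (h xs) (blockCoordinate (i , i′) xs) (E (x ∷ xs)) })
      (orth-⊗′ ⊥μ ⊥Φ dg (mult (i , i′) dh) dE
        (subst (ℕ._< k ℕ.+ l)
          (trans (ℕ.+-suc (a ℕ.+ b) j) (cong (ℕ._+ j) (sym (ℕ.+-suc a b)))) lt))
  orth-⊗′ ⊥μ ⊥Φ {g = g} {h} dg dh (ext eq dE) lt =
    trans (∫-cong (μ ⊗ Φ) (λ xs → cong (g (head xs) * h (tail xs) *_) (sym (eq xs))))
      (orth-⊗′ ⊥μ ⊥Φ dg dh dE lt)

  orth-⊗ : ∀ {k l} → Orth coordinate k μ → Orth blockCoordinate l Φ →
    Orth blockCoordinate (k ℕ.+ l) (μ ⊗ Φ)
  orth-⊗ ⊥μ ⊥Φ {g = E} dE j<k+l =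
    trans (∫-cong (μ ⊗ Φ) (λ xs → sym (ℚ.*-identityˡ (E xs))))
      (orth-⊗′ ⊥μ ⊥Φ {a = 0} {b = 0} (const 1ℚ) (const 1ℚ) dE j<k+l)

-- Elementary inequalities between rationals

≤⇒0≤- : ∀ {p q} → p ℚ.≤ q → 0ℚ ℚ.≤ q - p
≤⇒0≤- {p} {q} p≤q = subst (ℚ._≤ q - p) (ℚ.+-inverseʳ p) (ℚ.+-monoˡ-≤ (- p) p≤q)

0≤-⇒≤ : ∀ {p q} → 0ℚ ℚ.≤ q - p → p ℚ.≤ q
0≤-⇒≤ {p} {q} 0≤ = subst₂ ℚ._≤_ (ℚ.+-identityˡ p)
  (solve 2 (λ p q → (q :- p) :+ p := q) refl p q) (ℚ.+-monoˡ-≤ p 0≤)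

0≤* : ∀ {p q} → 0ℚ ℚ.≤ p → 0ℚ ℚ.≤ q → 0ℚ ℚ.≤ p * q
0≤* {p} {q} 0≤p 0≤q = subst (ℚ._≤ p * q) (ℚ.*-zeroʳ p)
  (ℚ.*-monoˡ-≤-nonNeg p {{ℚ.nonNegative 0≤p}} 0≤q)

*-mono-≤ : ∀ {p q r s} → 0ℚ ℚ.≤ q → 0ℚ ℚ.≤ r → p ℚ.≤ q → r ℚ.≤ s → p * r ℚ.≤ q * s
*-mono-≤ {q = q} {r} 0≤q 0≤r p≤q r≤s = ℚ.≤-trans
  (ℚ.*-monoʳ-≤-nonNeg r {{ℚ.nonNegative 0≤r}} p≤q)
  (ℚ.*-monoˡ-≤-nonNeg q {{ℚ.nonNegative 0≤q}} r≤s)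

p≤∣p∣ : ∀ p → p ℚ.≤ abs p
p≤∣p∣ p with ℚ.≤-total 0ℚ p
... | inj₁ 0≤p = ℚ.≤-reflexive (sym (ℚ.0≤p⇒∣p∣≡p 0≤p))
... | inj₂ p≤0 = ℚ.≤-trans p≤0 (ℚ.0≤∣p∣ p)

-∣p∣≤p : ∀ p → - abs p ℚ.≤ p
-∣p∣≤p p = subst (- abs p ℚ.≤_) (solve 1 (λ p → :- (:- p) := p) refl p)
  (ℚ.neg-antimono-≤ (subst (- p ℚ.≤_) (ℚ.∣-p∣≡∣p∣ p) (p≤∣p∣ (- p))))

∣p∣≤ : ∀ {p q} → p ℚ.≤ q → - p ℚ.≤ q → abs p ℚ.≤ q
∣p∣≤ {p} {q} p≤q -p≤q with ℚ.∣p∣≡p∨∣p∣≡-p p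
... | inj₁ eq = subst (ℚ._≤ q) (sym eq) p≤q
... | inj₂ eq = subst (ℚ._≤ q) (sym eq) -p≤q

signℚ-* : ∀ v w → signℚ (v Sign.* w) ≡ signℚ v * signℚ w
signℚ-* Sign.- Sign.- = refl
signℚ-* Sign.- Sign.+ = refl
signℚ-* Sign.+ w      = sym (ℚ.*-identityˡ (signℚ w))

signℚ-square : ∀ v p q → (signℚ v * p) * (signℚ v * q) ≡ p * q
signℚ-square Sign.- p q = solve 2 (λ p q → con (- 1ℚ) :* p :* (con (- 1ℚ) :* q) := p :* q) refl p q
signℚ-square Sign.+ p q = solve 2 (λ p q → con 1ℚ :* p :* (con 1ℚ :* q) := p :* q) refl p q

∣signℚ*p∣ : ∀ v p → abs (signℚ v * p) ≡ abs p
∣signℚ*p∣ Sign.- p = trans (ℚ.∣p*q∣≡∣p∣*∣q∣ (- 1ℚ) p) (ℚ.*-identityˡ (abs p))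
∣signℚ*p∣ Sign.+ p = cong abs (ℚ.*-identityˡ p)

-- The dual polynomial of a product

data Ascending : ∀ {n} → (Fin n → ℕ) → Set where
  []  : ∀ {d : Fin 0 → ℕ} → Ascending d
  _∷_ : ∀ {n} {d : Fin (suc n) → ℕ} →
        (∀ i → d zero ≤ d (suc i)) → Ascending (d ∘ suc) → Ascending d

-- ballot≥ k is the sum, over the sets S of blocks such that no final segment
-- of the blocks has more members of S than non-members, and in the whole the
-- non-members of S exceed the members by at least k, of (-1)^|S| times the
-- product of β i for i in S and α i + β i for i not in S.  In ballot≡ the
-- excess is exactly k.
ballot≥ ballot≡ : ∀ {A : Set} {n} → (α β : Fin n → Measure A) → ℕ → Measure (Vec A n)
ballot≥ {n = zero}  α β zero    = (1ℚ , []) ∷ []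
ballot≥ {n = zero}  α β (suc k) = []
ballot≥ {n = suc n} α β k       =
  (α zero ++ β zero) ⊗ ballot≥ (α ∘ suc) (β ∘ suc) (ℕ.pred k) ++
  scale (- 1ℚ) (β zero ⊗ ballot≥ (α ∘ suc) (β ∘ suc) (suc k))
ballot≡ {n = zero}  α β zero    = (1ℚ , []) ∷ []
ballot≡ {n = zero}  α β (suc k) = []
ballot≡ {n = suc n} α β zero    =
  scale (- 1ℚ) (β zero ⊗ ballot≡ (α ∘ suc) (β ∘ suc) 1)
ballot≡ {n = suc n} α β (suc k) =
  (α zero ++ β zero) ⊗ ballot≡ (α ∘ suc) (β ∘ suc) k ++
  scale (- 1ℚ) (β zero ⊗ ballot≡ (α ∘ suc) (β ∘ suc) (suc (suc k)))

∫-++-scale-⊗ : ∀ {A : Set} {n} (μ ν : Measure A) (Φ Ψ : Measure (Vec A n)) E →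
  ∫ (μ ⊗ Φ ++ scale (- 1ℚ) (ν ⊗ Ψ)) E ≡
  ∫ μ (λ x → ∫ Φ (λ xs → E (x ∷ xs))) - ∫ ν (λ x → ∫ Ψ (λ xs → E (x ∷ xs)))
∫-++-scale-⊗ μ ν Φ Ψ E = begin
  ∫ (μ ⊗ Φ ++ scale (- 1ℚ) (ν ⊗ Ψ)) E        ≡⟨ ∫-++ (μ ⊗ Φ) (scale (- 1ℚ) (ν ⊗ Ψ)) E ⟩
  ∫ (μ ⊗ Φ) E + ∫ (scale (- 1ℚ) (ν ⊗ Ψ)) E   ≡⟨ cong (∫ (μ ⊗ Φ) E +_) (∫-scale (- 1ℚ) (ν ⊗ Ψ) E) ⟩
  ∫ (μ ⊗ Φ) E + (- 1ℚ) * ∫ (ν ⊗ Ψ) E         ≡⟨ cong₂ (λ a b → a + (- 1ℚ) * b) (∫-⊗ μ Φ E) (∫-⊗ ν Ψ E) ⟩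
  a + (- 1ℚ) * b                             ≡⟨ solve 2 (λ a b → a :+ con (- 1ℚ) :* b := a :- b) refl a b ⟩
  a - b                                      ∎
  where
  open ≡-Reasoning
  a = ∫ μ (λ x → ∫ Φ (λ xs → E (x ∷ xs)))
  b = ∫ ν (λ x → ∫ Ψ (λ xs → E (x ∷ xs)))

-- Both recursions are compared branch by branch on the first block. For `k = 0` the branch with
-- this block outside S agrees for excess at least 0 and at least 1, since `ℕ.pred` sends both to 0:
-- the ballot condition forbids a negative excess of the tail. Only the branch inside S leaves a
-- remainder, as in `ballot≡ α β 0`.
ballot≥-split : ∀ {A : Set} {n} (α β : Fin n → Measure A) k E →
  ∫ (ballot≥ α β k) E ≡ ∫ (ballot≥ α β (suc k)) E + ∫ (ballot≡ α β k) E
ballot≥-split {n = zero}  α β zero    E = sym (ℚ.+-identityˡ (1ℚ * E [] + 0ℚ))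
ballot≥-split {n = zero}  α β (suc k) E = refl
ballot≥-split {n = suc n} α β zero    E = begin
  ∫ (ballot≥ α β 0) E
    ≡⟨ ∫-++-scale-⊗ ψ (β zero) (tail≥ 0) (tail≥ 1) E ⟩
  ∫ ψ (on (tail≥ 0)) - ∫ (β zero) (on (tail≥ 1))
    ≡⟨ cong (λ t → ∫ ψ (on (tail≥ 0)) - t) (trans
         (∫-cong (β zero) (λ x → ballot≥-split (α ∘ suc) (β ∘ suc) 1 (λ xs → E (x ∷ xs))))
         (∫-+ (β zero) (on (tail≥ 2)) (on (tail≡ 1)))) ⟩
  ∫ ψ (on (tail≥ 0)) - (∫ (β zero) (on (tail≥ 2)) + ∫ (β zero) (on (tail≡ 1)))
    ≡⟨ solve 3 (λ a b c → a :- (b :+ c) := (a :- b) :+ con (- 1ℚ) :* c) refl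
         (∫ ψ (on (tail≥ 0))) (∫ (β zero) (on (tail≥ 2))) (∫ (β zero) (on (tail≡ 1))) ⟩
  (∫ ψ (on (tail≥ 0)) - ∫ (β zero) (on (tail≥ 2))) + (- 1ℚ) * ∫ (β zero) (on (tail≡ 1))
    ≡⟨ cong₂ _+_ (∫-++-scale-⊗ ψ (β zero) (tail≥ 0) (tail≥ 2) E)
         (trans (∫-scale (- 1ℚ) (β zero ⊗ tail≡ 1) E)
           (cong ((- 1ℚ) *_) (∫-⊗ (β zero) (tail≡ 1) E))) ⟨
  ∫ (ballot≥ α β 1) E + ∫ (ballot≡ α β 0) E ∎
  where
  open ≡-Reasoning
  ψ = α zero ++ β zero
  tail≥ tail≡ : ℕ → Measure _
  tail≥ = ballot≥ (α ∘ suc) (β ∘ suc)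
  tail≡ = ballot≡ (α ∘ suc) (β ∘ suc)
  on : Measure _ → _ → ℚ
  on Φ x = ∫ Φ (λ xs → E (x ∷ xs))
ballot≥-split {n = suc n} α β (suc k) E = begin
  ∫ (ballot≥ α β (suc k)) E
    ≡⟨ ∫-++-scale-⊗ ψ (β zero) (tail≥ k) (tail≥ (2 ℕ.+ k)) E ⟩
  ∫ ψ (on (tail≥ k)) - ∫ (β zero) (on (tail≥ (2 ℕ.+ k)))
    ≡⟨ cong₂ _-_ (peel ψ k) (peel (β zero) (2 ℕ.+ k)) ⟩
  (a + b) - (c + e)
    ≡⟨ solve 4 (λ a b c e → (a :+ b) :- (c :+ e) := (a :- c) :+ (b :- e)) refl a b c e ⟩
  (a - c) + (b - e)
    ≡⟨ cong₂ _+_ (∫-++-scale-⊗ ψ (β zero) (tail≥ (suc k)) (tail≥ (3 ℕ.+ k)) E)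
                 (∫-++-scale-⊗ ψ (β zero) (tail≡ k) (tail≡ (2 ℕ.+ k)) E) ⟨
  ∫ (ballot≥ α β (2 ℕ.+ k)) E + ∫ (ballot≡ α β (suc k)) E ∎
  where
  open ≡-Reasoning
  ψ = α zero ++ β zero
  tail≥ tail≡ : ℕ → Measure _
  tail≥ = ballot≥ (α ∘ suc) (β ∘ suc)
  tail≡ = ballot≡ (α ∘ suc) (β ∘ suc)
  on : Measure _ → _ → ℚ
  on Φ x = ∫ Φ (λ xs → E (x ∷ xs))
  a = ∫ ψ (on (tail≥ (suc k)))
  b = ∫ ψ (on (tail≡ k))
  c = ∫ (β zero) (on (tail≥ (3 ℕ.+ k)))
  e = ∫ (β zero) (on (tail≡ (2 ℕ.+ k)))
  peel : ∀ μ k → ∫ μ (on (tail≥ k)) ≡ ∫ μ (on (tail≥ (suc k))) + ∫ μ (on (tail≡ k))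
  peel μ k = trans
    (∫-cong μ (λ x → ballot≥-split (α ∘ suc) (β ∘ suc) k (λ xs → E (x ∷ xs))))
    (∫-+ μ (on (tail≥ (suc k))) (on (tail≡ k)))

-- By Abel summation, the non-members of a ballot set carry at least half of
-- the total degree.
ballot≥-orth : ∀ {n m} (α β : Fin n → Measure (Vec Sign m)) (d : Fin n → ℕ) → Ascending d →
  (∀ i → Orth coordinate (d i) (α i ++ β i)) →
  ∀ h → (∀ i → h ≤ d i) → ∀ k D → 2 ℕ.* D ≤ suc (sum d ℕ.+ k ℕ.* h) →
  Orth blockCoordinate D (ballot≥ α β k)
ballot≥-orth {n = zero} α β d asc ⊥ψ h h≤ zero zero    le p ()
ballot≥-orth {n = zero} α β d asc ⊥ψ h h≤ zero (suc D) le p _ =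
  ⊥-elim (ℕ.<⇒≱ (ℕ.*-monoʳ-≤ 2 (s≤s (z≤n {D}))) le)
ballot≥-orth {n = zero} α β d asc ⊥ψ h h≤ (suc k) D le p _ = refl
-- Each unit of the excess `k` is credited with `h`, a lower bound for all remaining degrees.
-- Passing to the tail raises the credit per unit to `d zero`, which is where the ascending order
-- enters.
ballot≥-orth {n = suc n} α β d (d₀≤ ∷ asc) ⊥ψ h h≤ k D le =
  orth-++ (ψ ⊗ tail≥ (ℕ.pred k)) (scale (- 1ℚ) (β zero ⊗ tail≥ (suc k)))
    -- First block outside S: it supplies orthogonality `d zero`, at the price of one unit of
    -- excess. The truncated difference covers the case where `d zero` alone exceeds `D`.
    (orth-mono {μ = ψ ⊗ tail≥ (ℕ.pred k)} (ℕ.m≤n+m∸n D (d zero)) (orth-⊗ ψ (tail≥ (ℕ.pred k)) (⊥ψ zero)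
      (ballot≥-orth (α ∘ suc) (β ∘ suc) (d ∘ suc) asc (⊥ψ ∘ suc) (d zero) d₀≤ (ℕ.pred k) (D ℕ.∸ d zero) out)))
    -- First block inside S: it supplies no orthogonality, but the tail then has one more unit of
    -- excess, credited with the missing `d zero`.
    (orth-scale (- 1ℚ) (β zero ⊗ tail≥ (suc k)) (orth-⊗ (β zero) (tail≥ (suc k)) (λ _ ())
      (ballot≥-orth (α ∘ suc) (β ∘ suc) (d ∘ suc) asc (⊥ψ ∘ suc) (d zero) d₀≤ (suc k) D inn)))
  where
  tail≥ = ballot≥ (α ∘ suc) (β ∘ suc)
  ψ = α zero ++ β zero
  s = sum (d ∘ suc)
  open ℕ.≤-Reasoning
  step : ∀ k → k ℕ.* h ≤ d zero ℕ.+ ℕ.pred k ℕ.* d zero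
  step zero    = z≤n
  step (suc k) = ℕ.+-mono-≤ (h≤ zero) (ℕ.*-monoʳ-≤ k (h≤ zero))
  out : 2 ℕ.* (D ℕ.∸ d zero) ≤ suc (s ℕ.+ ℕ.pred k ℕ.* d zero)
  out = begin
    2 ℕ.* (D ℕ.∸ d zero)                 ≡⟨ ℕ.*-distribˡ-∸ 2 D (d zero) ⟩
    2 ℕ.* D ℕ.∸ 2 ℕ.* d zero             ≤⟨ ℕ.m≤n+o⇒m∸n≤o (2 ℕ.* D) (2 ℕ.* d zero) (begin
      2 ℕ.* D                                                  ≤⟨ le ⟩
      suc (d zero ℕ.+ s ℕ.+ k ℕ.* h)                           ≤⟨ s≤s (ℕ.+-monoʳ-≤ (d zero ℕ.+ s) (step k)) ⟩
      suc (d zero ℕ.+ s ℕ.+ (d zero ℕ.+ ℕ.pred k ℕ.* d zero))  ≡⟨ regroup (d zero) s (ℕ.pred k ℕ.* d zero) ⟩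
      2 ℕ.* d zero ℕ.+ suc (s ℕ.+ ℕ.pred k ℕ.* d zero)         ∎) ⟩
    suc (s ℕ.+ ℕ.pred k ℕ.* d zero)      ∎
    where
    regroup : ∀ a s t → suc (a ℕ.+ s ℕ.+ (a ℕ.+ t)) ≡ 2 ℕ.* a ℕ.+ suc (s ℕ.+ t)
    regroup = S.solve 3 (λ a s t → S.con 1 S.:+ (a S.:+ s S.:+ (a S.:+ t)) S.:=
                                   S.con 2 S.:* a S.:+ (S.con 1 S.:+ (s S.:+ t))) refl
      where module S = ℕSolver.+-*-Solver
  inn : 2 ℕ.* D ≤ suc (s ℕ.+ suc k ℕ.* d zero)
  inn = begin
    2 ℕ.* D                               ≤⟨ le ⟩
    suc (d zero ℕ.+ s ℕ.+ k ℕ.* h)        ≤⟨ s≤s (ℕ.+-monoʳ-≤ (d zero ℕ.+ s) (ℕ.*-monoʳ-≤ k (h≤ zero))) ⟩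
    suc (d zero ℕ.+ s ℕ.+ k ℕ.* d zero)   ≡⟨ cong (λ t → suc (t ℕ.+ k ℕ.* d zero)) (ℕ.+-comm (d zero) s) ⟩
    suc (s ℕ.+ d zero ℕ.+ k ℕ.* d zero)   ≡⟨ cong suc (ℕ.+-assoc s (d zero) (k ℕ.* d zero)) ⟩
    suc (s ℕ.+ suc k ℕ.* d zero)          ∎

-- Weighting excess k by 4⁻ᵏ, adding a block multiplies the mass by at most
-- κ = (16/15) / 4 + (1/15) * 4.
κ four : ℚ
κ    = ℤ.+ 8 ℚ./ 15
four = ℤ.+ 4 ℚ./ 1

0≤? : ∀ p {_ : True (0ℚ ℚ.≤? p)} → 0ℚ ℚ.≤ p
0≤? p {t} = toWitness t

0≤^ : ∀ {p} → 0ℚ ℚ.≤ p → ∀ n → 0ℚ ℚ.≤ p ^ n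
0≤^ 0≤p zero    = 0≤? 1ℚ
0≤^ 0≤p (suc n) = 0≤* 0≤p (0≤^ 0≤p n)

module _ {A : Set} where

  -- The required excess of the tail drops by one for a block outside S and rises by one for a block
  -- inside, so the two branches contribute (16/15)/4 and 4/15 to the factor κ. At excess 0 only the
  -- second branch exists, and 4/15 is below κ.
  ballot≡-mass : ∀ {n} (α β : Fin n → Measure A) →
    (∀ i → mass (α i) ≡ 1ℚ) → (∀ i → mass (β i) ℚ.≤ ℤ.+ 1 ℚ./ 15) →
    ∀ k → mass (ballot≡ α β k) ℚ.≤ κ ^ n * four ^ k
  ballot≡-mass {zero}  α β mα mβ zero    = ℚ.≤-refl
  ballot≡-mass {zero}  α β mα mβ (suc k) = 0≤* (0≤^ (0≤? κ) 0) (0≤^ (0≤? four) (suc k))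
  ballot≡-mass {suc n} α β mα mβ zero    = begin
    mass (scale (- 1ℚ) (β zero ⊗ tail≡ 1))   ≡⟨ mass-scale (- 1ℚ) (β zero ⊗ tail≡ 1) ⟩
    1ℚ * mass (β zero ⊗ tail≡ 1)             ≡⟨ ℚ.*-identityˡ (mass (β zero ⊗ tail≡ 1)) ⟩
    mass (β zero ⊗ tail≡ 1)                  ≡⟨ mass-⊗ (β zero) (tail≡ 1) ⟩
    mass (β zero) * mass (tail≡ 1)           ≤⟨ *-mono-≤ (0≤? (ℤ.+ 1 ℚ./ 15)) (0≤mass (tail≡ 1)) (mβ zero)
                                                  (ballot≡-mass (α ∘ suc) (β ∘ suc) (mα ∘ suc) (mβ ∘ suc) 1) ⟩
    (ℤ.+ 1 ℚ./ 15) * (κ ^ n * four ^ 1)      ≤⟨ 0≤-⇒≤ (subst (0ℚ ℚ.≤_) (sym (slack (κ ^ n)))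
                                                  (0≤* (0≤? (ℤ.+ 4 ℚ./ 15)) (0≤^ (0≤? κ) n))) ⟩
    κ ^ suc n * four ^ 0                     ∎
    where
    open ℚ.≤-Reasoning
    tail≡ = ballot≡ (α ∘ suc) (β ∘ suc)
    slack : ∀ x → κ * x * 1ℚ - (ℤ.+ 1 ℚ./ 15) * (x * (four * 1ℚ)) ≡ (ℤ.+ 4 ℚ./ 15) * x
    slack = solve 1 (λ x → con κ :* x :* con 1ℚ :- con (ℤ.+ 1 ℚ./ 15) :* (x :* (con four :* con 1ℚ))
                        := con (ℤ.+ 4 ℚ./ 15) :* x) refl
  ballot≡-mass {suc n} α β mα mβ (suc k) = begin
    mass (ψ ⊗ tail≡ k ++ scale (- 1ℚ) (β zero ⊗ tail≡ (2 ℕ.+ k)))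
      ≡⟨ mass-++ (ψ ⊗ tail≡ k) (scale (- 1ℚ) (β zero ⊗ tail≡ (2 ℕ.+ k))) ⟩
    mass (ψ ⊗ tail≡ k) + mass (scale (- 1ℚ) (β zero ⊗ tail≡ (2 ℕ.+ k)))
      ≡⟨ cong₂ _+_ (mass-⊗ ψ (tail≡ k)) (trans (mass-scale (- 1ℚ) (β zero ⊗ tail≡ (2 ℕ.+ k)))
           (trans (ℚ.*-identityˡ (mass (β zero ⊗ tail≡ (2 ℕ.+ k)))) (mass-⊗ (β zero) (tail≡ (2 ℕ.+ k))))) ⟩
    mass ψ * mass (tail≡ k) + mass (β zero) * mass (tail≡ (2 ℕ.+ k))
      ≤⟨ ℚ.+-mono-≤
           (*-mono-≤ (0≤? (ℤ.+ 16 ℚ./ 15)) (0≤mass (tail≡ k)) mψ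
             (ballot≡-mass (α ∘ suc) (β ∘ suc) (mα ∘ suc) (mβ ∘ suc) k))
           (*-mono-≤ (0≤? (ℤ.+ 1 ℚ./ 15)) (0≤mass (tail≡ (2 ℕ.+ k))) (mβ zero)
             (ballot≡-mass (α ∘ suc) (β ∘ suc) (mα ∘ suc) (mβ ∘ suc) (2 ℕ.+ k))) ⟩
    (ℤ.+ 16 ℚ./ 15) * (κ ^ n * four ^ k) + (ℤ.+ 1 ℚ./ 15) * (κ ^ n * four ^ (2 ℕ.+ k))
      ≡⟨ total (κ ^ n) (four ^ k) ⟩
    κ ^ suc n * four ^ suc k
      ∎
    where
    open ℚ.≤-Reasoning
    ψ = α zero ++ β zero
    tail≡ = ballot≡ (α ∘ suc) (β ∘ suc)
    mψ : mass ψ ℚ.≤ ℤ.+ 16 ℚ./ 15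
    mψ = ℚ.≤-trans (ℚ.≤-reflexive (mass-++ (α zero) (β zero)))
      (ℚ.+-mono-≤ (ℚ.≤-reflexive (mα zero)) (mβ zero))
    total : ∀ x y → (ℤ.+ 16 ℚ./ 15) * (x * y) + (ℤ.+ 1 ℚ./ 15) * (x * (four * (four * y))) ≡
                    κ * x * (four * y)
    total = solve 2 (λ x y → con (ℤ.+ 16 ℚ./ 15) :* (x :* y) :+
                             con (ℤ.+ 1 ℚ./ 15) :* (x :* (con four :* (con four :* y)))
                          := con κ :* x :* (con four :* y)) refl

-- Correlation of the ballot measure with the product

Aligned : ∀ {X : Set} → (X → Maybe Sign) → Measure X → Set
Aligned g = All (λ (c , x) → ∃[ v ] g x ≡ just v × 0ℚ ℚ.≤ signℚ v * c)

-- Alignment means `signℚ v * c = abs c`, and since `signℚ v` squares to 1, `c * F x` equals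
-- `abs c * (signℚ v * F x)`.
aligned-∫ : ∀ {X : Set} {g : X → Maybe Sign} {α} → Aligned g α → ∀ t F →
  (∀ x v → g x ≡ just v → t ℚ.≤ signℚ v * F x) → mass α * t ℚ.≤ ∫ α F
aligned-∫ [] t F t≤ = ℚ.≤-reflexive (ℚ.*-zeroˡ t)
aligned-∫ {α = (c , x) ∷ α} ((v , gx≡v , 0≤vc) ∷ al) t F t≤ = begin
  (abs c + mass α) * t                    ≡⟨ ℚ.*-distribʳ-+ t (abs c) (mass α) ⟩
  abs c * t + mass α * t                  ≡⟨ cong (λ u → u * t + mass α * t)
                                               (trans (sym (∣signℚ*p∣ v c)) (ℚ.0≤p⇒∣p∣≡p 0≤vc)) ⟩
  signℚ v * c * t + mass α * t            ≤⟨ ℚ.+-mono-≤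
                                               (ℚ.*-monoˡ-≤-nonNeg (signℚ v * c) {{ℚ.nonNegative 0≤vc}} (t≤ x v gx≡v))
                                               (aligned-∫ al t F t≤) ⟩
  signℚ v * c * (signℚ v * F x) + ∫ α F   ≡⟨ cong (_+ ∫ α F) (signℚ-square v c (F x)) ⟩
  c * F x + ∫ α F                         ∎
  where open ℚ.≤-Reasoning

-- The sum of κ ^ i / 15 over i < n.
loss : ℕ → ℚ
loss n = (ℤ.+ 1 ℚ./ 7) * (1ℚ - κ ^ n)

-- In (α + β) ⊗ `ballot≥ 0` - β ⊗ `ballot≥ 1`, with the ballot measures taken on the tail, splitting
-- the β-part of the first term cancels the second. What remains is α ⊗ `ballot≥ 0` + β ⊗
-- `ballot≡ 0`. The first summand is treated by induction; the second is at most its mass κ^n / 15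
-- times `B`, and these errors add up to `loss`. The bound `B` ranges over all points because β may
-- charge points outside the domain.
ballot≥-correlation : ∀ {n} {X : Set} (g : Fin n → X → Maybe Sign) (α β : Fin n → Measure X) →
  (∀ i → Aligned (g i) (α i)) →
  (∀ i → mass (α i) ≡ 1ℚ) → (∀ i → mass (β i) ℚ.≤ ℤ.+ 1 ℚ./ 15) →
  ∀ E B τ → 0ℚ ℚ.≤ B → (∀ xs → abs (E xs) ℚ.≤ B) →
  (∀ xs v → ⨂-value g xs ≡ just v → τ ℚ.≤ signℚ v * E xs) →
  τ ℚ.≤ ∫ (ballot≥ α β 0) E + B * loss n
ballot≥-correlation {zero} g α β al mα mβ E B τ 0≤B E≤B τ≤ = begin
  τ                                                      ≤⟨ τ≤ [] Sign.+ refl ⟩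
  1ℚ * E []                                              ≡⟨ pad (E []) B ⟩
  (1ℚ * E [] + 0ℚ) + B * ((ℤ.+ 1 ℚ./ 7) * (1ℚ - 1ℚ))     ∎
  where
  open ℚ.≤-Reasoning
  pad : ∀ e B → 1ℚ * e ≡ (1ℚ * e + 0ℚ) + B * ((ℤ.+ 1 ℚ./ 7) * (1ℚ - 1ℚ))
  pad = solve 2 (λ e B → con 1ℚ :* e := (con 1ℚ :* e :+ con 0ℚ) :+
                         B :* (con (ℤ.+ 1 ℚ./ 7) :* (con 1ℚ :- con 1ℚ))) refl
ballot≥-correlation {suc n} g α β al mα mβ E B τ 0≤B E≤B τ≤ = 0≤-⇒≤ (begin
  0ℚ                                                   ≤⟨ ℚ.+-mono-≤ (≤⇒0≤- good) (≤⇒0≤- bad) ⟩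
  (a - (τ - B * loss n)) + (b - - ((ℤ.+ 1 ℚ./ 15) * (κ ^ n * 1ℚ) * B))
                                                       ≡⟨ rearrange a b τ B (κ ^ n) ⟩
  ((a + b) + B * loss (suc n)) - τ                     ≡⟨ cong (λ t → (t + B * loss (suc n)) - τ) (sym ∫≡) ⟩
  (∫ (ballot≥ α β 0) E + B * loss (suc n)) - τ         ∎)
  where
  open ℚ.≤-Reasoning
  tail≥ tail≡ : ℕ → Measure _
  tail≥ = ballot≥ (α ∘ suc) (β ∘ suc)
  tail≡ = ballot≡ (α ∘ suc) (β ∘ suc)
  F G H : _ → ℚ
  F x = ∫ (tail≥ 0) (λ xs → E (x ∷ xs))
  G x = ∫ (tail≡ 0) (λ xs → E (x ∷ xs))
  H x = ∫ (tail≥ 1) (λ xs → E (x ∷ xs))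
  a = ∫ (α zero) F
  b = ∫ (β zero) G
  rearrange : ∀ a b τ B k →
    (a - (τ - B * ((ℤ.+ 1 ℚ./ 7) * (1ℚ - k)))) + (b - - ((ℤ.+ 1 ℚ./ 15) * (k * 1ℚ) * B)) ≡
    ((a + b) + B * ((ℤ.+ 1 ℚ./ 7) * (1ℚ - κ * k))) - τ
  rearrange = solve 5 (λ a b τ B k →
    (a :- (τ :- B :* (con (ℤ.+ 1 ℚ./ 7) :* (con 1ℚ :- k)))) :+
      (b :- (:- (con (ℤ.+ 1 ℚ./ 15) :* (k :* con 1ℚ) :* B))) :=
    ((a :+ b) :+ B :* (con (ℤ.+ 1 ℚ./ 7) :* (con 1ℚ :- con κ :* k))) :- τ) refl
  ∫≡ : ∫ (ballot≥ α β 0) E ≡ a + b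
  ∫≡ = begin-equality
    ∫ (ballot≥ α β 0) E                              ≡⟨ ∫-++-scale-⊗ (α zero ++ β zero) (β zero) (tail≥ 0) (tail≥ 1) E ⟩
    ∫ (α zero ++ β zero) F - ∫ (β zero) H            ≡⟨ cong (_- ∫ (β zero) H) (∫-++ (α zero) (β zero) F) ⟩
    (a + ∫ (β zero) F) - ∫ (β zero) H                ≡⟨ cong (λ t → (a + t) - ∫ (β zero) H) (trans
                                                          (∫-cong (β zero) (λ x → ballot≥-split (α ∘ suc) (β ∘ suc) 0 (λ xs → E (x ∷ xs))))
                                                          (∫-+ (β zero) H G)) ⟩
    (a + (∫ (β zero) H + b)) - ∫ (β zero) H          ≡⟨ solve 3 (λ a h b → (a :+ (h :+ b)) :- h := a :+ b) refl
                                                          a (∫ (β zero) H) b ⟩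
    a + b                                            ∎
  good : τ - B * loss n ℚ.≤ a
  good = begin
    τ - B * loss n                        ≡⟨ ℚ.*-identityˡ (τ - B * loss n) ⟨
    1ℚ * (τ - B * loss n)                 ≡⟨ cong (_* (τ - B * loss n)) (mα zero) ⟨
    mass (α zero) * (τ - B * loss n)      ≤⟨ aligned-∫ (al zero) (τ - B * loss n) F rest ⟩
    a                                     ∎
    where
    rest : ∀ x v → g zero x ≡ just v → τ - B * loss n ℚ.≤ signℚ v * F x
    rest x v eq = begin
      τ - B * loss n                                                          ≤⟨ ℚ.+-monoˡ-≤ (- (B * loss n)) ih ⟩
      (∫ (tail≥ 0) (λ xs → signℚ v * E (x ∷ xs)) + B * loss n) - B * loss n   ≡⟨ solve 2 (λ p q → (p :+ q) :- q := p) refl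
                                                                                   (∫ (tail≥ 0) (λ xs → signℚ v * E (x ∷ xs))) (B * loss n) ⟩
      ∫ (tail≥ 0) (λ xs → signℚ v * E (x ∷ xs))                               ≡⟨ ∫-*ˡ (signℚ v) (tail≥ 0) (λ xs → E (x ∷ xs)) ⟩
      signℚ v * F x                                                           ∎
      where
      -- With the first block fixed at a point of value `v`, multiplying `E` by `signℚ v` gives a
      -- function that correlates with the product of the remaining blocks.
      ih : τ ℚ.≤ ∫ (tail≥ 0) (λ xs → signℚ v * E (x ∷ xs)) + B * loss n
      ih = ballot≥-correlation (g ∘ suc) (α ∘ suc) (β ∘ suc) (al ∘ suc) (mα ∘ suc) (mβ ∘ suc)
        (λ xs → signℚ v * E (x ∷ xs)) B τ 0≤B
        (λ xs → ℚ.≤-trans (ℚ.≤-reflexive (∣signℚ*p∣ v (E (x ∷ xs)))) (E≤B (x ∷ xs)))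
        (λ xs w eq′ → ℚ.≤-trans
          (τ≤ (x ∷ xs) (v Sign.* w) (cong₂ (zipWith Sign._*_) eq eq′))
          (ℚ.≤-reflexive (trans (cong (_* E (x ∷ xs)) (signℚ-* v w))
            (solve 3 (λ v w e → v :* w :* e := w :* (v :* e)) refl (signℚ v) (signℚ w) (E (x ∷ xs))))))
  bad : - ((ℤ.+ 1 ℚ./ 15) * (κ ^ n * 1ℚ) * B) ℚ.≤ b
  bad = begin
    - ((ℤ.+ 1 ℚ./ 15) * (κ ^ n * 1ℚ) * B)           ≤⟨ ℚ.neg-antimono-≤ (begin
      abs b                                           ≡⟨ cong abs (∫-⊗ (β zero) (tail≡ 0) E) ⟨
      abs (∫ (β zero ⊗ tail≡ 0) E)                    ≤⟨ ∣∫∣≤mass (β zero ⊗ tail≡ 0) E B E≤B ⟩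
      mass (β zero ⊗ tail≡ 0) * B                     ≤⟨ weaken ⟩
      (ℤ.+ 1 ℚ./ 15) * (κ ^ n * 1ℚ) * B               ∎) ⟩
    - abs b                                         ≤⟨ -∣p∣≤p b ⟩
    b                                               ∎
    where
    weaken : mass (β zero ⊗ tail≡ 0) * B ℚ.≤ (ℤ.+ 1 ℚ./ 15) * (κ ^ n * 1ℚ) * B
    weaken = ℚ.*-monoʳ-≤-nonNeg B {{ℚ.nonNegative 0≤B}} (ℚ.≤-trans
      (ℚ.≤-reflexive (mass-⊗ (β zero) (tail≡ 0)))
      (*-mono-≤ (0≤? (ℤ.+ 1 ℚ./ 15)) (0≤mass (tail≡ 0)) (mβ zero)
        (ballot≡-mass (α ∘ suc) (β ∘ suc) (mα ∘ suc) (mβ ∘ suc) 0)))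

-- Linear programming

-- These are the two ways in which elimination combines constraints, so a property of this kind is
-- inherited by the final certificate.
record IsCone {I : Set} (C : Measure I → Set) : Set where
  field
    ++-closed    : ∀ {μ ν} → C μ → C ν → C (μ ++ ν)
    scale-closed : ∀ {r μ} → 0ℚ ℚ.< r → C μ → C (scale r μ)

-- This supplies the value of an eliminated unknown: the maximum of 0 and the lower bounds, cut down
-- to the upper bounds.
between : ∀ {W : Set} (N P : List W) (lower upper : W → ℚ) →
  (∀ {n p} → n ∈ N → p ∈ P → lower n ℚ.≤ upper p) →
  ∃[ c ] All (λ n → lower n ℚ.≤ c) N × All (λ p → c ℚ.≤ upper p) P
between []      []      lower upper le = 0ℚ , [] , []
between (n ∷ N) []      lower upper le =
  let c , N≤c , _ = between N [] lower upper (λ _ ()) in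
  lower n ℚ.⊔ c ,
  ℚ.p≤p⊔q (lower n) c ∷ All.map (λ n≤c → ℚ.≤-trans n≤c (ℚ.p≤q⊔p (lower n) c)) N≤c ,
  []
between N       (p ∷ P) lower upper le =
  let c , N≤c , c≤P = between N P lower upper (λ n∈N p∈P → le n∈N (there p∈P)) in
  upper p ℚ.⊓ c ,
  All.tabulate (λ n∈N → ℚ.⊓-glb (le n∈N (here refl)) (All.lookup N≤c n∈N)) ,
  ℚ.p⊓q≤p (upper p) c ∷ All.map (ℚ.≤-trans (ℚ.p⊓q≤q (upper p) c)) c≤P

module _ {I K : Set} (a : K → I → ℚ) (b : I → ℚ) where

  -- The linear combination y of the a k is at most b on average over μ.
  _⊨_ : Measure K → Measure I → Set
  y ⊨ μ = ∫ y (λ k → ∫ μ (a k)) ℚ.≤ ∫ μ b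

  ⊨-scale : ∀ {r} y μ → 0ℚ ℚ.< r → y ⊨ scale r μ → y ⊨ μ
  ⊨-scale {r} y μ r>0 sat = ℚ.*-cancelˡ-≤-pos r {{ℚ.positive r>0}}
    (subst₂ ℚ._≤_
      (trans (∫-cong y (λ k → ∫-scale r μ (a k))) (∫-*ˡ r y (λ k → ∫ μ (a k))))
      (∫-scale r μ b) sat)

  -- Positive rescaling turns each coefficient of the unknown `k` into 0, 1 or -1. A plus and a
  -- minus constraint then cancel by mere concatenation.
  record Split (C : Measure I → Set) (k : K) (L : List (Measure I)) : Set where
    field
      zeros pluses minuses : List (Measure I)
      zeros-C   : All (λ μ → C μ × ∫ μ (a k) ≡ 0ℚ) zeros
      pluses-C  : All (λ μ → C μ × ∫ μ (a k) ≡ 1ℚ) pluses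
      minuses-C : All (λ μ → C μ × ∫ μ (a k) ≡ - 1ℚ) minuses
      recover   : ∀ y → All (y ⊨_) zeros → All (y ⊨_) pluses → All (y ⊨_) minuses → All (y ⊨_) L

  split : ∀ {C} → IsCone C → ∀ k {L} → All C L → Split C k L
  split cone k [] = record
    { zeros = [] ; pluses = [] ; minuses = [] ; zeros-C = [] ; pluses-C = [] ; minuses-C = []
    ; recover = λ _ _ _ _ → [] }
  split cone k {μ ∷ L} (Cμ ∷ CL) with ℚ.<-cmp (∫ μ (a k)) 0ℚ | split cone k CL
  ... | tri≈ _ eq _ | S = record
    { zeros   = μ ∷ zeros
    ; zeros-C = (Cμ , eq) ∷ zeros-C
    ; recover = λ { y (μz ∷ z) p m → μz ∷ recover y z p m }
    ; pluses = pluses ; minuses = minuses ; pluses-C = pluses-C ; minuses-C = minuses-C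
    }
    where open Split S
  ... | tri> _ _ pos | S = record
    { pluses   = scale r μ ∷ pluses
    ; pluses-C = (IsCone.scale-closed cone r>0 Cμ ,
                  trans (∫-scale r μ (a k)) (trans (ℚ.*-comm r (∫ μ (a k))) eq)) ∷ pluses-C
    ; recover  = λ { y z (μp ∷ p) m → ⊨-scale y μ r>0 μp ∷ recover y z p m }
    ; zeros = zeros ; minuses = minuses ; zeros-C = zeros-C ; minuses-C = minuses-C
    }
    where
    open Split S
    inverse = divide (∫ μ (a k)) 1ℚ pos (ℚ.positive⁻¹ 1ℚ)
    r = proj₁ inverse
    r>0 = proj₁ (proj₂ inverse)
    eq = proj₂ (proj₂ inverse)
  ... | tri< neg _ _ | S = record
    { minuses   = scale r μ ∷ minuses
    ; minuses-C = (IsCone.scale-closed cone r>0 Cμ ,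
                   trans (∫-scale r μ (a k)) (trans
                     (solve 2 (λ r t → r :* t := :- ((:- t) :* r)) refl r (∫ μ (a k)))
                     (cong -_ eq))) ∷ minuses-C
    ; recover   = λ { y z p (μm ∷ m) → ⊨-scale y μ r>0 μm ∷ recover y z p m }
    ; zeros = zeros ; pluses = pluses ; zeros-C = zeros-C ; pluses-C = pluses-C
    }
    where
    open Split S
    inverse = divide (- ∫ μ (a k)) 1ℚ (ℚ.neg-antimono-< neg) (ℚ.positive⁻¹ 1ℚ)
    r = proj₁ inverse
    r>0 = proj₁ (proj₂ inverse)
    eq = proj₂ (proj₂ inverse)

  -- Farkas' lemma by Fourier–Motzkin elimination: constraints are combined so
  -- as to cancel one unknown at a time, which keeps them inside the cone C.
  farkas : ∀ ks {C} → IsCone C → ∀ {L} → All C L →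
    (∃[ y ] map proj₂ y ≡ ks × All (y ⊨_) L) ⊎
    (∃[ μ ] C μ × All (λ k → ∫ μ (a k) ≡ 0ℚ) ks × ∫ μ b ℚ.< 0ℚ)
  farkas [] cone [] = inj₁ ([] , refl , [])
  -- Without unknowns a constraint reads `0ℚ ≤ ∫ μ b`, so a violated one is itself the certificate.
  farkas [] cone {μ ∷ L} (Cμ ∷ CL) with ∫ μ b ℚ.<? 0ℚ | farkas [] cone CL
  ... | yes neg | _ = inj₂ (μ , Cμ , [] , neg)
  ... | no  nneg | inj₁ ([] , eq , sat) = inj₁ ([] , eq , ℚ.≮⇒≥ nneg ∷ sat)
  ... | no  nneg | inj₂ cert = inj₂ cert
  farkas (k ∷ ks) {C} cone {L} CL with split cone k CL
  ... | S = [ (λ (y , eq , sat) → inj₁ (extend y eq sat)) ,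
              (λ (μ , (Cμ , eq) , eqs , neg) → inj₂ (μ , Cμ , eq ∷ eqs , neg)) ]′
            (farkas ks cone′ (All.++⁺ zeros-C
              (All.cartesianProductWith⁺ (≡.setoid _) (≡.setoid _) _++_ pluses minuses
                λ p∈ n∈ → cancel (All.lookup pluses-C p∈) (All.lookup minuses-C n∈))))
    where
    open Split S
    -- Vanishing at `k` becomes part of the cone, so a certificate found for the remaining unknowns
    -- also annihilates `k`.
    C′ : Measure I → Set
    C′ μ = C μ × ∫ μ (a k) ≡ 0ℚ
    cone′ : IsCone C′
    cone′ = record
      { ++-closed    = λ {μ} {ν} (Cμ , μ0) (Cν , ν0) →
          IsCone.++-closed cone Cμ Cν , trans (∫-++ μ ν (a k)) (cong₂ _+_ μ0 ν0)
      ; scale-closed = λ {r} {μ} r>0 (Cμ , μ0) →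
          IsCone.scale-closed cone r>0 Cμ ,
          trans (∫-scale r μ (a k)) (trans (cong (r *_) μ0) (ℚ.*-zeroʳ r))
      }
    cancel : ∀ {p n} → C p × ∫ p (a k) ≡ 1ℚ → C n × ∫ n (a k) ≡ - 1ℚ → C′ (p ++ n)
    cancel {p} {n} (Cp , p1) (Cn , n1) =
      IsCone.++-closed cone Cp Cn , trans (∫-++ p n (a k)) (cong₂ _+_ p1 n1)
    L′ = zeros ++ cartesianProductWith _++_ pluses minuses
    extend : ∀ y → map proj₂ y ≡ ks → All (y ⊨_) L′ →
      ∃[ y′ ] map proj₂ y′ ≡ k ∷ ks × All (y′ ⊨_) L
    extend y eq sat = (c , k) ∷ y , cong (k ∷_) eq , recover ((c , k) ∷ y)
      (All.tabulate λ {μ} μ∈ → subst (ℚ._≤ ∫ μ b)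
        (sym (trans (cong (λ t → c * t + Y μ) (proj₂ (All.lookup zeros-C μ∈)))
          (trans (cong (_+ Y μ) (ℚ.*-zeroʳ c)) (ℚ.+-identityˡ (Y μ)))))
        (All.lookup (All.++⁻ˡ zeros sat) μ∈))
      (All.tabulate λ {p} p∈ → subst₂ ℚ._≤_
        (sym (trans (cong (λ t → c * t + Y p) (proj₂ (All.lookup pluses-C p∈)))
          (cong (_+ Y p) (ℚ.*-identityʳ c))))
        (solve 2 (λ b y → b :- y :+ y := b) refl (∫ p b) (Y p))
        (ℚ.+-monoˡ-≤ (Y p) (All.lookup c≤ p∈)))
      (All.tabulate λ {n} n∈ → subst₂ ℚ._≤_
        (trans (solve 3 (λ y b c → (y :- b) :+ (b :- c) := c :* con (- 1ℚ) :+ y) refl (Y n) (∫ n b) c)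
          (cong (λ t → c * t + Y n) (sym (proj₂ (All.lookup minuses-C n∈)))))
        (solve 2 (λ b c → c :+ (b :- c) := b) refl (∫ n b) c)
        (ℚ.+-monoˡ-≤ (∫ n b - c) (All.lookup ≤c n∈)))
      where
      Y : Measure I → ℚ
      Y μ = ∫ y (λ k → ∫ μ (a k))
      -- The solution for the other unknowns satisfies the combined constraint `p ++ n`. Rearranged,
      -- it places the lower bound from `n` below the upper bound from `p`.
      cross : ∀ {n p} → n ∈ minuses → p ∈ pluses → Y n - ∫ n b ℚ.≤ ∫ p b - Y p
      cross {n} {p} n∈ p∈ = subst₂ ℚ._≤_
        (trans (cong (_- (Y p + ∫ n b)) (trans
            (∫-cong y (λ k → ∫-++ p n (a k))) (∫-+ y (λ k → ∫ p (a k)) (λ k → ∫ n (a k)))))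
          (solve 3 (λ yp yn bn → (yp :+ yn) :- (yp :+ bn) := yn :- bn) refl (Y p) (Y n) (∫ n b)))
        (trans (cong (_- (Y p + ∫ n b)) (∫-++ p n b))
          (solve 3 (λ bp bn yp → (bp :+ bn) :- (yp :+ bn) := bp :- yp) refl (∫ p b) (∫ n b) (Y p)))
        (ℚ.+-monoˡ-≤ (- (Y p + ∫ n b)) (All.lookup sat
          (∈-++⁺ʳ zeros (∈-cartesianProductWith⁺ _++_ p∈ n∈))))
      separated = between minuses pluses (λ n → Y n - ∫ n b) (λ p → ∫ p b - Y p) cross
      c  = proj₁ separated
      ≤c = proj₁ (proj₂ separated)
      c≤ = proj₂ (proj₂ separated)

-- Duality for approximate degree

module _ {V Y : Set} (var : V → Y → ℚ) where

  monomial : List V → Y → ℚ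
  monomial []      y = 1ℚ
  monomial (v ∷ w) y = var v y * monomial w y

  monomial-degree : ∀ {k} w → length w ≤ k → Degree≤ var k (monomial w)
  monomial-degree []      z≤n       = const 1ℚ
  monomial-degree (v ∷ w) (s≤s len) = mult v (monomial-degree w len)

  -- The derivation is unrolled while the variables met so far collect in `w`. Each leaf is a
  -- constant times a monomial of length below `k`.
  orth-monomials : ∀ {k μ} → (∀ w → length w ℕ.< k → ∫ μ (monomial w) ≡ 0ℚ) → Orth var k μ
  orth-monomials {k} {μ} ⊥w {g = g} p j<k =
    trans (∫-cong μ (λ y → sym (ℚ.*-identityˡ (g y)))) (go [] p j<k)
    where
    go : ∀ w {j g} → Degree≤ var j g → length w ℕ.+ j ℕ.< k → ∫ μ (λ y → monomial w y * g y) ≡ 0ℚ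
    go w (const c) lt = trans (∫-*ʳ c μ (monomial w))
      (trans (cong (_* c) (⊥w w (ℕ.≤-<-trans (ℕ.m≤m+n _ _) lt))) (ℚ.*-zeroˡ c))
    go w (add {g = g} {h} p q) lt =
      trans (∫-cong μ (λ y → ℚ.*-distribˡ-+ (monomial w y) (g y) (h y)))
        (trans (∫-+ μ (λ y → monomial w y * g y) (λ y → monomial w y * h y))
          (cong₂ _+_ (go w p lt) (go w q lt)))
    go w (mult {k = j} {g} v p) lt =
      trans (∫-cong μ (λ y → solve 3 (λ m v g → m :* (v :* g) := v :* m :* g) refl
          (monomial w y) (var v y) (g y)))
        (go (v ∷ w) p (subst (ℕ._< k) (ℕ.+-suc (length w) j) lt))
    go w (ext eq p) lt =
      trans (∫-cong μ (λ y → cong (monomial w y *_) (sym (eq y)))) (go w p lt)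

-- Distinct words may be the same function on the cube. This redundancy among the unknowns does no
-- harm to the linear program.
words : ∀ {V : Set} → List V → ℕ → List (List V)
words vs zero    = [] ∷ []
words vs (suc k) = [] ∷ cartesianProductWith _∷_ vs (words vs k)

words-length : ∀ {V : Set} (vs : List V) k → All (λ w → length w ≤ k) (words vs k)
words-length vs zero    = z≤n ∷ []
words-length vs (suc k) = z≤n ∷
  All.cartesianProductWith⁺ (≡.setoid _) (≡.setoid _) _∷_ vs (words vs k)
    (λ _ w∈ → s≤s (All.lookup (words-length vs k) w∈))

words-complete : ∀ {V : Set} {vs : List V} → (∀ v → v ∈ vs) → ∀ {k} w → length w ≤ k → w ∈ words vs k
words-complete all {zero}  []      _         = here refl
words-complete all {suc k} []      _         = here refl
words-complete all {suc k} (v ∷ w) (s≤s len) =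
  there (∈-cartesianProductWith⁺ _∷_ (all v) (words-complete all w len))

signs : List Sign
signs = Sign.- ∷ Sign.+ ∷ []

∈-signs : ∀ s → s ∈ signs
∈-signs Sign.- = here refl
∈-signs Sign.+ = there (here refl)

points : ∀ m → List (Vec Sign m)
points zero    = [] ∷ []
points (suc m) = cartesianProductWith _∷_ signs (points m)

∈-points : ∀ {m} (x : Vec Sign m) → x ∈ points m
∈-points []      = here refl
∈-points (s ∷ x) = ∈-cartesianProductWith⁺ _∷_ (∈-signs s) (∈-points x)

-- A bound on an absolute value is split into two linear inequalities, one for each sign `s`, as the
-- linear program requires.
bound : ℚ → Maybe Sign → Sign → ℚ
bound ε (just v) s = signℚ s * signℚ v + ε
bound ε nothing  s = 1ℚ + ε

-- |g - v| ≤ ε where f has the value v, and |g| ≤ 1 + ε off its domain.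
Approximatesℚ : ∀ {X : Set} → ℚ → (X → Maybe Sign) → (X → ℚ) → Set
Approximatesℚ ε f g = ∀ x s → signℚ s * g x ℚ.≤ bound ε (f x) s

-- `good` and `bad` are the α and β of the overview. `bad` may have atoms both on and off the
-- domain.
record DualPolynomial {m} (f : Vec Sign m → Maybe Sign) (k : ℕ) : Set where
  field
    good bad   : Measure (Vec Sign m)
    orthogonal : Orth coordinate k (good ++ bad)
    aligned    : Aligned f good
    mass-good  : mass good ≡ 1ℚ
    mass-bad   : mass bad ℚ.≤ ℤ.+ 1 ℚ./ 15

NonNegative : ∀ {I : Set} → Measure I → Set
NonNegative = All (λ (c , _) → 0ℚ ℚ.≤ c)

nonNegative-cone : ∀ {I : Set} → IsCone {I} NonNegative
nonNegative-cone = record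
  { ++-closed    = All.++⁺
  ; scale-closed = λ r>0 C → All.map⁺ (All.map (0≤* (ℚ.<⇒≤ r>0)) C)
  }

-- Chosen so that (1 - ε₀) / (1 + ε₀) = 1/15.
ε₀ : ℚ
ε₀ = ℤ.+ 7 ℚ./ 8

module _ {X : Set} (f : X → Maybe Sign) where

  -- An atom of weight c on the constraint (x, s) becomes the weight -s c at x. It belongs to `good`
  -- exactly when s is opposite to the value of f at x, where the bound is -1/8. Everywhere else the
  -- bound is 15/8, and the atom goes to `bad`. Hence a negative value of a Farkas certificate says
  -- that `mass bad` is below 1/15 of `mass good`.
  record SeparatedSigns (μ : Measure (X × Sign)) : Set where
    field
      good bad : Measure X
      aligned  : Aligned f good
      ∫≡       : ∀ g → ∫ (good ++ bad) g ≡ - ∫ μ (λ (x , s) → signℚ s * g x)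
      mass≡    : ∫ μ (λ (x , s) → bound ε₀ (f x) s) ≡ (ℤ.+ 15 ℚ./ 8) * mass bad - (ℤ.+ 1 ℚ./ 8) * mass good

  separateSigns : ∀ {μ} → NonNegative μ → SeparatedSigns μ
  separateSigns [] = record { good = [] ; bad = [] ; aligned = [] ; ∫≡ = λ _ → refl ; mass≡ = refl }
  separateSigns {(c , x , s) ∷ μ} (0≤c ∷ nn) = place (f x) refl s
    where
    open SeparatedSigns (separateSigns nn)
    rest : (X → ℚ) → ℚ
    rest g = ∫ μ (λ (x , s) → signℚ s * g x)
    ∣weight∣ : ∀ s → abs (- (signℚ s * c)) ≡ c
    ∣weight∣ s = trans (ℚ.∣-p∣≡∣p∣ (signℚ s * c)) (trans (∣signℚ*p∣ s c) (ℚ.0≤p⇒∣p∣≡p 0≤c))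
    opposite-* : ∀ s → signℚ (Sign.opposite s) * (- (signℚ s * c)) ≡ c
    opposite-* Sign.- = solve 1 (λ c → con 1ℚ :* (:- (con (- 1ℚ) :* c)) := c) refl c
    opposite-* Sign.+ = solve 1 (λ c → con (- 1ℚ) :* (:- (con 1ℚ :* c)) := c) refl c
    toGood : ∀ s → f x ≡ just (Sign.opposite s) → bound ε₀ (f x) s ≡ - (ℤ.+ 1 ℚ./ 8) →
      SeparatedSigns ((c , x , s) ∷ μ)
    toGood s eq b≡ = record
      { good    = (- (signℚ s * c) , x) ∷ good
      ; bad     = bad
      ; aligned = (Sign.opposite s , eq , subst (0ℚ ℚ.≤_) (sym (opposite-* s)) 0≤c) ∷ aligned
      ; ∫≡      = λ g → trans (cong (- (signℚ s * c) * g x +_) (∫≡ g))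
          (solve 4 (λ s c g r → (:- (s :* c)) :* g :+ (:- r) := :- (c :* (s :* g) :+ r)) refl
            (signℚ s) c (g x) (rest g))
      ; mass≡   = begin
          c * bound ε₀ (f x) s + ∫ μ (λ (x , s) → bound ε₀ (f x) s)
            ≡⟨ cong₂ (λ b r → c * b + r) b≡ mass≡ ⟩
          c * (- (ℤ.+ 1 ℚ./ 8)) + ((ℤ.+ 15 ℚ./ 8) * mass bad - (ℤ.+ 1 ℚ./ 8) * mass good)
            ≡⟨ solve 3 (λ c p q → c :* con (- (ℤ.+ 1 ℚ./ 8)) :+ (con (ℤ.+ 15 ℚ./ 8) :* p :- con (ℤ.+ 1 ℚ./ 8) :* q)
                               := con (ℤ.+ 15 ℚ./ 8) :* p :- con (ℤ.+ 1 ℚ./ 8) :* (c :+ q)) refl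
                 c (mass bad) (mass good) ⟩
          (ℤ.+ 15 ℚ./ 8) * mass bad - (ℤ.+ 1 ℚ./ 8) * (c + mass good)
            ≡⟨ cong (λ t → (ℤ.+ 15 ℚ./ 8) * mass bad - (ℤ.+ 1 ℚ./ 8) * (t + mass good)) (∣weight∣ s) ⟨
          (ℤ.+ 15 ℚ./ 8) * mass bad - (ℤ.+ 1 ℚ./ 8) * (abs (- (signℚ s * c)) + mass good) ∎
      }
      where open ≡-Reasoning
    toBad : ∀ s → bound ε₀ (f x) s ≡ ℤ.+ 15 ℚ./ 8 → SeparatedSigns ((c , x , s) ∷ μ)
    toBad s b≡ = record
      { good    = good
      ; bad     = (- (signℚ s * c) , x) ∷ bad
      ; aligned = aligned
      ; ∫≡      = λ g → begin
          ∫ (good ++ (- (signℚ s * c) , x) ∷ bad) g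
            ≡⟨ ∫-++ good ((- (signℚ s * c) , x) ∷ bad) g ⟩
          ∫ good g + (- (signℚ s * c) * g x + ∫ bad g)
            ≡⟨ solve 5 (λ a s c g b → a :+ ((:- (s :* c)) :* g :+ b) := (a :+ b) :- c :* (s :* g)) refl
                 (∫ good g) (signℚ s) c (g x) (∫ bad g) ⟩
          (∫ good g + ∫ bad g) - c * (signℚ s * g x)
            ≡⟨ cong (_- c * (signℚ s * g x)) (trans (sym (∫-++ good bad g)) (∫≡ g)) ⟩
          - rest g - c * (signℚ s * g x)
            ≡⟨ solve 2 (λ r t → (:- r) :- t := :- (t :+ r)) refl (rest g) (c * (signℚ s * g x)) ⟩
          - (c * (signℚ s * g x) + rest g) ∎
      ; mass≡   = begin
          c * bound ε₀ (f x) s + ∫ μ (λ (x , s) → bound ε₀ (f x) s)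
            ≡⟨ cong₂ (λ b r → c * b + r) b≡ mass≡ ⟩
          c * (ℤ.+ 15 ℚ./ 8) + ((ℤ.+ 15 ℚ./ 8) * mass bad - (ℤ.+ 1 ℚ./ 8) * mass good)
            ≡⟨ solve 3 (λ c p q → c :* con (ℤ.+ 15 ℚ./ 8) :+ (con (ℤ.+ 15 ℚ./ 8) :* p :- con (ℤ.+ 1 ℚ./ 8) :* q)
                               := con (ℤ.+ 15 ℚ./ 8) :* (c :+ p) :- con (ℤ.+ 1 ℚ./ 8) :* q) refl
                 c (mass bad) (mass good) ⟩
          (ℤ.+ 15 ℚ./ 8) * (c + mass bad) - (ℤ.+ 1 ℚ./ 8) * mass good
            ≡⟨ cong (λ t → (ℤ.+ 15 ℚ./ 8) * (t + mass bad) - (ℤ.+ 1 ℚ./ 8) * mass good) (∣weight∣ s) ⟨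
          (ℤ.+ 15 ℚ./ 8) * (abs (- (signℚ s * c)) + mass bad) - (ℤ.+ 1 ℚ./ 8) * mass good ∎
      }
      where open ≡-Reasoning
    place : ∀ v → f x ≡ v → ∀ s → SeparatedSigns ((c , x , s) ∷ μ)
    place nothing       eq s      = toBad s (cong (λ t → bound ε₀ t s) eq)
    place (just Sign.-) eq Sign.- = toBad Sign.- (cong (λ t → bound ε₀ t Sign.-) eq)
    place (just Sign.+) eq Sign.+ = toBad Sign.+ (cong (λ t → bound ε₀ t Sign.+) eq)
    place (just Sign.-) eq Sign.+ = toGood Sign.+ eq (cong (λ t → bound ε₀ t Sign.+) eq)
    place (just Sign.+) eq Sign.- = toGood Sign.- eq (cong (λ t → bound ε₀ t Sign.-) eq)

aligned-scale : ∀ {X : Set} {f : X → Maybe Sign} {μ r} → 0ℚ ℚ.≤ r → Aligned f μ → Aligned f (scale r μ)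
aligned-scale {μ = μ} {r} 0≤r al = All.map⁺ (All.map
  (λ {(c , x)} (v , eq , 0≤vc) → v , eq , subst (0ℚ ℚ.≤_)
    (solve 3 (λ r v c → r :* (v :* c) := v :* (r :* c)) refl r (signℚ v) c) (0≤* 0≤r 0≤vc)) al)

-- The unknowns of the linear program are the coefficients of the words of length at most `k`. If it
-- has no solution, the Farkas multipliers annihilate all these words, which after separating signs
-- is orthogonality to degree below `suc k`.
approximation⊎dual : ∀ {m} (f : Vec Sign m → Maybe Sign) k →
  (∃[ g ] Degree≤ coordinate k g × Approximatesℚ ε₀ f g) ⊎ DualPolynomial f (suc k)
approximation⊎dual {m} f k = [ inj₁ ∘ primal , inj₂ ∘ dual ]′
  (farkas a b (words (allFin m) k) nonNegative-cone constraints-nonNegative)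
  where
  a : List (Fin m) → Vec Sign m × Sign → ℚ
  a w (x , s) = signℚ s * monomial coordinate w x
  b : Vec Sign m × Sign → ℚ
  b (x , s) = bound ε₀ (f x) s
  δ : Vec Sign m × Sign → Measure (Vec Sign m × Sign)
  δ i = (1ℚ , i) ∷ []
  constraints : List (Measure (Vec Sign m × Sign))
  constraints = map δ (cartesianProduct (points m) signs)
  constraints-nonNegative : All NonNegative constraints
  constraints-nonNegative = All.map⁺ (All.universal (λ _ → 0≤? 1ℚ ∷ []) _)

  primal : (∃[ y ] map proj₂ y ≡ words (allFin m) k × All (_⊨_ a b y) constraints) →
    ∃[ g ] Degree≤ coordinate k g × Approximatesℚ ε₀ f g
  primal (y , eq , sat) = g , degree y (All.map⁻ (subst (All _) (sym eq) (words-length (allFin m) k))) , approx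
    where
    g : Vec Sign m → ℚ
    g x = ∫ y (λ w → monomial coordinate w x)
    degree : ∀ y → All (λ (_ , w) → length w ≤ k) y →
      Degree≤ coordinate k (λ x → ∫ y (λ w → monomial coordinate w x))
    degree []            []         = const 0ℚ
    degree ((c , w) ∷ y) (len ∷ ls) = add (degree-scale c (monomial-degree coordinate w len)) (degree y ls)
    approx : Approximatesℚ ε₀ f g
    approx x s = subst₂ ℚ._≤_
      (trans (∫-cong y (λ w → trans (ℚ.+-identityʳ (1ℚ * a w (x , s))) (ℚ.*-identityˡ (a w (x , s)))))
        (∫-*ˡ (signℚ s) y (λ w → monomial coordinate w x)))
      (trans (ℚ.+-identityʳ (1ℚ * b (x , s))) (ℚ.*-identityˡ (b (x , s))))
      (All.lookup sat (∈-map⁺ δ (∈-cartesianProduct⁺ (∈-points x) (∈-signs s))))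

  dual : (∃[ μ ] NonNegative μ × All (λ w → ∫ μ (a w) ≡ 0ℚ) (words (allFin m) k) × ∫ μ b ℚ.< 0ℚ) →
    DualPolynomial f (suc k)
  dual (μ , nn , zero-moments , neg) = record
    { good       = scale r good
    ; bad        = scale r bad
    ; orthogonal = orth-monomials coordinate {μ = scale r good ++ scale r bad} λ { w (s≤s len) → begin-equality
        ∫ (scale r good ++ scale r bad) (monomial coordinate w)
          ≡⟨ ∫-scale-++ (monomial coordinate w) ⟩
        r * ∫ (good ++ bad) (monomial coordinate w)
          ≡⟨ cong (r *_) (trans (∫≡ (monomial coordinate w))
               (cong -_ (All.lookup zero-moments (words-complete ∈-allFin w len)))) ⟩
        r * 0ℚ
          ≡⟨ ℚ.*-zeroʳ r ⟩
        0ℚ ∎ }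
    ; aligned    = aligned-scale (ℚ.<⇒≤ r>0) aligned
    ; mass-good  = trans (mass-scale r good) (trans (cong (_* mass good) ∣r∣≡r)
                     (trans (ℚ.*-comm r (mass good)) inv))
    ; mass-bad   = begin
        mass (scale r bad)                          ≡⟨ trans (mass-scale r bad) (cong (_* mass bad) ∣r∣≡r) ⟩
        r * mass bad                                ≤⟨ ℚ.*-monoˡ-≤-nonNeg r {{ℚ.nonNegative (ℚ.<⇒≤ r>0)}} (ℚ.<⇒≤ bad<) ⟩
        r * ((ℤ.+ 1 ℚ./ 15) * mass good)            ≡⟨ solve 3 (λ r c g → r :* (c :* g) := c :* (g :* r)) refl
                                                         r (ℤ.+ 1 ℚ./ 15) (mass good) ⟩
        (ℤ.+ 1 ℚ./ 15) * (mass good * r)            ≡⟨ cong ((ℤ.+ 1 ℚ./ 15) *_) inv ⟩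
        (ℤ.+ 1 ℚ./ 15) * 1ℚ                         ≡⟨ ℚ.*-identityʳ (ℤ.+ 1 ℚ./ 15) ⟩
        ℤ.+ 1 ℚ./ 15                                ∎
    }
    where
    open ℚ.≤-Reasoning
    open SeparatedSigns (separateSigns f nn)
    bad< : mass bad ℚ.< (ℤ.+ 1 ℚ./ 15) * mass good
    bad< = begin-strict
      mass bad
        ≡⟨ solve 2 (λ p q → p := con (ℤ.+ 8 ℚ./ 15) :* (con (ℤ.+ 15 ℚ./ 8) :* p :- con (ℤ.+ 1 ℚ./ 8) :* q)
                             :+ con (ℤ.+ 1 ℚ./ 15) :* q) refl (mass bad) (mass good) ⟩
      (ℤ.+ 8 ℚ./ 15) * ((ℤ.+ 15 ℚ./ 8) * mass bad - (ℤ.+ 1 ℚ./ 8) * mass good) + (ℤ.+ 1 ℚ./ 15) * mass good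
        <⟨ ℚ.+-monoˡ-< ((ℤ.+ 1 ℚ./ 15) * mass good)
             (ℚ.*-monoʳ-<-pos (ℤ.+ 8 ℚ./ 15) (subst (ℚ._< 0ℚ) mass≡ neg)) ⟩
      (ℤ.+ 8 ℚ./ 15) * 0ℚ + (ℤ.+ 1 ℚ./ 15) * mass good
        ≡⟨ ℚ.+-identityˡ ((ℤ.+ 1 ℚ./ 15) * mass good) ⟩
      (ℤ.+ 1 ℚ./ 15) * mass good ∎
    -- Strictness of `bad<` excludes an empty good part, so the measure can be normalised.
    good>0 : 0ℚ ℚ.< mass good
    good>0 = ℚ.*-cancelˡ-<-nonNeg (ℤ.+ 1 ℚ./ 15) (ℚ.≤-<-trans (0≤mass bad) bad<)
    inverse = divide (mass good) 1ℚ good>0 (ℚ.positive⁻¹ 1ℚ)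
    r   = proj₁ inverse
    r>0 = proj₁ (proj₂ inverse)
    inv = proj₂ (proj₂ inverse)
    ∣r∣≡r : abs r ≡ r
    ∣r∣≡r = ℚ.0≤p⇒∣p∣≡p (ℚ.<⇒≤ r>0)
    ∫-scale-++ : ∀ g → ∫ (scale r good ++ scale r bad) g ≡ r * ∫ (good ++ bad) g
    ∫-scale-++ g = begin-equality
      ∫ (scale r good ++ scale r bad) g        ≡⟨ ∫-++ (scale r good) (scale r bad) g ⟩
      ∫ (scale r good) g + ∫ (scale r bad) g   ≡⟨ cong₂ _+_ (∫-scale r good g) (∫-scale r bad g) ⟩
      r * ∫ good g + r * ∫ bad g               ≡⟨ ℚ.*-distribˡ-+ r (∫ good g) (∫ bad g) ⟨
      r * (∫ good g + ∫ bad g)                 ≡⟨ cong (r *_) (∫-++ good bad g) ⟨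
      r * ∫ (good ++ bad) g                    ∎

-- Error reduction

-- The odd cubic (3t - t^3)/2 fixes -1, 0 and 1 and pushes all other points of [-1, 1] towards the
-- nearer end. Each iteration triples the degree.
smooth : ℚ → ℚ
smooth t = ½ * (t * (ℤ.+ 3 ℚ./ 1 - t * t))

smooth-signℚ : ∀ s t → smooth (signℚ s * t) ≡ signℚ s * smooth t
smooth-signℚ Sign.- = solve 1 (λ t →
  let u = con (- 1ℚ) :* t in
  con ½ :* (u :* (con (ℤ.+ 3 ℚ./ 1) :- u :* u)) :=
  con (- 1ℚ) :* (con ½ :* (t :* (con (ℤ.+ 3 ℚ./ 1) :- t :* t)))) refl
smooth-signℚ Sign.+ = solve 1 (λ t →
  let u = con 1ℚ :* t in
  con ½ :* (u :* (con (ℤ.+ 3 ℚ./ 1) :- u :* u)) :=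
  con 1ℚ :* (con ½ :* (t :* (con (ℤ.+ 3 ℚ./ 1) :- t :* t)))) refl

-- By the factorisation 1 - smooth(t) = (1 - t)^2 (2 + t) / 2.
smooth-≤1 : ∀ {t} → t ℚ.≤ 1ℚ → - t ℚ.≤ 1ℚ → smooth t ℚ.≤ 1ℚ
smooth-≤1 {t} t≤1 -t≤1 = 0≤-⇒≤ (subst (0ℚ ℚ.≤_)
  (solve 1 (λ t → con ½ :* (((con 1ℚ :- t) :* (con 1ℚ :- t)) :* (con 1ℚ :+ (con 1ℚ :- (:- t)))) :=
                  con 1ℚ :- con ½ :* (t :* (con (ℤ.+ 3 ℚ./ 1) :- t :* t))) refl t)
  (0≤* (0≤? ½) (0≤* (0≤* 0≤1-t 0≤1-t) (ℚ.+-mono-≤ (0≤? 1ℚ) (≤⇒0≤- -t≤1)))))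
  where
  0≤1-t = ≤⇒0≤- t≤1

smooth-increases : ∀ {t} → 0ℚ ℚ.≤ t → t ℚ.≤ 1ℚ → t ℚ.≤ smooth t
smooth-increases {t} 0≤t t≤1 = 0≤-⇒≤ (subst (0ℚ ℚ.≤_)
  (solve 1 (λ t → con ½ :* (t :* ((con 1ℚ :- t) :* (con 1ℚ :+ t))) :=
                  con ½ :* (t :* (con (ℤ.+ 3 ℚ./ 1) :- t :* t)) :- t) refl t)
  (0≤* (0≤? ½) (0≤* 0≤t (0≤* (≤⇒0≤- t≤1) (ℚ.+-mono-≤ (0≤? 1ℚ) 0≤t)))))

-- The factor (3 - t^2)/2 is at least 23/18 for t up to 2/3, which exceeds 5/4.
smooth-amplifies : ∀ {t} → 0ℚ ℚ.≤ t → t ℚ.≤ ℤ.+ 2 ℚ./ 3 → (ℤ.+ 5 ℚ./ 4) * t ℚ.≤ smooth t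
smooth-amplifies {t} 0≤t t≤⅔ = 0≤-⇒≤ (subst (0ℚ ℚ.≤_)
  (solve 1 (λ t → con ½ :* (t :* (con (ℤ.+ 1 ℚ./ 18) :+
                    (con (ℤ.+ 2 ℚ./ 3) :- t) :* (con (ℤ.+ 2 ℚ./ 3) :+ t))) :=
                  con ½ :* (t :* (con (ℤ.+ 3 ℚ./ 1) :- t :* t)) :- con (ℤ.+ 5 ℚ./ 4) :* t) refl t)
  (0≤* (0≤? ½) (0≤* 0≤t (ℚ.+-mono-≤ (0≤? (ℤ.+ 1 ℚ./ 18))
    (0≤* (≤⇒0≤- t≤⅔) (ℚ.+-mono-≤ (0≤? (ℤ.+ 2 ℚ./ 3)) 0≤t))))))

smoothed : ℕ → ℚ → ℚ
smoothed zero    t = t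
smoothed (suc n) t = smooth (smoothed n t)

smoothed-signℚ : ∀ n s t → smoothed n (signℚ s * t) ≡ signℚ s * smoothed n t
smoothed-signℚ zero    s t = refl
smoothed-signℚ (suc n) s t = trans (cong smooth (smoothed-signℚ n s t)) (smooth-signℚ s (smoothed n t))

smoothed-≤1 : ∀ n {t} → (∀ s → signℚ s * t ℚ.≤ 1ℚ) → ∀ s → signℚ s * smoothed n t ℚ.≤ 1ℚ
smoothed-≤1 zero    t≤1 s = t≤1 s
smoothed-≤1 (suc n) {t} t≤1 s = subst (ℚ._≤ 1ℚ) (smooth-signℚ s (smoothed n t))
  (smooth-≤1 (smoothed-≤1 n t≤1 s)
    (subst (ℚ._≤ 1ℚ) (negate s) (smoothed-≤1 n t≤1 (Sign.opposite s))))
  where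
  negate : ∀ s → signℚ (Sign.opposite s) * smoothed n t ≡ - (signℚ s * smoothed n t)
  negate Sign.- = solve 1 (λ u → con 1ℚ :* u := :- (con (- 1ℚ) :* u)) refl (smoothed n t)
  negate Sign.+ = solve 1 (λ u → con (- 1ℚ) :* u := :- (con 1ℚ :* u)) refl (smoothed n t)

-- The factor 5/4 is guaranteed only up to 2/3, so the alternative records that 2/3 has been
-- reached. From there on `smooth-increases` keeps the iterate above it.
smoothed-grows : ∀ n {t} → ℤ.+ 1 ℚ./ 16 ℚ.≤ t → (∀ s → signℚ s * t ℚ.≤ 1ℚ) →
  0ℚ ℚ.≤ smoothed n t ×
  ((ℤ.+ 5 ℚ./ 4) ^ n * (ℤ.+ 1 ℚ./ 16) ℚ.≤ smoothed n t ⊎ ℤ.+ 2 ℚ./ 3 ℚ.≤ smoothed n t)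
smoothed-grows zero    {t} lo t≤1 =
  ℚ.≤-trans (0≤? (ℤ.+ 1 ℚ./ 16)) lo , inj₁ (subst (ℚ._≤ t) (sym (ℚ.*-identityˡ (ℤ.+ 1 ℚ./ 16))) lo)
smoothed-grows (suc n) {t} lo t≤1 with smoothed-grows n lo t≤1
... | 0≤u , reach = ℚ.≤-trans 0≤u u≤smooth , step reach (ℚ.≤-total u (ℤ.+ 2 ℚ./ 3))
  where
  u = smoothed n t
  u≤smooth : u ℚ.≤ smooth u
  u≤smooth = smooth-increases 0≤u (subst (ℚ._≤ 1ℚ) (ℚ.*-identityˡ u) (smoothed-≤1 n t≤1 Sign.+))
  step : (ℤ.+ 5 ℚ./ 4) ^ n * (ℤ.+ 1 ℚ./ 16) ℚ.≤ u ⊎ ℤ.+ 2 ℚ./ 3 ℚ.≤ u →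
    u ℚ.≤ ℤ.+ 2 ℚ./ 3 ⊎ ℤ.+ 2 ℚ./ 3 ℚ.≤ u →
    (ℤ.+ 5 ℚ./ 4) ^ suc n * (ℤ.+ 1 ℚ./ 16) ℚ.≤ smooth u ⊎ ℤ.+ 2 ℚ./ 3 ℚ.≤ smooth u
  step (inj₁ le)  (inj₁ u≤⅔) = inj₁ (ℚ.≤-trans
    (ℚ.≤-reflexive (ℚ.*-assoc (ℤ.+ 5 ℚ./ 4) ((ℤ.+ 5 ℚ./ 4) ^ n) (ℤ.+ 1 ℚ./ 16)))
    (ℚ.≤-trans (ℚ.*-monoˡ-≤-nonNeg (ℤ.+ 5 ℚ./ 4) le) (smooth-amplifies 0≤u u≤⅔)))
  step (inj₂ ⅔≤u) _          = inj₂ (ℚ.≤-trans ⅔≤u u≤smooth)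
  step _          (inj₂ ⅔≤u) = inj₂ (ℚ.≤-trans ⅔≤u u≤smooth)

abstract
  -- Eleven is the least choice: (5/4)^11 / 16 is about 0.73, while ten rounds give about 0.58.
  rounds : ∃[ n ] ℤ.+ 2 ℚ./ 3 ℚ.≤ (ℤ.+ 5 ℚ./ 4) ^ n * (ℤ.+ 1 ℚ./ 16)
  rounds = 11 , toWitness {a? = (ℤ.+ 2 ℚ./ 3) ℚ.≤? ((ℤ.+ 5 ℚ./ 4) ^ 11 * (ℤ.+ 1 ℚ./ 16))} _

amplify : ℚ → ℚ
amplify = smoothed (proj₁ rounds)

amplify-≥⅔ : ∀ {t} → ℤ.+ 1 ℚ./ 16 ℚ.≤ t → (∀ s → signℚ s * t ℚ.≤ 1ℚ) → ℤ.+ 2 ℚ./ 3 ℚ.≤ amplify t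
amplify-≥⅔ lo t≤1 with proj₂ (smoothed-grows (proj₁ rounds) lo t≤1)
... | inj₁ le = ℚ.≤-trans (proj₂ rounds) le
... | inj₂ le = le

smooth-degree : ∀ {V Y : Set} {var : V → Y → ℚ} {k g} → Degree≤ var k g →
  Degree≤ var (3 ℕ.* k) (λ y → smooth (g y))
smooth-degree {var = var} {k} {g} p = ext (λ y → cong (λ u → ½ * (g y * u))
    (solve 1 (λ t → con (ℤ.+ 3 ℚ./ 1) :+ con (- 1ℚ) :* (t :* t) := con (ℤ.+ 3 ℚ./ 1) :- t :* t) refl (g y)))
  (subst (λ j → Degree≤ var j (λ y → ½ * (g y * (ℤ.+ 3 ℚ./ 1 + (- 1ℚ) * (g y * g y)))))
    (cong (λ j → k ℕ.+ (k ℕ.+ j)) (sym (ℕ.+-identityʳ k)))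
    (degree-scale ½ (degree-* p (add (const (ℤ.+ 3 ℚ./ 1)) (degree-scale (- 1ℚ) (degree-* p p))))))

smoothed-degree : ∀ {V Y : Set} {var : V → Y → ℚ} {k g} n → Degree≤ var k g →
  Degree≤ var (3 ℕ.^ n ℕ.* k) (λ y → smoothed n (g y))
smoothed-degree {var = var} {k} {g} zero    p =
  subst (λ j → Degree≤ var j g) (sym (ℕ.+-identityʳ k)) p
smoothed-degree {var = var} {k} {g} (suc n) p =
  subst (λ j → Degree≤ var j (λ y → smoothed (suc n) (g y))) (sym (ℕ.*-assoc 3 (3 ℕ.^ n) k))
    (smooth-degree (smoothed-degree n p))

bound₀-≤ : ∀ v s → bound ε₀ v s ℚ.≤ ℤ.+ 15 ℚ./ 8
bound₀-≤ nothing       s      = ℚ.≤-refl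
bound₀-≤ (just Sign.-) Sign.- = ℚ.≤-refl
bound₀-≤ (just Sign.-) Sign.+ = ℚ.≤-trans (ℚ.nonPositive⁻¹ (- (ℤ.+ 1 ℚ./ 8))) (0≤? (ℤ.+ 15 ℚ./ 8))
bound₀-≤ (just Sign.+) Sign.- = ℚ.≤-trans (ℚ.nonPositive⁻¹ (- (ℤ.+ 1 ℚ./ 8))) (0≤? (ℤ.+ 15 ℚ./ 8))
bound₀-≤ (just Sign.+) Sign.+ = ℚ.≤-refl

⅓ : ℚ
⅓ = ℤ.+ 1 ℚ./ 3

-- On the domain v g lies between 1/8 and 15/8, and off it abs(g) is at most 15/8. Halving brings
-- all values into [-1, 1], which the iteration preserves, and leaves v g/2 at least 1/16 on the
-- domain. The iterate then has v u between 2/3 and 1, so it is within 1/3 of v.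
reduceError : ∀ {X : Set} {f : X → Maybe Sign} {g} → Approximatesℚ ε₀ f g →
  Approximatesℚ ⅓ f (λ x → amplify (½ * g x))
reduceError {f = f} {g} approx x = conclude (f x) refl
  where
  t = ½ * g x
  halve : ∀ s → signℚ s * t ≡ ½ * (signℚ s * g x)
  halve s = solve 3 (λ s h g → s :* (h :* g) := h :* (s :* g)) refl (signℚ s) ½ (g x)
  t≤1 : ∀ s → signℚ s * t ℚ.≤ 1ℚ
  t≤1 s = ℚ.≤-trans (ℚ.≤-reflexive (halve s)) (ℚ.≤-trans
    (ℚ.*-monoˡ-≤-nonNeg ½ (ℚ.≤-trans (approx x s) (bound₀-≤ (f x) s)))
    (toWitness {a? = (½ * (ℤ.+ 15 ℚ./ 8)) ℚ.≤? 1ℚ} _))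
  u≤1 = smoothed-≤1 (proj₁ rounds) t≤1
  ≥⅔ : ∀ v → signℚ (Sign.opposite v) * g x ℚ.≤ - (ℤ.+ 1 ℚ./ 8) →
    signℚ (Sign.opposite v) * amplify t ℚ.≤ - (ℤ.+ 2 ℚ./ 3)
  ≥⅔ v le = ℚ.≤-trans
    (ℚ.≤-reflexive (trans (negate v (amplify t)) (cong -_ (sym (smoothed-signℚ (proj₁ rounds) v t)))))
    (ℚ.neg-antimono-≤ (amplify-≥⅔
      (ℚ.≤-trans
        (ℚ.neg-antimono-≤ (ℚ.*-monoˡ-≤-nonNeg ½ le))
        (ℚ.≤-reflexive (trans (cong (λ u → - (½ * u)) (negate v (g x)))
          (solve 3 (λ v h g → :- (h :* (:- (v :* g))) := v :* (h :* g)) refl (signℚ v) ½ (g x)))))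
      (λ s → ℚ.≤-trans (ℚ.≤-reflexive (trans (sym (ℚ.*-assoc (signℚ s) (signℚ v) t))
        (cong (_* t) (sym (signℚ-* s v))))) (t≤1 (s Sign.* v)))))
    where
    negate : ∀ v p → signℚ (Sign.opposite v) * p ≡ - (signℚ v * p)
    negate Sign.- p = solve 1 (λ u → con 1ℚ :* u := :- (con (- 1ℚ) :* u)) refl p
    negate Sign.+ p = solve 1 (λ u → con (- 1ℚ) :* u := :- (con 1ℚ :* u)) refl p
  1≤4/3 : 1ℚ ℚ.≤ ℤ.+ 4 ℚ./ 3
  1≤4/3 = toWitness {a? = 1ℚ ℚ.≤? (ℤ.+ 4 ℚ./ 3)} _
  conclude : ∀ v → f x ≡ v → ∀ s → signℚ s * amplify t ℚ.≤ bound ⅓ v s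
  conclude nothing       eq s      = ℚ.≤-trans (u≤1 s) 1≤4/3
  conclude (just Sign.-) eq Sign.- = ℚ.≤-trans (u≤1 Sign.-) 1≤4/3
  conclude (just Sign.+) eq Sign.+ = ℚ.≤-trans (u≤1 Sign.+) 1≤4/3
  conclude (just Sign.-) eq Sign.+ = ≥⅔ Sign.-
    (subst (λ v → signℚ Sign.+ * g x ℚ.≤ bound ε₀ v Sign.+) eq (approx x Sign.+))
  conclude (just Sign.+) eq Sign.- = ≥⅔ Sign.+
    (subst (λ v → signℚ Sign.- * g x ℚ.≤ bound ε₀ v Sign.-) eq (approx x Sign.-))
-- Polynomials from functions of bounded degree

-- The real operations act termwise, so ring identities reduce to rational identities at each index.
≡⇒≈ᴿ : ∀ {x y} → (∀ i → seq x i ≡ seq y i) → x ≈ᴿ y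
≡⇒≈ᴿ {x} {y} eq = mk≈ᴿ λ ε ε>0 → 0 , λ i _ →
  subst (λ t → abs t ℚ.< ε) (sym (trans (cong (_- seq y i) (eq i)) (ℚ.+-inverseʳ (seq y i)))) ε>0

≤⇒≤ᴿ : ∀ {x y} → (∀ i → seq x i ℚ.≤ seq y i) → x ≤ᴿ y
≤⇒≤ᴿ {x} {y} le = mk≤ᴿ λ ε ε>0 → 0 , λ i _ → begin-strict
  seq x i        ≤⟨ le i ⟩
  seq y i        ≡⟨ ℚ.+-identityʳ (seq y i) ⟨
  seq y i + 0ℚ   <⟨ ℚ.+-monoʳ-< (seq y i) ε>0 ⟩
  seq y i + ε    ∎
  where open ℚ.≤-Reasoning

seq-signᴿ : ∀ s i → seq (signᴿ s) i ≡ signℚ s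
seq-signᴿ Sign.- i = refl
seq-signᴿ Sign.+ i = refl

monomialᴿ : ∀ {m} → Vec ℕ m → Vec Sign m → ℝ
monomialᴿ e x = productᴿ (λ i → signᴿ (lookup x i) ^ᴿ lookup e i)

monomialᴿ-0 : ∀ {m} (x : Vec Sign m) i → seq (monomialᴿ (replicate m 0) x) i ≡ 1ℚ
monomialᴿ-0 []      i = refl
monomialᴿ-0 (s ∷ x) i = trans (ℚ.*-identityˡ _) (monomialᴿ-0 x i)

monomialᴿ-suc : ∀ {m} (e : Vec ℕ m) v (x : Vec Sign m) i →
  seq (monomialᴿ (updateAt e v suc) x) i ≡ coordinate v x * seq (monomialᴿ e x) i
monomialᴿ-suc (k ∷ e) zero (s ∷ x) i = trans
  (cong (λ t → t * seq (signᴿ s ^ᴿ k) i * seq (monomialᴿ e x) i) (seq-signᴿ s i))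
  (ℚ.*-assoc (signℚ s) (seq (signᴿ s ^ᴿ k) i) (seq (monomialᴿ e x) i))
monomialᴿ-suc (k ∷ e) (suc v) (s ∷ x) i = trans
  (cong (seq (signᴿ s ^ᴿ k) i *_) (monomialᴿ-suc e v x i))
  (solve 3 (λ a b c → a :* (b :* c) := b :* (a :* c)) refl
    (seq (signᴿ s ^ᴿ k) i) (coordinate v x) (seq (monomialᴿ e x) i))

sum-replicate-0 : ∀ m → Vec.sum (replicate m 0) ≡ 0
sum-replicate-0 zero    = refl
sum-replicate-0 (suc m) = sum-replicate-0 m

sum-updateAt-suc : ∀ {m} (e : Vec ℕ m) v → Vec.sum (updateAt e v suc) ≡ suc (Vec.sum e)
sum-updateAt-suc (k ∷ e) zero    = refl
sum-updateAt-suc (k ∷ e) (suc v) =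
  trans (cong (k ℕ.+_) (sum-updateAt-suc e v)) (ℕ.+-suc k (Vec.sum e))

module _ {m : ℕ} where

  ExponentsAtMost : ℕ → Polynomial m → Set
  ExponentsAtMost k = All (λ (c , e) → Vec.sum e ≤ k)

  exponents⇒degree : ∀ {k p} → ExponentsAtMost k p → DegreeAtMost k p
  exponents⇒degree {k} ps e k< = ≡⇒≈ᴿ (vanishes ps)
    where
    vanishes : ∀ {p} → ExponentsAtMost k p → ∀ i → seq (coefficient p e) i ≡ 0ℚ
    vanishes []                 i = refl
    vanishes {(c , d) ∷ p} (d≤ ∷ ps) i with Vec-≡-dec ℕ._≟_ d e
    ... | yes refl = ⊥-elim (ℕ.<⇒≱ k< d≤)
    ... | no  _    = trans (ℚ.+-identityˡ (seq (coefficient p e) i)) (vanishes ps i)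

  evaluate-++ : ∀ p q x i →
    seq (evaluate {m} (p ++ q) x) i ≡ seq (evaluate p x) i + seq (evaluate q x) i
  evaluate-++ []            q x i = sym (ℚ.+-identityˡ (seq (evaluate q x) i))
  evaluate-++ ((c , e) ∷ p) q x i = trans
    (cong (seq c i * seq (monomialᴿ e x) i +_) (evaluate-++ p q x i))
    (sym (ℚ.+-assoc (seq c i * seq (monomialᴿ e x) i) (seq (evaluate p x) i) (seq (evaluate q x) i)))

  shift : Fin m → Polynomial m → Polynomial m
  shift v = map (λ (c , e) → c , updateAt e v suc)

  evaluate-shift : ∀ v p x i →
    seq (evaluate (shift v p) x) i ≡ coordinate v x * seq (evaluate p x) i
  evaluate-shift v []            x i = sym (ℚ.*-zeroʳ (coordinate v x))
  evaluate-shift v ((c , e) ∷ p) x i = trans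
    (cong₂ (λ a b → seq c i * a + b) (monomialᴿ-suc e v x i) (evaluate-shift v p x i))
    (solve 4 (λ c v a b → c :* (v :* a) :+ v :* b := v :* (c :* a :+ b)) refl
      (seq c i) (coordinate v x) (seq (monomialᴿ e x) i) (seq (evaluate p x) i))

  polynomial : ∀ {k g} → Degree≤ coordinate k g →
    ∃[ p ] ExponentsAtMost k p × ∀ x i → seq (evaluate p x) i ≡ g x
  polynomial (const {k} c) = (fromℚ c , replicate m 0) ∷ [] ,
    subst (_≤ k) (sym (sum-replicate-0 m)) z≤n ∷ [] ,
    λ x i → trans (ℚ.+-identityʳ (c * seq (monomialᴿ (replicate m 0) x) i))
      (trans (cong (c *_) (monomialᴿ-0 x i)) (ℚ.*-identityʳ c))
  polynomial (add p q) =
    let P , P≤ , P≡ = polynomial p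
        Q , Q≤ , Q≡ = polynomial q
    in P ++ Q , All.++⁺ P≤ Q≤ ,
       λ x i → trans (evaluate-++ P Q x i) (cong₂ _+_ (P≡ x i) (Q≡ x i))
  polynomial (mult {k} v p) =
    let P , P≤ , P≡ = polynomial p
    in shift v P ,
       All.map⁺ (All.map (λ {(c , e)} le → subst (_≤ suc k) (sym (sum-updateAt-suc e v)) (s≤s le)) P≤) ,
       λ x i → trans (evaluate-shift v P x i) (cong (coordinate v x *_) (P≡ x i))
  polynomial (ext eq p) =
    let P , P≤ , P≡ = polynomial p
    in P , P≤ , λ x i → trans (P≡ x i) (eq x)

  approximation⇒degree≤ : ∀ {f : PartialBoolean (Vec Sign m)} {d k g} → IsApproxDegree ⅓ᴿ f d →
    Degree≤ coordinate k g → Approximatesℚ ⅓ (value f) g → d ≤ k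
  approximation⇒degree≤ {f} {d} {k} {g} (_ , least) p approx =
    let P , P≤ , P≡ = polynomial p in
    least k (P , exponents⇒degree P≤ ,
      (λ x v eq → ≤⇒≤ᴿ λ i → subst (λ t → abs t ℚ.≤ ⅓)
        (sym (cong₂ _-_ (seq-signᴿ v i) (P≡ x i))) (inside x v eq)) ,
      (λ x eq → ≤⇒≤ᴿ λ i → subst (λ t → abs t ℚ.≤ 1ℚ + ⅓) (sym (P≡ x i)) (outside x eq)))
    where
    at : ∀ x s {v} → value f x ≡ v → signℚ s * g x ℚ.≤ bound ⅓ v s
    at x s eq = subst (λ v → signℚ s * g x ℚ.≤ bound ⅓ v s) eq (approx x s)
    inside : ∀ x v → value f x ≡ just v → abs (signℚ v - g x) ℚ.≤ ⅓
    inside x v eq = ∣p∣≤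
      (subst₂ ℚ._≤_
        (solve 2 (λ v g → v :+ con (- 1ℚ) :* g := v :- g) refl (signℚ v) (g x))
        (solve 2 (λ v e → v :+ (con (- 1ℚ) :* v :+ e) := e) refl (signℚ v) ⅓)
        (ℚ.+-monoʳ-≤ (signℚ v) (at x Sign.- eq)))
      (subst₂ ℚ._≤_
        (solve 2 (λ v g → (:- v) :+ con 1ℚ :* g := :- (v :- g)) refl (signℚ v) (g x))
        (solve 2 (λ v e → (:- v) :+ (con 1ℚ :* v :+ e) := e) refl (signℚ v) ⅓)
        (ℚ.+-monoʳ-≤ (- signℚ v) (at x Sign.+ eq)))
    outside : ∀ x → value f x ≡ nothing → abs (g x) ℚ.≤ 1ℚ + ⅓
    outside x eq = ∣p∣≤
      (subst (ℚ._≤ 1ℚ + ⅓) (ℚ.*-identityˡ (g x)) (at x Sign.+ eq))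
      (subst (ℚ._≤ 1ℚ + ⅓) (solve 1 (λ g → con (- 1ℚ) :* g := :- g) refl (g x)) (at x Sign.- eq))

-- Dual polynomials from approximate degree

K : ℕ
K = 3 ℕ.^ proj₁ rounds

K≢0 : ℕ.NonZero K
K≢0 = ℕ.m^n≢0 3 (proj₁ rounds)

-- Let k be the integer part of (d - 1) / K. An approximant of degree k at error 7/8 would be
-- amplified to one of degree K k, at most d - 1, at error 1/3, against the minimality of d. So
-- duality gives orthogonality below k + 1, and d is at most K (k + 1). For d = 0 a point mass in
-- the domain serves.
approxDegree⇒dual : ∀ {m} (f : PartialBoolean (Vec Sign m)) {d} → IsApproxDegree ⅓ᴿ f d →
  ∃[ k ] d ≤ K ℕ.* k × DualPolynomial (value f) k
approxDegree⇒dual f {zero} isDegree = 0 , z≤n , record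
  { good       = (signℚ v , x) ∷ []
  ; bad        = []
  ; orthogonal = λ _ ()
  ; aligned    = (v , eq , 0≤v² v) ∷ []
  ; mass-good  = ∣v∣≡1 v
  ; mass-bad   = 0≤? (ℤ.+ 1 ℚ./ 15)
  }
  where
  x  = proj₁ (nonempty f)
  v  = proj₁ (proj₂ (nonempty f))
  eq = proj₂ (proj₂ (nonempty f))
  0≤v² : ∀ v → 0ℚ ℚ.≤ signℚ v * signℚ v
  0≤v² Sign.- = 0≤? 1ℚ
  0≤v² Sign.+ = 0≤? 1ℚ
  ∣v∣≡1 : ∀ v → abs (signℚ v) + 0ℚ ≡ 1ℚ
  ∣v∣≡1 Sign.- = refl
  ∣v∣≡1 Sign.+ = refl
approxDegree⇒dual f {suc e} isDegree with approximation⊎dual (value f) k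
  where k = (e / K) {{K≢0}}
... | inj₂ dual = suc k , e<K*suc-k , dual
  where
  k = (e / K) {{K≢0}}
  e<K*suc-k : e ℕ.< K ℕ.* suc k
  e<K*suc-k = begin-strict
    e                              ≡⟨ m≡m%n+[m/n]*n e K {{K≢0}} ⟩
    (e % K) {{K≢0}} ℕ.+ k ℕ.* K    <⟨ ℕ.+-monoˡ-< (k ℕ.* K) (m%n<n e K {{K≢0}}) ⟩
    K ℕ.+ k ℕ.* K                  ≡⟨ ℕ.*-comm (suc k) K ⟩
    K ℕ.* suc k                    ∎
    where open ℕ.≤-Reasoning
... | inj₁ (g , p , approx) = ⊥-elim (ℕ.<⇒≱ (s≤s (begin
    K ℕ.* k   ≡⟨ ℕ.*-comm K k ⟩
    k ℕ.* K   ≤⟨ m/n*n≤m e K {{K≢0}} ⟩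
    e         ∎))
    (approximation⇒degree≤ {f = f} isDegree
      (smoothed-degree (proj₁ rounds) (degree-scale ½ p)) (reduceError {f = value f} approx)))
  where
  open ℕ.≤-Reasoning
  k = (e / K) {{K≢0}}

-- Complex numbers

≈ᴿ-refl : ∀ {x} → x ≈ᴿ x
≈ᴿ-refl = ≡⇒≈ᴿ λ _ → refl

≈ᴿ-sym : ∀ {x y} → x ≈ᴿ y → y ≈ᴿ x
≈ᴿ-sym {x} {y} (mk≈ᴿ e) = mk≈ᴿ λ ε ε>0 → let N , h = e ε ε>0 in
  N , λ i N≤i → subst (ℚ._< ε) (∣p-q∣≡∣q-p∣ (seq x i) (seq y i)) (h i N≤i)

≈ᴿ-trans : ∀ {x y z} → x ≈ᴿ y → y ≈ᴿ z → x ≈ᴿ z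
≈ᴿ-trans {x} {y} {z} (mk≈ᴿ e) (mk≈ᴿ e′) = mk≈ᴿ λ ε ε>0 →
  let M , h  = e  (½ * ε) (half-pos ε>0)
      N , h′ = e′ (½ * ε) (half-pos ε>0)
  in M ℕ.⊔ N , λ i le → begin-strict
    abs (seq x i - seq z i)
      ≡⟨ cong abs (solve 3 (λ x y z → x :- z := (x :- y) :+ (y :- z)) refl (seq x i) (seq y i) (seq z i)) ⟩
    abs ((seq x i - seq y i) + (seq y i - seq z i))
      ≤⟨ ℚ.∣p+q∣≤∣p∣+∣q∣ (seq x i - seq y i) (seq y i - seq z i) ⟩
    abs (seq x i - seq y i) + abs (seq y i - seq z i)
      <⟨ ℚ.+-mono-< (h i (ℕ.m⊔n≤o⇒m≤o M N le)) (h′ i (ℕ.m⊔n≤o⇒n≤o M N le)) ⟩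
    ½ * ε + ½ * ε
      ≡⟨ halves ε ⟩
    ε ∎
  where open ℚ.≤-Reasoning

+ᴿ-cong : ∀ {x x′ y y′} → x ≈ᴿ x′ → y ≈ᴿ y′ → x +ᴿ y ≈ᴿ x′ +ᴿ y′
+ᴿ-cong {x} {x′} {y} {y′} (mk≈ᴿ e) (mk≈ᴿ e′) = mk≈ᴿ λ ε ε>0 →
  let M , h  = e  (½ * ε) (half-pos ε>0)
      N , h′ = e′ (½ * ε) (half-pos ε>0)
  in M ℕ.⊔ N , λ i le → begin-strict
    abs ((seq x i + seq y i) - (seq x′ i + seq y′ i))
      ≡⟨ cong abs (solve 4 (λ x y x′ y′ → (x :+ y) :- (x′ :+ y′) := (x :- x′) :+ (y :- y′)) refl
           (seq x i) (seq y i) (seq x′ i) (seq y′ i)) ⟩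
    abs ((seq x i - seq x′ i) + (seq y i - seq y′ i))
      ≤⟨ ℚ.∣p+q∣≤∣p∣+∣q∣ (seq x i - seq x′ i) (seq y i - seq y′ i) ⟩
    abs (seq x i - seq x′ i) + abs (seq y i - seq y′ i)
      <⟨ ℚ.+-mono-< (h i (ℕ.m⊔n≤o⇒m≤o M N le)) (h′ i (ℕ.m⊔n≤o⇒n≤o M N le)) ⟩
    ½ * ε + ½ * ε
      ≡⟨ halves ε ⟩
    ε ∎
  where open ℚ.≤-Reasoning

-ᴿ-cong : ∀ {x x′} → x ≈ᴿ x′ → -ᴿ x ≈ᴿ -ᴿ x′
-ᴿ-cong {x} {x′} (mk≈ᴿ e) = mk≈ᴿ λ ε ε>0 → let N , h = e ε ε>0 in
  N , λ i N≤i → subst (ℚ._< ε)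
    (trans (sym (ℚ.∣-p∣≡∣p∣ (seq x i - seq x′ i)))
      (cong abs (solve 2 (λ x y → :- (x :- y) := (:- x) :- (:- y)) refl (seq x i) (seq x′ i))))
    (h i N≤i)

*ᴿ-cong : ∀ {x x′ y y′} → x ≈ᴿ x′ → y ≈ᴿ y′ → x *ᴿ y ≈ᴿ x′ *ᴿ y′
*ᴿ-cong {x} {x′} {y} {y′} (mk≈ᴿ e) (mk≈ᴿ e′) = mk≈ᴿ λ ε ε>0 →
  let A , A>0 , P , x≤A  = eventually-bounded (seq x) (cauchy x)
      B , B>0 , Q , y′≤B = eventually-bounded (seq y′) (cauchy y′)
      δ , δ>0 , Dδ≡ε     = divide (A + B) ε (ℚ.+-mono-< A>0 B>0) ε>0
      M , h              = e δ δ>0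
      N , h′             = e′ δ δ>0
  in (P ℕ.⊔ Q) ℕ.⊔ (M ℕ.⊔ N) , λ i le →
    let PQ = ℕ.m⊔n≤o⇒m≤o (P ℕ.⊔ Q) (M ℕ.⊔ N) le
        MN = ℕ.m⊔n≤o⇒n≤o (P ℕ.⊔ Q) (M ℕ.⊔ N) le
    in ℚ.≤-<-trans (∣ab-cd∣≤ (seq x i) (seq y i) (seq x′ i) (seq y′ i))
         (subst (abs (seq x i * (seq y i - seq y′ i)) + abs (seq y′ i * (seq x i - seq x′ i)) ℚ.<_)
           (trans (sym (ℚ.*-distribʳ-+ δ A B)) Dδ≡ε)
           (ℚ.+-mono-<
             (∣p*q∣<C*δ (seq x i) (seq y i - seq y′ i) A δ A>0
               (x≤A i (ℕ.m⊔n≤o⇒m≤o P Q PQ)) (h′ i (ℕ.m⊔n≤o⇒n≤o M N MN)))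
             (∣p*q∣<C*δ (seq y′ i) (seq x i - seq x′ i) B δ B>0
               (y′≤B i (ℕ.m⊔n≤o⇒n≤o P Q PQ)) (h i (ℕ.m⊔n≤o⇒m≤o M N MN)))))

open Algebra.Structures.Biased _≈ᶜ_ using (isCommutativeMonoidˡ; isCommutativeSemiringˡ)

≡⇒≈ᶜ : ∀ {z w} → (∀ i → seq (re z) i ≡ seq (re w) i) → (∀ i → seq (im z) i ≡ seq (im w) i) → z ≈ᶜ w
≡⇒≈ᶜ eq eq′ = ≡⇒≈ᴿ eq , ≡⇒≈ᴿ eq′

≈ᶜ-isEquivalence : IsEquivalence _≈ᶜ_
≈ᶜ-isEquivalence = record
  { refl  = ≈ᴿ-refl , ≈ᴿ-refl
  ; sym   = λ (p , q) → ≈ᴿ-sym p , ≈ᴿ-sym q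
  ; trans = λ (p , q) (p′ , q′) → ≈ᴿ-trans p p′ , ≈ᴿ-trans q q′
  }

*ᶜ-cong : ∀ {z z′ w w′} → z ≈ᶜ z′ → w ≈ᶜ w′ → z *ᶜ w ≈ᶜ z′ *ᶜ w′
*ᶜ-cong (p , q) (p′ , q′) =
  +ᴿ-cong (*ᴿ-cong p p′) (-ᴿ-cong (*ᴿ-cong q q′)) , +ᴿ-cong (*ᴿ-cong p q′) (*ᴿ-cong q p′)

*ᶜ-comm : ∀ z w → z *ᶜ w ≈ᶜ w *ᶜ z
*ᶜ-comm (a +i b) (c +i d) = ≡⇒≈ᶜ
  (λ i → solve 4 (λ a b c d → a :* c :- b :* d := c :* a :- d :* b) refl (seq a i) (seq b i) (seq c i) (seq d i))
  (λ i → solve 4 (λ a b c d → a :* d :+ b :* c := c :* b :+ d :* a) refl (seq a i) (seq b i) (seq c i) (seq d i))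

*ᶜ-assoc : ∀ z w u → (z *ᶜ w) *ᶜ u ≈ᶜ z *ᶜ (w *ᶜ u)
*ᶜ-assoc (a +i b) (c +i d) (e +i f) = ≡⇒≈ᶜ
  (λ i → solve 6 (λ a b c d e f →
    (a :* c :- b :* d) :* e :- (a :* d :+ b :* c) :* f :=
    a :* (c :* e :- d :* f) :- b :* (c :* f :+ d :* e)) refl
    (seq a i) (seq b i) (seq c i) (seq d i) (seq e i) (seq f i))
  (λ i → solve 6 (λ a b c d e f →
    (a :* c :- b :* d) :* f :+ (a :* d :+ b :* c) :* e :=
    a :* (c :* f :+ d :* e) :+ b :* (c :* e :- d :* f)) refl
    (seq a i) (seq b i) (seq c i) (seq d i) (seq e i) (seq f i))

*ᶜ-identityˡ : ∀ z → 1ᶜ *ᶜ z ≈ᶜ z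
*ᶜ-identityˡ (a +i b) = ≡⇒≈ᶜ
  (λ i → solve 2 (λ a b → con 1ℚ :* a :- con 0ℚ :* b := a) refl (seq a i) (seq b i))
  (λ i → solve 2 (λ a b → con 1ℚ :* b :+ con 0ℚ :* a := b) refl (seq a i) (seq b i))

*ᶜ-zeroˡ : ∀ z → 0ᶜ *ᶜ z ≈ᶜ 0ᶜ
*ᶜ-zeroˡ (a +i b) = ≡⇒≈ᶜ
  (λ i → solve 2 (λ a b → con 0ℚ :* a :- con 0ℚ :* b := con 0ℚ) refl (seq a i) (seq b i))
  (λ i → solve 2 (λ a b → con 0ℚ :* b :+ con 0ℚ :* a := con 0ℚ) refl (seq a i) (seq b i))

*ᶜ-distribʳ-+ᶜ : ∀ u z w → (z +ᶜ w) *ᶜ u ≈ᶜ z *ᶜ u +ᶜ w *ᶜ u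
*ᶜ-distribʳ-+ᶜ (e +i f) (a +i b) (c +i d) = ≡⇒≈ᶜ
  (λ i → solve 6 (λ a b c d e f →
    (a :+ c) :* e :- (b :+ d) :* f := (a :* e :- b :* f) :+ (c :* e :- d :* f)) refl
    (seq a i) (seq b i) (seq c i) (seq d i) (seq e i) (seq f i))
  (λ i → solve 6 (λ a b c d e f →
    (a :+ c) :* f :+ (b :+ d) :* e := (a :* f :+ b :* e) :+ (c :* f :+ d :* e)) refl
    (seq a i) (seq b i) (seq c i) (seq d i) (seq e i) (seq f i))

ℂ-commutativeSemiring : CommutativeSemiring 0ℓ 0ℓ
ℂ-commutativeSemiring = record
  { _≈_ = _≈ᶜ_ ; _+_ = _+ᶜ_ ; _*_ = _*ᶜ_ ; 0# = 0ᶜ ; 1# = 1ᶜ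
  ; isCommutativeSemiring = isCommutativeSemiringˡ record
    { +-isCommutativeMonoid = isCommutativeMonoidˡ record
      { isSemigroup = record
        { isMagma = record
          { isEquivalence = ≈ᶜ-isEquivalence
          ; ∙-cong = λ (p , q) (p′ , q′) → +ᴿ-cong p p′ , +ᴿ-cong q q′ }
        ; assoc = λ z w u → ≡⇒≈ᶜ
            (λ i → ℚ.+-assoc (seq (re z) i) (seq (re w) i) (seq (re u) i))
            (λ i → ℚ.+-assoc (seq (im z) i) (seq (im w) i) (seq (im u) i)) }
      ; identityˡ = λ z → ≡⇒≈ᶜ (λ i → ℚ.+-identityˡ (seq (re z) i)) (λ i → ℚ.+-identityˡ (seq (im z) i))
      ; comm = λ z w → ≡⇒≈ᶜ
          (λ i → ℚ.+-comm (seq (re z) i) (seq (re w) i)) (λ i → ℚ.+-comm (seq (im z) i) (seq (im w) i)) }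
    ; *-isCommutativeMonoid = isCommutativeMonoidˡ record
      { isSemigroup = record
        { isMagma = record { isEquivalence = ≈ᶜ-isEquivalence ; ∙-cong = *ᶜ-cong }
        ; assoc = *ᶜ-assoc }
      ; identityˡ = *ᶜ-identityˡ
      ; comm = *ᶜ-comm }
    ; distribʳ = *ᶜ-distribʳ-+ᶜ
    ; zeroˡ = *ᶜ-zeroˡ } }

conj-+ : ∀ z w → conj (z +ᶜ w) ≈ᶜ conj z +ᶜ conj w
conj-+ z w = ≡⇒≈ᶜ (λ _ → refl) (λ i → ℚ.neg-distrib-+ (seq (im z) i) (seq (im w) i))

conj-* : ∀ z w → conj (z *ᶜ w) ≈ᶜ conj z *ᶜ conj w
conj-* (a +i b) (c +i d) = ≡⇒≈ᶜ
  (λ i → solve 4 (λ a b c d → a :* c :- b :* d := a :* c :- (:- b) :* (:- d)) refl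
    (seq a i) (seq b i) (seq c i) (seq d i))
  (λ i → solve 4 (λ a b c d → :- (a :* d :+ b :* c) := a :* (:- d) :+ (:- b) :* c) refl
    (seq a i) (seq b i) (seq c i) (seq d i))

-- Norms of quantum states

-- Conservation of the norm is pure algebra with finite sums and a conjugation that respects them,
-- so it is carried out over an abstract commutative semiring and then applied to ℂ.
module Isometry {c ℓ} (R : CommutativeSemiring c ℓ) where

  open CommutativeSemiring R hiding (zero)
    renaming (_+_ to _∔_; _*_ to _⋆_; *-assoc to ⋆-assoc; *-comm to ⋆-comm;
              refl to ≈-refl; sym to ≈-sym; trans to ≈-trans)

  module Conjugation
    (conj : Carrier → Carrier)
    (conj-+ : ∀ z w → conj (z ∔ w) ≈ conj z ∔ conj w)
    (conj-* : ∀ z w → conj (z ⋆ w) ≈ conj z ⋆ conj w)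
    (conj-0 : conj 0# ≈ 0#)
    {N W : ℕ} where

    module Σ = Algebra.Properties.Semiring.Sum semiring
    module ≈-Reasoning = Relation.Binary.Reasoning.Setoid setoid

    private
      B : Set
      B = Basis N W

    State Matrix : Set c
    State  = B → Carrier
    Matrix = B → B → Carrier

    sumᵇ : (B → Carrier) → Carrier
    sumᵇ g = Σ.sum λ i → Σ.sum λ w → g (i , false , w) ∔ g (i , true , w)

    δ : Matrix
    δ r s = if does (×-≡-dec _≟ᶠ_ (×-≡-dec _≟ᵇ_ _≟ᶠ_) r s) then 1# else 0#

    act : Matrix → State → State
    act A ψ r = sumᵇ (λ s → A r s ⋆ ψ s)

    _†_ : Matrix → Matrix → Matrix
    (A † A′) r t = sumᵇ (λ s → conj (A s r) ⋆ A′ s t)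

    conj-sum : ∀ {n} (g : Fin n → Carrier) → conj (Σ.sum g) ≈ Σ.sum (λ i → conj (g i))
    conj-sum {zero}  g = conj-0
    conj-sum {suc n} g = ≈-trans (conj-+ (g zero) (Σ.sum (g ∘ suc))) (+-congˡ (conj-sum (g ∘ suc)))

    sum-zero : ∀ {n} {g : Fin n → Carrier} → (∀ i → g i ≈ 0#) → Σ.sum g ≈ 0#
    sum-zero {zero}  zeros = ≈-refl
    sum-zero {suc n} zeros = ≈-trans (+-cong (zeros zero) (sum-zero (zeros ∘ suc))) (+-identityˡ 0#)

    sum-single : ∀ {n} (g : Fin n → Carrier) k → (∀ j → ¬ j ≡ k → g j ≈ 0#) → Σ.sum g ≈ g k
    sum-single {suc n} g zero zeros = ≈-trans
      (+-congˡ (sum-zero (λ j → zeros (suc j) (λ ()))))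
      (+-identityʳ (g zero))
    sum-single {suc n} g (suc k) zeros = ≈-trans
      (+-cong (zeros zero (λ ())) (sum-single (g ∘ suc) k (λ j j≢k → zeros (suc j) (λ { refl → j≢k refl }))))
      (+-identityˡ (g (suc k)))

    sum-basis-cong : ∀ {g h : B → Carrier} → (∀ r → g r ≈ h r) → sumᵇ g ≈ sumᵇ h
    sum-basis-cong eq = Σ.sum-cong-≋ λ i → Σ.sum-cong-≋ λ w →
      +-cong (eq (i , false , w)) (eq (i , true , w))

    sum-basis-+ : ∀ (g h : B → Carrier) → sumᵇ (λ r → g r ∔ h r) ≈ sumᵇ g ∔ sumᵇ h
    sum-basis-+ g h = ≈-trans
      (Σ.sum-cong-≋ λ i → ≈-trans
        (Σ.sum-cong-≋ λ w → interchange (g (i , false , w)) (h (i , false , w)) (g (i , true , w)) (h (i , true , w)))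
        (Σ.∑-distrib-+ (λ w → g (i , false , w) ∔ g (i , true , w)) (λ w → h (i , false , w) ∔ h (i , true , w))))
      (Σ.∑-distrib-+ (λ i → Σ.sum λ w → g (i , false , w) ∔ g (i , true , w))
                     (λ i → Σ.sum λ w → h (i , false , w) ∔ h (i , true , w)))
      where
      interchange : ∀ a b c d → (a ∔ b) ∔ (c ∔ d) ≈ (a ∔ c) ∔ (b ∔ d)
      interchange = Algebra.Properties.CommutativeSemigroup.interchange +-commutativeSemigroup

    sum-basis-*ˡ : ∀ z (g : B → Carrier) → z ⋆ sumᵇ g ≈ sumᵇ (λ r → z ⋆ g r)
    sum-basis-*ˡ z g = ≈-trans
      (Σ.*-distribˡ-sum z (λ i → Σ.sum λ w → g (i , false , w) ∔ g (i , true , w)))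
      (Σ.sum-cong-≋ λ i → ≈-trans
        (Σ.*-distribˡ-sum z (λ w → g (i , false , w) ∔ g (i , true , w)))
        (Σ.sum-cong-≋ λ w → distribˡ z (g (i , false , w)) (g (i , true , w))))

    sum-basis-*ʳ : ∀ z (g : B → Carrier) → sumᵇ g ⋆ z ≈ sumᵇ (λ r → g r ⋆ z)
    sum-basis-*ʳ z g = ≈-trans (⋆-comm (sumᵇ g) z)
      (≈-trans (sum-basis-*ˡ z g) (sum-basis-cong λ r → ⋆-comm z (g r)))

    sum-basis-sum : ∀ {n} (g : B → Fin n → Carrier) →
      sumᵇ (λ r → Σ.sum (g r)) ≈ Σ.sum (λ k → sumᵇ (λ r → g r k))
    sum-basis-sum {zero}  g = sum-zero {N} λ i → sum-zero {W} λ w → +-identityˡ 0#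
    sum-basis-sum {suc n} g = ≈-trans
      (sum-basis-+ (λ r → g r zero) (λ r → Σ.sum (λ k → g r (suc k))))
      (+-congˡ (sum-basis-sum (λ r k → g r (suc k))))

    sum-basis-swap : ∀ (g : B → B → Carrier) →
      sumᵇ (λ r → sumᵇ (λ s → g r s)) ≈ sumᵇ (λ s → sumᵇ (λ r → g r s))
    sum-basis-swap g = ≈-trans
      (sum-basis-sum (λ r i → Σ.sum λ w → g r (i , false , w) ∔ g r (i , true , w)))
      (Σ.sum-cong-≋ λ i → ≈-trans
        (sum-basis-sum (λ r w → g r (i , false , w) ∔ g r (i , true , w)))
        (Σ.sum-cong-≋ λ w → sum-basis-+ (λ r → g r (i , false , w)) (λ r → g r (i , true , w))))

    conj-sum-basis : ∀ (g : B → Carrier) → conj (sumᵇ g) ≈ sumᵇ (λ r → conj (g r))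
    conj-sum-basis g = ≈-trans
      (conj-sum (λ i → Σ.sum λ w → g (i , false , w) ∔ g (i , true , w)))
      (Σ.sum-cong-≋ λ i → ≈-trans
        (conj-sum (λ w → g (i , false , w) ∔ g (i , true , w)))
        (Σ.sum-cong-≋ λ w → conj-+ (g (i , false , w)) (g (i , true , w))))

    sum-basis-single : ∀ (g : B → Carrier) s → (∀ r → ¬ r ≡ s → g r ≈ 0#) → sumᵇ g ≈ g s
    sum-basis-single g (i , b , w) zeros = ≈-trans
      (sum-single (λ i → Σ.sum λ w → g (i , false , w) ∔ g (i , true , w)) i
        λ j j≢i → sum-zero λ w′ → ≈-trans
          (+-cong (zeros (j , false , w′) λ { refl → j≢i refl }) (zeros (j , true , w′) λ { refl → j≢i refl }))
          (+-identityˡ 0#))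
      (≈-trans
        (sum-single (λ w → g (i , false , w) ∔ g (i , true , w)) w
          λ v v≢w → ≈-trans
            (+-cong (zeros (i , false , v) λ { refl → v≢w refl }) (zeros (i , true , v) λ { refl → v≢w refl }))
            (+-identityˡ 0#))
        (pick b zeros))
      where
      pick : ∀ b → (∀ r → ¬ r ≡ (i , b , w) → g r ≈ 0#) →
        g (i , false , w) ∔ g (i , true , w) ≈ g (i , b , w)
      pick false zeros = ≈-trans (+-congˡ (zeros (i , true , w) λ ())) (+-identityʳ (g (i , false , w)))
      pick true  zeros = ≈-trans (+-congʳ (zeros (i , false , w) λ ())) (+-identityˡ (g (i , true , w)))

    δ-* : ∀ s (g : B → Carrier) → sumᵇ (λ t → δ s t ⋆ g t) ≈ g s
    δ-* s g = ≈-trans (sum-basis-single (λ t → δ s t ⋆ g t) s off) diagonal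
      where
      off : ∀ r → ¬ r ≡ s → δ s r ⋆ g r ≈ 0#
      off r r≢s with ×-≡-dec _≟ᶠ_ (×-≡-dec _≟ᵇ_ _≟ᶠ_) s r
      ... | yes s≡r = ⊥-elim (r≢s (sym s≡r))
      ... | no  _   = zeroˡ (g r)
      diagonal : δ s s ⋆ g s ≈ g s
      diagonal with ×-≡-dec _≟ᶠ_ (×-≡-dec _≟ᵇ_ _≟ᶠ_) s s
      ... | yes _   = *-identityˡ (g s)
      ... | no  s≢s = ⊥-elim (s≢s refl)

    norm² : State → Carrier
    norm² ψ = sumᵇ (λ r → conj (ψ r) ⋆ ψ r)

    quadratic : Matrix → State → Carrier
    quadratic A ψ = sumᵇ (λ s → conj (ψ s) ⋆ sumᵇ (λ t → A s t ⋆ ψ t))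

    quadratic-cong : ∀ {A A′ : Matrix} → (∀ s t → A s t ≈ A′ s t) → ∀ ψ → quadratic A ψ ≈ quadratic A′ ψ
    quadratic-cong A≈A′ ψ = sum-basis-cong λ s → *-congˡ {conj (ψ s)} (sum-basis-cong λ t → *-congʳ {ψ t} (A≈A′ s t))

    quadratic-+ : ∀ A A′ ψ → quadratic (λ s t → A s t ∔ A′ s t) ψ ≈ quadratic A ψ ∔ quadratic A′ ψ
    quadratic-+ A A′ ψ = ≈-trans
      (sum-basis-cong λ s → ≈-trans
        (*-congˡ {conj (ψ s)} (≈-trans (sum-basis-cong λ t → distribʳ (ψ t) (A s t) (A′ s t))
          (sum-basis-+ (λ t → A s t ⋆ ψ t) (λ t → A′ s t ⋆ ψ t))))
        (distribˡ (conj (ψ s)) (sumᵇ λ t → A s t ⋆ ψ t) (sumᵇ λ t → A′ s t ⋆ ψ t)))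
      (sum-basis-+ (λ s → conj (ψ s) ⋆ sumᵇ λ t → A s t ⋆ ψ t) (λ s → conj (ψ s) ⋆ sumᵇ λ t → A′ s t ⋆ ψ t))

    quadratic-δ : ∀ ψ → quadratic δ ψ ≈ norm² ψ
    quadratic-δ ψ = sum-basis-cong λ s → *-congˡ {conj (ψ s)} (δ-* s ψ)

    -- Exchanging the basis sums moves one copy of A across the inner product. Unitarity and
    -- completeness of a measurement are both statements about `A † A`, so both conservation laws
    -- follow.
    norm²-act : ∀ A ψ → norm² (act A ψ) ≈ quadratic (A † A) ψ
    norm²-act A ψ = begin
      sumᵇ (λ r → conj (act A ψ r) ⋆ act A ψ r)
        ≈⟨ sum-basis-cong (λ r → *-congʳ {act A ψ r} (≈-trans (conj-sum-basis (λ s → A r s ⋆ ψ s))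
             (sum-basis-cong λ s → conj-* (A r s) (ψ s)))) ⟩
      sumᵇ (λ r → sumᵇ (λ s → conj (A r s) ⋆ conj (ψ s)) ⋆ act A ψ r)
        ≈⟨ sum-basis-cong (λ r → sum-basis-*ʳ (act A ψ r) (λ s → conj (A r s) ⋆ conj (ψ s))) ⟩
      sumᵇ (λ r → sumᵇ (λ s → conj (A r s) ⋆ conj (ψ s) ⋆ act A ψ r))
        ≈⟨ sum-basis-swap (λ r s → conj (A r s) ⋆ conj (ψ s) ⋆ act A ψ r) ⟩
      sumᵇ (λ s → sumᵇ (λ r → conj (A r s) ⋆ conj (ψ s) ⋆ act A ψ r))
        ≈⟨ sum-basis-cong (λ s → ≈-trans
             (sum-basis-cong λ r → ≈-trans (*-congʳ {act A ψ r} (⋆-comm (conj (A r s)) (conj (ψ s))))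
               (⋆-assoc (conj (ψ s)) (conj (A r s)) (act A ψ r)))
             (≈-sym (sum-basis-*ˡ (conj (ψ s)) (λ r → conj (A r s) ⋆ act A ψ r)))) ⟩
      sumᵇ (λ s → conj (ψ s) ⋆ sumᵇ (λ r → conj (A r s) ⋆ act A ψ r))
        ≈⟨ sum-basis-cong (λ s → *-congˡ {conj (ψ s)} (inner s)) ⟩
      quadratic (A † A) ψ ∎
      where
      open ≈-Reasoning
      inner : ∀ s → sumᵇ (λ r → conj (A r s) ⋆ act A ψ r) ≈
                    sumᵇ (λ t → (A † A) s t ⋆ ψ t)
      inner s = begin
        sumᵇ (λ r → conj (A r s) ⋆ act A ψ r)
          ≈⟨ sum-basis-cong (λ r → sum-basis-*ˡ (conj (A r s)) (λ t → A r t ⋆ ψ t)) ⟩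
        sumᵇ (λ r → sumᵇ (λ t → conj (A r s) ⋆ (A r t ⋆ ψ t)))
          ≈⟨ sum-basis-swap (λ r t → conj (A r s) ⋆ (A r t ⋆ ψ t)) ⟩
        sumᵇ (λ t → sumᵇ (λ r → conj (A r s) ⋆ (A r t ⋆ ψ t)))
          ≈⟨ sum-basis-cong (λ t → ≈-trans
               (sum-basis-cong λ r → ≈-sym (⋆-assoc (conj (A r s)) (A r t) (ψ t)))
               (≈-sym (sum-basis-*ʳ (ψ t) (λ r → conj (A r s) ⋆ A r t)))) ⟩
        sumᵇ (λ t → (A † A) s t ⋆ ψ t) ∎

    norm²-isometry : ∀ {A} → (∀ s t → (A † A) s t ≈ δ s t) → ∀ ψ → norm² (act A ψ) ≈ norm² ψ
    norm²-isometry {A} isometry ψ = ≈-trans (norm²-act A ψ)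
      (≈-trans (quadratic-cong isometry ψ) (quadratic-δ ψ))

    norm²-measurement : ∀ A A′ → (∀ s t → (A † A) s t ∔ (A′ † A′) s t ≈ δ s t) → ∀ ψ →
      norm² (act A ψ) ∔ norm² (act A′ ψ) ≈ norm² ψ
    norm²-measurement A A′ complete ψ = begin
      norm² (act A ψ) ∔ norm² (act A′ ψ)                        ≈⟨ +-cong (norm²-act A ψ) (norm²-act A′ ψ) ⟩
      quadratic (A † A) ψ ∔ quadratic (A′ † A′) ψ               ≈⟨ quadratic-+ (A † A) (A′ † A′) ψ ⟨
      quadratic (λ s t → (A † A) s t ∔ (A′ † A′) s t) ψ         ≈⟨ quadratic-cong complete ψ ⟩
      quadratic δ ψ                                             ≈⟨ quadratic-δ ψ ⟩
      norm² ψ                                                   ∎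
      where open ≈-Reasoning

    -- For fixed `i` and `w`, a query either keeps or exchanges the two values of the answer bit.
    norm²-swap : ∀ (c : Fin N → Bool) ψ → norm² (λ (i , b , w) → ψ (i , b xor c i , w)) ≈ norm² ψ
    norm²-swap c ψ = Σ.sum-cong-≋ λ i → Σ.sum-cong-≋ λ w →
      flip (c i) (λ b → conj (ψ (i , b , w)) ⋆ ψ (i , b , w))
      where
      flip : ∀ c (g : Bool → Carrier) → g (false xor c) ∔ g (true xor c) ≈ g false ∔ g true
      flip false g = ≈-refl
      flip true  g = +-comm (g true) (g false)

-- Query algorithms at a fixed precision

conj-0 : conj 0ᶜ ≈ᶜ 0ᶜ
conj-0 = ≡⇒≈ᶜ (λ _ → refl) (λ _ → refl)

seq-sumᴿ-cong : ∀ {n} (g h : Fin n → ℝ) j → (∀ i → seq (g i) j ≡ seq (h i) j) → seq (sumᴿ g) j ≡ seq (sumᴿ h) j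
seq-sumᴿ-cong {zero}  g h j eq = refl
seq-sumᴿ-cong {suc n} g h j eq = cong₂ _+_ (eq zero) (seq-sumᴿ-cong (g ∘ suc) (h ∘ suc) j (eq ∘ suc))

re-sumᶜ : ∀ {n} (g : Fin n → ℂ) j → seq (re (sumᶜ g)) j ≡ seq (sumᴿ (re ∘ g)) j
re-sumᶜ {zero}  g j = refl
re-sumᶜ {suc n} g j = cong (seq (re (g zero)) j +_) (re-sumᶜ (g ∘ suc) j)

module _ {N W : ℕ} where

  open Isometry.Conjugation ℂ-commutativeSemiring conj conj-+ conj-* conj-0 {N} {W}
    using (norm²; norm²-isometry; norm²-measurement; norm²-swap)

  re-norm² : ∀ ψ → re (norm² ψ) ≈ᴿ normSq ψ
  re-norm² ψ = ≡⇒≈ᴿ λ j → trans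
    (re-sumᶜ (λ i → sumᶜ λ w → term i false w +ᶜ term i true w) j)
    (seq-sumᴿ-cong (λ i → re (sumᶜ λ w → term i false w +ᶜ term i true w))
      (λ i → sumᴿ λ w → modSq (ψ (i , false , w)) +ᴿ modSq (ψ (i , true , w))) j λ i → trans
      (re-sumᶜ (λ w → term i false w +ᶜ term i true w) j)
      (seq-sumᴿ-cong (λ w → re (term i false w +ᶜ term i true w))
        (λ w → modSq (ψ (i , false , w)) +ᴿ modSq (ψ (i , true , w))) j λ w →
        cong₂ _+_ (modulus (ψ (i , false , w)) j) (modulus (ψ (i , true , w)) j)))
    where
    term : Fin N → Bool → Fin W → ℂ
    term i b w = conj (ψ (i , b , w)) *ᶜ ψ (i , b , w)
    modulus : ∀ z j → seq (re (conj z *ᶜ z)) j ≡ seq (modSq z) j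
    modulus (a +i b) j = solve 2 (λ a b → a :* a :- (:- b) :* b := a :* a :+ b :* b) refl (seq a j) (seq b j)

  -- This holds at every index and not merely in the limit, because each term is a sum of rational
  -- squares.
  0≤normSq : ∀ (ψ : Vector {N} {W}) j → 0ℚ ℚ.≤ seq (normSq ψ) j
  0≤normSq ψ j = 0≤sum (λ i → sumᴿ λ w → modSq (ψ (i , false , w)) +ᴿ modSq (ψ (i , true , w))) λ i →
    0≤sum (λ w → modSq (ψ (i , false , w)) +ᴿ modSq (ψ (i , true , w))) λ w →
      ℚ.+-mono-≤ (0≤modSq (ψ (i , false , w))) (0≤modSq (ψ (i , true , w)))
    where
    0≤square : ∀ p → 0ℚ ℚ.≤ p * p
    0≤square p = subst (0ℚ ℚ.≤_) (trans (sym (ℚ.∣p*q∣≡∣p∣*∣q∣ p p)) (square p)) (0≤* (ℚ.0≤∣p∣ p) (ℚ.0≤∣p∣ p))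
      where
      square : ∀ p → abs (p * p) ≡ p * p
      square p with ℚ.≤-total 0ℚ p
      ... | inj₁ 0≤p = ℚ.0≤p⇒∣p∣≡p (0≤* 0≤p 0≤p)
      ... | inj₂ p≤0 = trans (cong abs (sym (neg-square p)))
          (trans (ℚ.0≤p⇒∣p∣≡p (0≤* (ℚ.neg-antimono-≤ p≤0) (ℚ.neg-antimono-≤ p≤0))) (neg-square p))
        where
        neg-square : ∀ p → (- p) * (- p) ≡ p * p
        neg-square = solve 1 (λ p → (:- p) :* (:- p) := p :* p) refl
    0≤modSq : ∀ z → 0ℚ ℚ.≤ seq (modSq z) j
    0≤modSq z = ℚ.+-mono-≤ (0≤square (seq (re z) j)) (0≤square (seq (im z) j))
    0≤sum : ∀ {n} (g : Fin n → ℝ) → (∀ i → 0ℚ ℚ.≤ seq (g i) j) → 0ℚ ℚ.≤ seq (sumᴿ g) j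
    0≤sum {zero}  g 0≤g = ℚ.≤-refl
    0≤sum {suc n} g 0≤g = ℚ.+-mono-≤ (0≤g zero) (0≤sum (g ∘ suc) (0≤g ∘ suc))

  normSq-isometry : ∀ A → compose (adjoint A) A ≈ᴼ identity → ∀ ψ →
    normSq (apply {N} {W} A ψ) ≈ᴿ normSq ψ
  normSq-isometry A isometry ψ =
    ≈ᴿ-trans {normSq (apply A ψ)} {re (norm² (apply A ψ))} {normSq ψ} (≈ᴿ-sym (re-norm² (apply A ψ)))
      (≈ᴿ-trans {re (norm² (apply A ψ))} {re (norm² ψ)} {normSq ψ} (proj₁ (norm²-isometry {A} isometry ψ)) (re-norm² ψ))

  normSq-oracle : ∀ x ψ → normSq (oracle {N} {W} x ψ) ≈ᴿ normSq ψ
  normSq-oracle x ψ =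
    ≈ᴿ-trans {normSq (oracle x ψ)} {re (norm² (oracle x ψ))} {normSq ψ} (≈ᴿ-sym (re-norm² (oracle x ψ)))
      (≈ᴿ-trans {re (norm² (oracle x ψ))} {re (norm² ψ)} {normSq ψ}
        (proj₁ (norm²-swap (λ i → bit (lookup x i)) ψ)) (re-norm² ψ))

  normSq-evolve : ∀ T U → (∀ j → IsUnitary (U j)) → ∀ x ψ → normSq (evolve {N} {W} T U x ψ) ≈ᴿ normSq ψ
  normSq-evolve zero    U unitary x ψ = normSq-isometry (U zero) (proj₁ (unitary zero)) ψ
  normSq-evolve (suc T) U unitary x ψ =
    ≈ᴿ-trans {normSq (evolve T (U ∘ suc) x (oracle x φ))} {normSq (oracle x φ)} {normSq ψ}
      (normSq-evolve T (U ∘ suc) (unitary ∘ suc) x (oracle x φ))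
      (≈ᴿ-trans {normSq (oracle x φ)} {normSq φ} {normSq ψ}
        (normSq-oracle x φ) (normSq-isometry (U zero) (proj₁ (unitary zero)) ψ))
    where φ = apply (U zero) ψ

  normSq-measurement : ∀ A A′ → (compose (adjoint A) A ⊕ compose (adjoint A′) A′) ≈ᴼ identity → ∀ ψ →
    normSq (apply {N} {W} A ψ) +ᴿ normSq (apply A′ ψ) ≈ᴿ normSq ψ
  normSq-measurement A A′ complete ψ =
    ≈ᴿ-trans {normSq (apply A ψ) +ᴿ normSq (apply A′ ψ)} {re (norm² (apply A ψ)) +ᴿ re (norm² (apply A′ ψ))} {normSq ψ}
      (+ᴿ-cong {normSq (apply A ψ)} {re (norm² (apply A ψ))} {normSq (apply A′ ψ)} {re (norm² (apply A′ ψ))}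
        (≈ᴿ-sym (re-norm² (apply A ψ))) (≈ᴿ-sym (re-norm² (apply A′ ψ))))
      (≈ᴿ-trans {re (norm² (apply A ψ)) +ᴿ re (norm² (apply A′ ψ))} {re (norm² ψ)} {normSq ψ}
        (proj₁ (norm²-measurement A A′ complete ψ)) (re-norm² ψ))

totalProbability : ∀ {N T} (𝒜 : QueryAlgorithm N T) x →
  outputProbability 𝒜 x Sign.- +ᴿ outputProbability 𝒜 x Sign.+ ≈ᴿ 1ᴿ
totalProbability {N} {T} 𝒜 x =
  ≈ᴿ-trans {outputProbability 𝒜 x Sign.- +ᴿ outputProbability 𝒜 x Sign.+} {normSq ψ} {1ᴿ}
    (normSq-measurement (M Sign.-) (M Sign.+) complete ψ)
    (≈ᴿ-trans {normSq ψ} {normSq start} {1ᴿ} (normSq-evolve T U unitary x start) unit)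
  where
  open QueryAlgorithm 𝒜 hiding (outputProbability)
  ψ = evolve T U x start

-- The polynomial method: amplitudes and probabilities as functions of low degree

module _ {N : ℕ} (j : ℕ) where

  -- The real and imaginary parts, cut off at the j-th approximation, are
  -- functions of the input of degree at most k.
  Degreeᶜ : ℕ → (Vec Sign N → ℂ) → Set
  Degreeᶜ k Z = Degree≤ coordinate k (λ x → seq (re (Z x)) j) ×
                Degree≤ coordinate k (λ x → seq (im (Z x)) j)

  degreeᶜ-*ˡ : ∀ {k Z} z → Degreeᶜ k Z → Degreeᶜ k (λ x → z *ᶜ Z x)
  degreeᶜ-*ˡ {Z = Z} (a +i b) (p , q) =
    ext (λ x → cong (seq a j * seq (re (Z x)) j +_)
        (sym (ℚ.neg-distribˡ-* (seq b j) (seq (im (Z x)) j))))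
      (add (degree-scale (seq a j) p) (degree-scale (- seq b j) q)) ,
    add (degree-scale (seq a j) q) (degree-scale (seq b j) p)

  degreeᶜ-sum : ∀ {k n} {Z : Fin n → Vec Sign N → ℂ} → (∀ i → Degreeᶜ k (Z i)) →
    Degreeᶜ k (λ x → sumᶜ (λ i → Z i x))
  degreeᶜ-sum {n = zero}  dZ = const 0ℚ , const 0ℚ
  degreeᶜ-sum {n = suc n} dZ = let p , q = dZ zero ; ps , qs = degreeᶜ-sum (dZ ∘ suc) in
    add p ps , add q qs

  -- The bit is `b` at sign +1 and `not b` at sign -1, so the value is the linear interpolation
  -- between the two in the queried coordinate. This is where one query costs one degree.
  degree-xor : ∀ {k} (g : Bool → Vec Sign N → ℚ) → (∀ b → Degree≤ coordinate k (g b)) →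
    ∀ i b → Degree≤ coordinate (suc k) (λ x → g (b xor bit (lookup x i)) x)
  degree-xor g dg i b = ext (λ x → interpolate (lookup x i) (λ b → g b x))
    (add (degree-mono (ℕ.n≤1+n _) (degree-scale ½ (add (dg b) (dg (not b)))))
         (mult i (degree-scale ½ (add (dg b) (degree-scale (- 1ℚ) (dg (not b)))))))
    where
    interpolate : ∀ s (h : Bool → ℚ) →
      ½ * (h b + h (not b)) + signℚ s * (½ * (h b + (- 1ℚ) * h (not b))) ≡ h (b xor bit s)
    interpolate Sign.+ h = trans
      (solve 2 (λ p q → con ½ :* (p :+ q) :+ con 1ℚ :* (con ½ :* (p :+ con (- 1ℚ) :* q)) := p) refl (h b) (h (not b)))
      (cong h (sym (xor-false b)))
      where
      xor-false : ∀ b → b xor false ≡ b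
      xor-false false = refl
      xor-false true  = refl
    interpolate Sign.- h = trans
      (solve 2 (λ p q → con ½ :* (p :+ q) :+ con (- 1ℚ) :* (con ½ :* (p :+ con (- 1ℚ) :* q)) := q) refl (h b) (h (not b)))
      (cong h (sym (xor-true b)))
      where
      xor-true : ∀ b → b xor true ≡ not b
      xor-true false = refl
      xor-true true  = refl

  degree-sumᴿ : ∀ {k n} {Z : Fin n → Vec Sign N → ℝ} → (∀ i → Degree≤ coordinate k (λ x → seq (Z i x) j)) →
    Degree≤ coordinate k (λ x → seq (sumᴿ (λ i → Z i x)) j)
  degree-sumᴿ {n = zero}  dZ = const 0ℚ
  degree-sumᴿ {n = suc n} dZ = add (dZ zero) (degree-sumᴿ (dZ ∘ suc))

  module _ {W : ℕ} where

    DegreeState : ℕ → (Vec Sign N → Vector {N} {W}) → Set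
    DegreeState k Ψ = ∀ r → Degreeᶜ k (λ x → Ψ x r)

    degree-apply : ∀ {k Ψ} A → DegreeState k Ψ → DegreeState k (λ x → apply A (Ψ x))
    degree-apply {Ψ = Ψ} A dΨ r = degreeᶜ-sum λ i → degreeᶜ-sum λ w →
      let p  , q  = degreeᶜ-*ˡ {Z = λ x → Ψ x (i , false , w)} (A r (i , false , w)) (dΨ (i , false , w))
          p′ , q′ = degreeᶜ-*ˡ {Z = λ x → Ψ x (i , true , w)} (A r (i , true , w)) (dΨ (i , true , w))
      in add p p′ , add q q′

    degree-oracle : ∀ {k Ψ} → DegreeState k Ψ → DegreeState (suc k) (λ x → oracle x (Ψ x))
    degree-oracle {Ψ = Ψ} dΨ (i , b , w) =
      degree-xor (λ c x → seq (re (Ψ x (i , c , w))) j) (λ c → proj₁ (dΨ (i , c , w))) i b ,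
      degree-xor (λ c x → seq (im (Ψ x (i , c , w))) j) (λ c → proj₂ (dΨ (i , c , w))) i b

    degree-evolve : ∀ T U {k Ψ} → DegreeState k Ψ → DegreeState (T ℕ.+ k) (λ x → evolve T U x (Ψ x))
    degree-evolve zero    U {Ψ = Ψ} dΨ = degree-apply {Ψ = Ψ} (U zero) dΨ
    degree-evolve (suc T) U {k} {Ψ} dΨ =
      subst (λ l → DegreeState l (λ x → evolve (suc T) U x (Ψ x))) (ℕ.+-suc T k)
        (degree-evolve T (U ∘ suc) {Ψ = λ x → oracle x (apply (U zero) (Ψ x))}
          (degree-oracle {Ψ = λ x → apply (U zero) (Ψ x)} (degree-apply {Ψ = Ψ} (U zero) dΨ)))

    degree-normSq : ∀ {k Ψ} → DegreeState k Ψ → Degree≤ coordinate (k ℕ.+ k) (λ x → seq (normSq (Ψ x)) j)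
    degree-normSq {Ψ = Ψ} dΨ = degree-sumᴿ λ i → degree-sumᴿ λ w →
      add (square (λ x → Ψ x (i , false , w)) (dΨ (i , false , w)))
          (square (λ x → Ψ x (i , true , w)) (dΨ (i , true , w)))
      where
      square : ∀ {k} Z → Degreeᶜ k Z → Degree≤ coordinate (k ℕ.+ k) (λ x → seq (modSq (Z x)) j)
      square Z (p , q) = add (degree-* p p) (degree-* q q)

-- The amplitudes have degree at most T and the squared modulus doubles it. The bound is exact at
-- each index `j`, since every operation is termwise.
degree-outputProbability : ∀ {N T} (𝒜 : QueryAlgorithm N T) v j →
  Degree≤ coordinate (T ℕ.+ T) (λ x → seq (outputProbability 𝒜 x v) j)
degree-outputProbability {N} {T} 𝒜 v j =
  degree-normSq j {Ψ = λ x → apply (M v) (evolve T U x start)} (degree-apply j {Ψ = λ x → evolve T U x start} (M v)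
    (subst (λ k → DegreeState j k (λ x → evolve T U x start)) (ℕ.+-identityʳ T)
      (degree-evolve j T U {0} {λ _ → start} (λ r → const (seq (re (start r)) j) , const (seq (im (start r)) j)))))
  where open QueryAlgorithm 𝒜

-- The cube is finite, so the thresholds of its points have a maximum.
eventually-∀ : ∀ {m} {Q : Vec Sign m → ℕ → Set} →
  (∀ x → ∃[ n ] ∀ j → n ≤ j → Q x j) → ∃[ n ] ∀ x j → n ≤ j → Q x j
eventually-∀ {zero}  ev = proj₁ (ev []) , λ { [] → proj₂ (ev []) }
eventually-∀ {suc m} ev =
  let a , h  = eventually-∀ (λ x → ev (Sign.- ∷ x))
      b , h′ = eventually-∀ (λ x → ev (Sign.+ ∷ x))
  in a ℕ.⊔ b , λ { (Sign.- ∷ x) j le → h  x j (ℕ.m⊔n≤o⇒m≤o a b le)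
                 ; (Sign.+ ∷ x) j le → h′ x j (ℕ.m⊔n≤o⇒n≤o a b le) }

-- The bias P(+1) - P(-1) of an algorithm, up to small errors.
record Bias {N} (f : Vec Sign N → Maybe Sign) (k : ℕ) : Set where
  field
    bias       : Vec Sign N → ℚ
    degree     : Degree≤ coordinate k bias
    bounded    : ∀ x → abs (bias x) ℚ.≤ ℤ.+ 31 ℚ./ 30
    correlated : ∀ x v → f x ≡ just v → ℤ.+ 7 ℚ./ 30 ℚ.≤ signℚ v * bias x

-- At a late index common to all inputs, the two probabilities sum to at most 1 + 1/30 and the
-- correct one is at least 2/3 - 1/30 = 19/30. As both are nonnegative, the bias is at most 31/30 in
-- absolute value; its correlation is at least 2 (19/30) - 31/30 = 7/30.
algorithm⇒bias : ∀ {N T} (f : PartialBoolean (Vec Sign N)) (𝒜 : QueryAlgorithm N T) →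
  Computes ⅓ᴿ f 𝒜 → Bias (value f) (T ℕ.+ T)
algorithm⇒bias {N} {T} f 𝒜 computes = record
  { bias       = λ x → P x Sign.+ j + (- 1ℚ) * P x Sign.- j
  ; degree     = add (degree-outputProbability 𝒜 Sign.+ j)
                     (degree-scale (- 1ℚ) (degree-outputProbability 𝒜 Sign.- j))
  ; bounded    = λ x → bounded (0≤P x Sign.+) (0≤P x Sign.-) (proj₁ (good x))
  ; correlated = λ x v eq → correlated v (proj₁ (good x)) (proj₂ (good x) v eq)
  }
  where
  P : Vec Sign N → Sign → ℕ → ℚ
  P x v j = seq (outputProbability 𝒜 x v) j
  0≤P : ∀ x v {j} → 0ℚ ℚ.≤ P x v j
  0≤P x v {j} = 0≤normSq (apply (M v) (evolve T U x start)) j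
    where open QueryAlgorithm 𝒜
  Good : Vec Sign N → ℕ → Set
  Good x j = (P x Sign.- j + P x Sign.+ j ℚ.≤ ℤ.+ 31 ℚ./ 30) ×
             (∀ v → value f x ≡ just v → ℤ.+ 19 ℚ./ 30 ℚ.≤ P x v j)
  1/30 : ℚ
  1/30 = ℤ.+ 1 ℚ./ 30
  good-x : ∀ x → ∃[ n ] ∀ j → n ≤ j → Good x j
  good-x x =
    let a , h  = _≈ᴿ_.eventually (totalProbability 𝒜 x) 1/30 (ℚ.positive⁻¹ 1/30)
        b , h′ = success (value f x) refl
    in a ℕ.⊔ b , λ j le →
      (let s = P x Sign.- j + P x Sign.+ j in
       subst₂ ℚ._≤_ (solve 1 (λ s → (s :- con 1ℚ) :+ con 1ℚ := s) refl s) refl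
         (ℚ.+-monoˡ-≤ 1ℚ (ℚ.≤-trans (p≤∣p∣ (s - 1ℚ)) (ℚ.<⇒≤ (h j (ℕ.m⊔n≤o⇒m≤o a b le)))))) ,
      h′ j (ℕ.m⊔n≤o⇒n≤o a b le)
    where
    success : ∀ u → value f x ≡ u →
      ∃[ n ] ∀ j → n ≤ j → ∀ v → value f x ≡ just v → ℤ.+ 19 ℚ./ 30 ℚ.≤ P x v j
    success nothing  eq = 0 , λ j _ v eq′ → ⊥-elim (contradict (trans (sym eq) eq′))
      where
      contradict : ∀ {v : Sign} → nothing ≡ just v → ⊥
      contradict ()
    success (just u) eq =
      let n , h = _≤ᴿ_.eventually (computes x u eq) 1/30 (ℚ.positive⁻¹ 1/30) in
      n , λ j n≤j v eq′ → subst (λ v → ℤ.+ 19 ℚ./ 30 ℚ.≤ P x v j) (just-injective (trans (sym eq) eq′))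
        (subst (ℤ.+ 19 ℚ./ 30 ℚ.≤_) (solve 1 (λ p → (p :+ con 1/30) :+ con (- 1/30) := p) refl (P x u j))
          (ℚ.+-monoˡ-≤ (- 1/30) (ℚ.<⇒≤ (h j n≤j))))
  uniform = eventually-∀ {Q = Good} good-x
  j = proj₁ uniform
  good : ∀ x → Good x j
  good x = proj₂ uniform x j ℕ.≤-refl
  bounded : ∀ {p q} → 0ℚ ℚ.≤ p → 0ℚ ℚ.≤ q → q + p ℚ.≤ ℤ.+ 31 ℚ./ 30 →
    abs (p + (- 1ℚ) * q) ℚ.≤ ℤ.+ 31 ℚ./ 30
  bounded {p} {q} 0≤p 0≤q le = ℚ.≤-trans (∣p∣≤
    (0≤-⇒≤ (subst (0ℚ ℚ.≤_) (solve 2 (λ p q → q :+ q := (q :+ p) :- (p :+ con (- 1ℚ) :* q)) refl p q) (ℚ.+-mono-≤ 0≤q 0≤q)))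
    (0≤-⇒≤ (subst (0ℚ ℚ.≤_) (solve 2 (λ p q → p :+ p := (q :+ p) :- (:- (p :+ con (- 1ℚ) :* q))) refl p q) (ℚ.+-mono-≤ 0≤p 0≤p)))) le
  correlated : ∀ v {j x} → P x Sign.- j + P x Sign.+ j ℚ.≤ ℤ.+ 31 ℚ./ 30 → ℤ.+ 19 ℚ./ 30 ℚ.≤ P x v j →
    ℤ.+ 7 ℚ./ 30 ℚ.≤ signℚ v * (P x Sign.+ j + (- 1ℚ) * P x Sign.- j)
  correlated Sign.- {j} {x} total le = 0≤-⇒≤ (subst (0ℚ ℚ.≤_)
    (solve 2 (λ p q → (con (ℤ.+ 31 ℚ./ 30) :- (q :+ p)) :+ ((q :- con (ℤ.+ 19 ℚ./ 30)) :+ (q :- con (ℤ.+ 19 ℚ./ 30))) :=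
                      con (- 1ℚ) :* (p :+ con (- 1ℚ) :* q) :- con (ℤ.+ 7 ℚ./ 30)) refl (P x Sign.+ j) (P x Sign.- j))
    (ℚ.+-mono-≤ (≤⇒0≤- total) (ℚ.+-mono-≤ (≤⇒0≤- le) (≤⇒0≤- le))))
  correlated Sign.+ {j} {x} total le = 0≤-⇒≤ (subst (0ℚ ℚ.≤_)
    (solve 2 (λ p q → (con (ℤ.+ 31 ℚ./ 30) :- (q :+ p)) :+ ((p :- con (ℤ.+ 19 ℚ./ 30)) :+ (p :- con (ℤ.+ 19 ℚ./ 30))) :=
                      con 1ℚ :* (p :+ con (- 1ℚ) :* q) :- con (ℤ.+ 7 ℚ./ 30)) refl (P x Sign.+ j) (P x Sign.- j))
    (ℚ.+-mono-≤ (≤⇒0≤- total) (ℚ.+-mono-≤ (≤⇒0≤- le) (≤⇒0≤- le))))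

-- Sorting the blocks

argmin : ∀ {n} (d : Fin (suc n) → ℕ) → ∃[ i ] ∀ j → d i ≤ d j
argmin {zero}  d = zero , λ { zero → ℕ.≤-refl }
argmin {suc n} d with argmin (d ∘ suc)
... | i , min with ℕ.≤-total (d zero) (d (suc i))
...   | inj₁ le = zero , λ { zero → ℕ.≤-refl ; (suc j) → ℕ.≤-trans le (min j) }
...   | inj₂ ge = suc i , λ { zero → ge ; (suc j) → min j }

zipWith-swap : ∀ a b c → zipWith Sign._*_ a (zipWith Sign._*_ b c) ≡ zipWith Sign._*_ b (zipWith Sign._*_ a c)
zipWith-swap (just u) (just v) (just w) = cong just (trans (sym (Sign.*-assoc u v w))
  (trans (cong (Sign._* w) (Sign.*-comm u v)) (Sign.*-assoc v u w)))
zipWith-swap nothing  nothing  c        = refl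
zipWith-swap nothing  (just v) nothing  = refl
zipWith-swap nothing  (just v) (just w) = refl
zipWith-swap (just u) nothing  nothing  = refl
zipWith-swap (just u) nothing  (just w) = refl
zipWith-swap (just u) (just v) nothing  = refl

⨂-value-insertAt : ∀ {n} {X : Set} (g : Fin (suc n) → X → Maybe Sign) xs i x →
  ⨂-value g (insertAt xs i x) ≡ zipWith Sign._*_ (g i x) (⨂-value (g ∘ punchIn i) xs)
⨂-value-insertAt g xs       zero    x = refl
⨂-value-insertAt g (y ∷ xs) (suc i) x = trans
  (cong (zipWith Sign._*_ (g zero y)) (⨂-value-insertAt (g ∘ suc) xs i x))
  (zipWith-swap (g zero y) (g (suc i) x) (⨂-value (g ∘ suc ∘ punchIn i) xs))

-- `ballot≥-orth` needs ascending blocks, but the f i come in any order. `unsort` restores the given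
-- order: `position` shows that it only moves entries, so degrees survive, and `unsort-⨂` that the
-- product of signs is unaffected, including where it is undefined.
record Sorting {n} (A : Set) (d : Fin n → ℕ) : Set where
  field
    order       : Fin n → Fin n
    ascending   : Ascending (d ∘ order)
    sum≡        : sum (d ∘ order) ≡ sum d
    unsort      : Vec A n → Vec A n
    position    : ∀ i → ∃[ j ] ∀ ys → lookup (unsort ys) i ≡ lookup ys j
    unsort-⨂   : ∀ (g : Fin n → A → Maybe Sign) ys → ⨂-value g (unsort ys) ≡ ⨂-value (g ∘ order) ys

sorting : ∀ {n} {A : Set} (d : Fin n → ℕ) → Sorting A d
sorting {zero} d = record
  { order = λ () ; ascending = [] ; sum≡ = refl ; unsort = λ ys → ys ; position = λ () ; unsort-⨂ = λ { _ [] → refl } }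
sorting {suc n} {A} d with argmin d
... | i , min = record
  { order     = λ { zero → i ; (suc j) → punchIn i (order j) }
  ; ascending = (λ j → min (punchIn i (order j))) ∷ ascending
  ; sum≡      = trans (cong (d i ℕ.+_) sum≡) (sym (sum-remove {i = i} d))
  ; unsort    = unsort′
  ; position  = position′
  ; unsort-⨂ = λ { g (y ∷ ys) → trans (⨂-value-insertAt g (unsort ys) i y)
                     (cong (zipWith Sign._*_ (g i y)) (unsort-⨂ (g ∘ punchIn i) ys)) }
  }
  where
  open Sorting (sorting {n} {A} (d ∘ punchIn i))
  unsort′ : Vec A (suc n) → Vec A (suc n)
  unsort′ (y ∷ ys) = insertAt (unsort ys) i y
  position′ : ∀ k → ∃[ j ] ∀ ys → lookup (unsort′ ys) k ≡ lookup ys j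
  position′ k with i ≟ᶠ k
  ... | yes refl = zero , λ { (y ∷ ys) → insertAt-lookup (unsort ys) i y }
  ... | no  i≢k  = let j , eq = position (punchOut i≢k) in
    suc j , λ { (y ∷ ys) → trans
      (cong (lookup (insertAt (unsort ys) i y)) (sym (punchIn-punchOut i≢k)))
      (trans (insertAt-punchIn (unsort ys) i y (punchOut i≢k)) (eq ys)) }

flatten-concat : ∀ {A : Set} {m n} (F : PartialBoolean (Vec (Vec A m) n)) xss →
  value (flatten F) (concat xss) ≡ value F xss
flatten-concat {m = m} {n} F xss = let yss , eq = group n m (concat xss) in
  cong (value F) (sym (concat-injective xss yss eq))

-- The bound

loss-≤ : ∀ n → loss n ℚ.≤ ℤ.+ 1 ℚ./ 7
loss-≤ n = 0≤-⇒≤ (subst (0ℚ ℚ.≤_)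
  (solve 1 (λ k → con (ℤ.+ 1 ℚ./ 7) :* k := con (ℤ.+ 1 ℚ./ 7) :- con (ℤ.+ 1 ℚ./ 7) :* (con 1ℚ :- k)) refl (κ ^ n))
  (0≤* (0≤? (ℤ.+ 1 ℚ./ 7)) (0≤^ (0≤? κ) n)))

-- Otherwise the ballot measure is orthogonal to degree at most 2T, hence to the bias, and the
-- correlation bound collapses to 7/30 ≤ (31/30)(1/7), which is false.
dual-sum-≤ : ∀ {n m} (f : Fin n → PartialBoolean (Vec Sign m)) (k : Fin n → ℕ) →
  (∀ i → DualPolynomial (value (f i)) (k i)) →
  ∀ {T} → Bias (value (flatten (⨂ f))) (T ℕ.+ T) → sum k ≤ 4 ℕ.* T
dual-sum-≤ {n} {m} f k dual {T} b with sum k ℕ.≤? 4 ℕ.* T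
... | yes le = le
... | no  ≰  = ⊥-elim (from-no ((ℤ.+ 7 ℚ./ 30) ℚ.≤? ((ℤ.+ 31 ℚ./ 30) * (ℤ.+ 1 ℚ./ 7))) (begin
    ℤ.+ 7 ℚ./ 30                                      ≤⟨ correlation ⟩
    ∫ Ψ E + (ℤ.+ 31 ℚ./ 30) * loss n                  ≡⟨ cong (_+ (ℤ.+ 31 ℚ./ 30) * loss n) (Ψ⊥ degree-E ℕ.≤-refl) ⟩
    0ℚ + (ℤ.+ 31 ℚ./ 30) * loss n                     ≡⟨ ℚ.+-identityˡ ((ℤ.+ 31 ℚ./ 30) * loss n) ⟩
    (ℤ.+ 31 ℚ./ 30) * loss n                          ≤⟨ ℚ.*-monoˡ-≤-nonNeg (ℤ.+ 31 ℚ./ 30) (loss-≤ n) ⟩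
    (ℤ.+ 31 ℚ./ 30) * (ℤ.+ 1 ℚ./ 7)                   ∎))
  where
  open ℚ.≤-Reasoning
  open Bias b
  open Sorting (sorting {n} {Vec Sign m} k)
  module D i = DualPolynomial (dual (order i))
  Ψ : Measure (Vec (Vec Sign m) n)
  Ψ = ballot≥ D.good D.bad 0
  E : Vec (Vec Sign m) n → ℚ
  E ys = bias (concat (unsort ys))
  degree-E : Degree≤ blockCoordinate (T ℕ.+ T) E
  degree-E = degree-∘ (concat ∘ unsort) rename degree
    where
    rename : ∀ v → ∃[ w ] ∀ ys → blockCoordinate w ys ≡ coordinate v (concat (unsort ys))
    rename v = let i , j = remQuot {n} m v ; i′ , eq = position i in
      (i′ , j) , λ ys → cong signℚ (trans (cong (λ y → lookup y j) (sym (eq ys)))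
        (trans (sym (lookup-concat (unsort ys) i j))
          (cong (lookup (concat (unsort ys))) (combine-remQuot {n} m v))))
  Ψ⊥ : Orth blockCoordinate (suc (T ℕ.+ T)) Ψ
  -- At excess 0 no credit is claimed, so `h` may be 0. For D = 2T + 1 the condition 2D ≤ 1 + sum k
  -- is exactly 4T < sum k.
  Ψ⊥ = ballot≥-orth D.good D.bad (k ∘ order) ascending D.orthogonal 0 (λ _ → z≤n) 0 (suc (T ℕ.+ T))
    (ℕ.≤-trans (ℕ.≤-reflexive (twice T)) (s≤s (ℕ.≤-trans (ℕ.≰⇒> ≰)
      (ℕ.≤-reflexive (trans (sym sum≡) (sym (ℕ.+-identityʳ (sum (k ∘ order)))))))))
    where
    twice : ∀ T → 2 ℕ.* suc (T ℕ.+ T) ≡ suc (suc (4 ℕ.* T))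
    twice = S.solve 1 (λ T → S.con 2 S.:* (S.con 1 S.:+ (T S.:+ T)) S.:= S.con 2 S.:+ S.con 4 S.:* T) refl
      where module S = ℕSolver.+-*-Solver
  correlation : ℤ.+ 7 ℚ./ 30 ℚ.≤ ∫ Ψ E + (ℤ.+ 31 ℚ./ 30) * loss n
  correlation = ballot≥-correlation (λ i → value (f (order i))) D.good D.bad D.aligned D.mass-good D.mass-bad
    E (ℤ.+ 31 ℚ./ 30) (ℤ.+ 7 ℚ./ 30) (0≤? (ℤ.+ 31 ℚ./ 30)) (λ ys → bounded (concat (unsort ys)))
    (λ ys v eq → correlated (concat (unsort ys)) v
      (trans (flatten-concat (⨂ f) (unsort ys)) (trans (unsort-⨂ (λ i → value (f i)) ys) eq)))

-- Natural numbers as rationals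

fromNat : ℕ → ℚ
fromNat n = ℤ.+ n ℚ./ 1

toℚᵘ-fromNat : ∀ n → ℚ.toℚᵘ (fromNat n) ℚᵘ.≃ mkℚᵘ (ℤ.+ n) 0
toℚᵘ-fromNat n = ℚ.toℚᵘ-fromℚᵘ (mkℚᵘ (ℤ.+ n) 0)

fromNat-+ : ∀ a b → fromNat (a ℕ.+ b) ≡ fromNat a + fromNat b
fromNat-+ a b = ℚ.toℚᵘ-injective (begin-equality
  ℚ.toℚᵘ (fromNat (a ℕ.+ b))                       ≃⟨ toℚᵘ-fromNat (a ℕ.+ b) ⟩
  mkℚᵘ (ℤ.+ (a ℕ.+ b)) 0                           ≃⟨ ℚᵘ.*≡* (cong (ℤ._* ℤ.1ℤ)
                                                      (sym (cong₂ ℤ._+_ (ℤ.*-identityʳ (ℤ.+ a)) (ℤ.*-identityʳ (ℤ.+ b))))) ⟩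
  mkℚᵘ (ℤ.+ a) 0 ℚᵘ.+ mkℚᵘ (ℤ.+ b) 0               ≃⟨ ℚᵘ.+-cong (toℚᵘ-fromNat a) (toℚᵘ-fromNat b) ⟨
  ℚ.toℚᵘ (fromNat a) ℚᵘ.+ ℚ.toℚᵘ (fromNat b)       ≃⟨ ℚ.toℚᵘ-homo-+ (fromNat a) (fromNat b) ⟨
  ℚ.toℚᵘ (fromNat a + fromNat b)                   ∎)
  where open ℚᵘ.≤-Reasoning

fromNat-* : ∀ a b → fromNat (a ℕ.* b) ≡ fromNat a * fromNat b
fromNat-* zero    b = sym (ℚ.*-zeroˡ (fromNat b))
fromNat-* (suc a) b = begin
  fromNat (b ℕ.+ a ℕ.* b)                 ≡⟨ fromNat-+ b (a ℕ.* b) ⟩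
  fromNat b + fromNat (a ℕ.* b)           ≡⟨ cong (fromNat b +_) (fromNat-* a b) ⟩
  fromNat b + fromNat a * fromNat b       ≡⟨ solve 2 (λ a b → b :+ a :* b := (con 1ℚ :+ a) :* b) refl (fromNat a) (fromNat b) ⟩
  (1ℚ + fromNat a) * fromNat b            ≡⟨ cong (_* fromNat b) (fromNat-+ 1 a) ⟨
  fromNat (suc a) * fromNat b             ∎
  where open ≡-Reasoning

0≤fromNat : ∀ a → 0ℚ ℚ.≤ fromNat a
0≤fromNat zero    = ℚ.≤-refl
0≤fromNat (suc a) = subst (0ℚ ℚ.≤_) (sym (fromNat-+ 1 a)) (ℚ.+-mono-≤ (0≤? 1ℚ) (0≤fromNat a))

fromNat-mono : ∀ {a b} → a ≤ b → fromNat a ℚ.≤ fromNat b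
fromNat-mono {a} {b} a≤b = subst₂ ℚ._≤_ (ℚ.+-identityʳ (fromNat a))
  (trans (sym (fromNat-+ a (b ℕ.∸ a))) (cong fromNat (ℕ.m+[n∸m]≡n a≤b)))
  (ℚ.+-monoʳ-≤ (fromNat a) (0≤fromNat (b ℕ.∸ a)))

fromNat>0 : ∀ a .{{_ : ℕ.NonZero a}} → 0ℚ ℚ.< fromNat a
fromNat>0 a = ℚ.<-≤-trans (ℚ.positive⁻¹ 1ℚ) (fromNat-mono (ℕ.>-nonZero⁻¹ a))

seq-sum-fromℕ : ∀ {n} (d : Fin n → ℕ) j → seq (sumᴿ (λ i → fromℕ (d i))) j ≡ fromNat (sum d)
seq-sum-fromℕ {zero}  d j = refl
seq-sum-fromℕ {suc n} d j = trans (cong (fromNat (d zero) +_) (seq-sum-fromℕ (d ∘ suc) j))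
  (sym (fromNat-+ (d zero) (sum (d ∘ suc))))

sum-≤ : ∀ {n} (d k : Fin n → ℕ) a → (∀ i → d i ≤ a ℕ.* k i) → sum d ≤ a ℕ.* sum k
sum-≤ {zero}  d k a le = z≤n
sum-≤ {suc n} d k a le = ℕ.≤-trans (ℕ.+-mono-≤ (le zero) (sum-≤ (d ∘ suc) (k ∘ suc) a (le ∘ suc)))
  (ℕ.≤-reflexive (sym (ℕ.*-distribˡ-+ a (k zero) (sum (k ∘ suc)))))

0<fromℚ : ∀ {q} → 0ℚ ℚ.< q → 0ᴿ <ᴿ fromℚ q
0<fromℚ {q} q>0 = mk<ᴿ (½ * q) (half-pos q>0) (0 , λ _ _ →
  subst (0ℚ + ½ * q ℚ.<_) (halves q) (ℚ.+-monoˡ-< (½ * q) (half-pos q>0)))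

theorem5p10 : ∃[ c ] (0ᴿ <ᴿ c ×
    (∀ (n m : ℕ) → 1 ≤ n → 1 ≤ m →
    (f : Fin n → PartialBoolean (Vec Sign m)) →
    (T : ℕ) → IsQueryComplexity ⅓ᴿ (flatten (⨂ f)) T →
    (d : Fin n → ℕ) → (∀ i → IsApproxDegree ⅓ᴿ (f i) (d i)) →
    c *ᴿ sumᴿ (λ i → fromℕ (d i)) ≤ᴿ fromℕ T))
theorem5p10 = fromℚ c , 0<fromℚ c>0 , λ n m _ _ f T ((𝒜 , computes) , _) d isDegree →
  let dual = λ i → approxDegree⇒dual (f i) (isDegree i)
      k    = λ i → proj₁ (dual i)
      Σk≤  = dual-sum-≤ f k (λ i → proj₂ (proj₂ (dual i))) {T} (algorithm⇒bias (flatten (⨂ f)) 𝒜 computes)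
      Σd≤  = ℕ.≤-trans (sum-≤ d k K (λ i → proj₁ (proj₂ (dual i)))) (ℕ.*-monoʳ-≤ K Σk≤)
  in ≤⇒≤ᴿ λ j → bound-c T (sum d) Σd≤ (seq-sum-fromℕ d j)
  where
  instance
    _ = K≢0
    _ = ℕ.m*n≢0 K 4
  -- The constant is 1 / (4K), as dictated by the chain sum d ≤ K * sum k ≤ K * 4T.
  inverse = divide (fromNat (K ℕ.* 4)) 1ℚ (fromNat>0 (K ℕ.* 4)) (ℚ.positive⁻¹ 1ℚ)
  c   = proj₁ inverse
  c>0 = proj₁ (proj₂ inverse)
  bound-c : ∀ T s → s ≤ K ℕ.* (4 ℕ.* T) → ∀ {q} → q ≡ fromNat s → c * q ℚ.≤ fromNat T
  bound-c T s s≤ refl = begin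
    c * fromNat s                               ≤⟨ ℚ.*-monoˡ-≤-nonNeg c {{ℚ.nonNegative (ℚ.<⇒≤ c>0)}} (fromNat-mono s≤) ⟩
    c * fromNat (K ℕ.* (4 ℕ.* T))               ≡⟨ cong (λ t → c * fromNat t) (ℕ.*-assoc K 4 T) ⟨
    c * fromNat (K ℕ.* 4 ℕ.* T)                 ≡⟨ cong (c *_) (fromNat-* (K ℕ.* 4) T) ⟩
    c * (fromNat (K ℕ.* 4) * fromNat T)         ≡⟨ solve 3 (λ c k t → c :* (k :* t) := (k :* c) :* t) refl c (fromNat (K ℕ.* 4)) (fromNat T) ⟩
    (fromNat (K ℕ.* 4) * c) * fromNat T         ≡⟨ cong (_* fromNat T) (proj₂ (proj₂ inverse)) ⟩
    1ℚ * fromNat T                              ≡⟨ ℚ.*-identityˡ (fromNat T) ⟩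
    fromNat T                                   ∎
    where open ℚ.≤-Reasoning
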